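{- For every $n$-vertex graph $H$ with maximum degree $3$, the size-Ramsey number satisfies $\hat{r}(H) \leq n^{3/2+o(1)}$, where $o(1)$ denotes a quantity tending to $0$ as $n\to\infty$.
   Context: The size-Ramsey number $\hat{r}(H)$ of a graph $H$ is the minimum number of edges of a graph $G$ such that every colouring of the edges of $G$ with two colours (red and blue) contains a monochromatic copy of $H$ (a copy of $H$ all of whose edges have the same colour). -}

module Defs where

open import Data.Nat using (ℕ; zero; suc; _+_; _*_; _^_; _≤_; _<ᵇ_)
open import Data.Fin using (Fin; toℕ)
open import Data.Bool using (Bool; true; false; _∧_; if_then_else_)
open import Data.List using (List; map; allFin)
open import Data.Nat.ListAction using (sum)
open import Data.Product using (Σ; ∃; ∃-syntax; _×_; _,_)
open import Relation.Binary.PropositionalEquality using (_≡_)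
open import Function.Definitions using (Injective)

record Graph (n : ℕ) : Set where
  field
    adj   : Fin n → Fin n → Bool
    sym   : ∀ i j → adj i j ≡ adj j i
    irrefl : ∀ i → adj i i ≡ false
open Graph public

degree : ∀ {n} → Graph n → Fin n → ℕ
degree G i = sum (map (λ j → if adj G i j then 1 else 0) (allFin _))

MaxDegree≤ : ∀ {n} → ℕ → Graph n → Set
MaxDegree≤ d G = ∀ i → degree G i ≤ d

edgeCount : ∀ {n} → Graph n → ℕ
edgeCount G = sum (map (λ i → sum (map (λ j →
  if (toℕ i <ᵇ toℕ j) ∧ adj G i j then 1 else 0) (allFin _))) (allFin _))

-- a 2-colouring of the edges of G (colours are Bool: red/blue), i.e. a
-- symmetric colouring of vertex pairs (values on non-edges are irrelevant)
Colouring : ℕ → Set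
Colouring v = Fin v → Fin v → Bool

SymmetricColouring : ∀ {v} → Colouring v → Set
SymmetricColouring c = ∀ i j → c i j ≡ c j i

MonoCopy : ∀ {n v} → (H : Graph n) → (G : Graph v) → Colouring v → Set
MonoCopy {n} {v} H G c =
  Σ Bool λ col → Σ (Fin n → Fin v) λ f → Injective _≡_ _≡_ f ×
    (∀ x y → adj H x y ≡ true → (adj G (f x) (f y) ≡ true) × (c (f x) (f y) ≡ col))

Arrows : ∀ {n v} → Graph v → Graph n → Set
Arrows G H = ∀ (c : Colouring _) → SymmetricColouring c → MonoCopy H G c

SizeRamsey≤ : ∀ {n} → Graph n → ℕ → Set
SizeRamsey≤ H m = ∃[ v ] Σ (Graph v) λ G → Arrows G H × edgeCount G ≤ m

{-# OPTIONS --safe #-}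
module Submission where

-- The host has vertices (i , j , l) with i , j < 2R and a label l from a constant
-- set; distinct vertices are adjacent when they share i, j or i + j.  For numbers
-- P 1 , … , P N below R consider the points (P a − P b , P b − P c): by Ramsey's
-- theorem for 6-sets one may assume that the colour of a host edge between such
-- points only depends on which of i, j, i + j is shared, so two of these three
-- directions have the same colour.  By averaging, a positive proportion of all
-- choices of coordinates yields monochromatic grids with these two directions as
-- rows and columns, and by dependent random choice the graph can be embedded
-- into this dense family one coordinate at a time.
--
-- The graph H is prepared as follows: its edges are split into two classes with
-- bounded components such that every edge has its ends in a common component of
-- exactly one class.  Vertices then share a row coordinate within a component of
-- the first class, and a column coordinate within a component of the second.
-- To get the classes, cover H by paths no two of which have adjacent ends and
-- cut the paths into bounded pieces at edges that form an independent transversal;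
-- the first class consists of the remaining path edges, the second of all others.
--
-- A coordinate value may be used by about √n vertices of H, so R need exceed √n by
-- a small power of n only, and the host has O(R³) edges.

open import Defs hiding (sym)
open import Data.Nat
open import Data.Nat.Properties
open import Data.Nat.ListAction using (sum)
open import Data.Nat.Tactic.RingSolver using (solve-∀)
open import Data.Bool as B using (Bool; true; false; _∧_; _∨_; not; if_then_else_)
open import Data.Bool.ListAction using (all)
import Data.Bool.Properties as BP
open import Data.Fin as F using (Fin; zero; suc; toℕ; fromℕ<; combine; remQuot)
import Data.Fin.Properties as FP
open import Data.List as L using (List; []; _∷_; _++_; length; map; concatMap; allFin; filterᵇ; take; cartesianProduct)
import Data.List.Properties as LP
open import Data.List.Membership.Propositional using (_∈_)
import Data.List.Membership.Propositional.Properties as MP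
import Data.List.Membership.DecPropositional as DecMem
open import Data.List.Relation.Unary.Any as Any using (Any; here; there)
import Data.List.Relation.Unary.Any.Properties as AnyP
open import Data.List.Relation.Unary.All as All using (All; []; _∷_)
open import Data.List.Relation.Unary.AllPairs using (AllPairs; []; _∷_)
open import Data.List.Relation.Unary.Unique.Propositional using (Unique)
import Data.List.Relation.Unary.Unique.Propositional.Properties as UP
open import Data.List.Relation.Binary.Sublist.Propositional as S using (_⊆_; []; _∷_; _∷ʳ_; ⊆-refl; ⊆-trans; minimum)
open import Data.List.Relation.Binary.Sublist.Propositional.Properties using (++⁺)
open import Data.List.Relation.Binary.Permutation.Propositional
  using (_↭_; ↭-refl; ↭-trans; ↭-sym; ↭-prep; ↭-reflexive; ↭⇒↭ₛ; module PermutationReasoning)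
open import Data.List.Relation.Binary.Permutation.Propositional.Properties using (++-comm; ++⁺ˡ; ++⁺ʳ; ↭-length; ∈-resp-↭)
import Data.List.Relation.Binary.Permutation.Setoid.Properties as SetoidPerm
open import Data.Vec as V using (Vec; []; _∷_; tabulate; toList)
import Data.Vec.Properties as VP
open import Data.Product using (∃; ∃-syntax; _×_; _,_; proj₁; proj₂)
import Data.Product.Properties as ProdP
open import Data.Sum using (_⊎_; inj₁; inj₂; [_,_]′)
open import Data.Empty using (⊥; ⊥-elim)
open import Data.Unit using (⊤; tt)
open import Relation.Nullary
open import Relation.Nullary.Decidable using (does; dec-true; dec-false; _×-dec_; _⊎-dec_; ¬?)
open import Relation.Binary.Definitions using (tri<; tri≈; tri>)
open import Relation.Binary.PropositionalEquality hiding ([_])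
open import Function using (_∘_; id)

-- A grid controls an edge of `H` only if its ends agree in one coordinate and occupy different
-- slots of the other. This is why the two edge classes must be exclusive. An edge may well have its
-- ends joined by both classes, and a fixed-point argument removes such coincidences; it relies on
-- both classes being forests, where dropping an edge separates its ends. Every further coordinate
-- costs a constant factor of density, so their number cannot depend on n. Hence coordinates are
-- slots from a bounded palette: components that meet a common component of the other kind use
-- different slots, and one slot serves many components with various values. The Ramsey step needs
-- 6-sets because two points in one direction involve four indices and their labels two more. The
-- loss of n^o(1) is caused by dependent random choice: the bad tuples number a fixed power of R,
-- and a bounded number of rounds beats this only if R/β is itself a fixed power of n, though an
-- arbitrarily small one.

private variable
  X Y : Set

-- Sums and counting

∑ : List X → (X → ℕ) → ℕ
∑ []       f = 0
∑ (x ∷ xs) f = f x + ∑ xs f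

⟦_⟧ : Bool → ℕ
⟦ true ⟧  = 1
⟦ false ⟧ = 0

count : (X → Bool) → List X → ℕ
count p xs = ∑ xs (λ x → ⟦ p x ⟧)

⟦⟧≤1 : ∀ b → ⟦ b ⟧ ≤ 1
⟦⟧≤1 true  = ≤-refl
⟦⟧≤1 false = z≤n

∑-mono-∈ : ∀ (xs : List X) {f g : X → ℕ} → (∀ {x} → x ∈ xs → f x ≤ g x) → ∑ xs f ≤ ∑ xs g
∑-mono-∈ []       h = z≤n
∑-mono-∈ (x ∷ xs) h = +-mono-≤ (h (here refl)) (∑-mono-∈ xs (h ∘ there))

∑-mono : ∀ (xs : List X) {f g : X → ℕ} → (∀ x → f x ≤ g x) → ∑ xs f ≤ ∑ xs g
∑-mono xs h = ∑-mono-∈ xs (λ {x} _ → h x)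

∑-cong : ∀ (xs : List X) {f g : X → ℕ} → (∀ x → f x ≡ g x) → ∑ xs f ≡ ∑ xs g
∑-cong []       h = refl
∑-cong (x ∷ xs) h = cong₂ _+_ (h x) (∑-cong xs h)

∑-+ : ∀ (xs : List X) (f g : X → ℕ) → ∑ xs (λ x → f x + g x) ≡ ∑ xs f + ∑ xs g
∑-+ []       f g = refl
∑-+ (x ∷ xs) f g rewrite ∑-+ xs f g = lem (f x) (g x) (∑ xs f) (∑ xs g)
  where
  lem : ∀ a b c d → a + b + (c + d) ≡ a + c + (b + d)
  lem = solve-∀

∑-*ˡ : ∀ c (xs : List X) (f : X → ℕ) → ∑ xs (λ x → c * f x) ≡ c * ∑ xs f
∑-*ˡ c []       f = sym (*-zeroʳ c)
∑-*ˡ c (x ∷ xs) f rewrite ∑-*ˡ c xs f = sym (*-distribˡ-+ c (f x) (∑ xs f))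

∑-const : ∀ (xs : List X) c → ∑ xs (λ _ → c) ≡ length xs * c
∑-const []       c = refl
∑-const (x ∷ xs) c = cong (c +_) (∑-const xs c)

∑-0 : ∀ (xs : List X) → ∑ xs (λ _ → 0) ≡ 0
∑-0 []       = refl
∑-0 (x ∷ xs) = ∑-0 xs

∑-≤const : ∀ (xs : List X) {f : X → ℕ} {c} → (∀ x → f x ≤ c) → ∑ xs f ≤ length xs * c
∑-≤const xs {f} {c} h = ≤-trans (∑-mono xs h) (≤-reflexive (∑-const xs c))

∑-≤const-∈ : ∀ (xs : List X) {f : X → ℕ} {c} → (∀ {x} → x ∈ xs → f x ≤ c) → ∑ xs f ≤ length xs * c
∑-≤const-∈ xs {f} {c} h = ≤-trans (∑-mono-∈ xs h) (≤-reflexive (∑-const xs c))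

∑-swap : ∀ (xs : List X) (ys : List Y) (f : X → Y → ℕ) →
         ∑ xs (λ x → ∑ ys (f x)) ≡ ∑ ys (λ y → ∑ xs (λ x → f x y))
∑-swap []       ys f = sym (∑-0 ys)
∑-swap (x ∷ xs) ys f rewrite ∑-swap xs ys f = sym (∑-+ ys (f x) (λ y → ∑ xs (λ x → f x y)))

∑-++ : ∀ (xs ys : List X) (f : X → ℕ) → ∑ (xs ++ ys) f ≡ ∑ xs f + ∑ ys f
∑-++ []       ys f = refl
∑-++ (x ∷ xs) ys f rewrite ∑-++ xs ys f = sym (+-assoc (f x) _ _)

∑-map : ∀ (h : X → Y) (xs : List X) (f : Y → ℕ) → ∑ (map h xs) f ≡ ∑ xs (f ∘ h)
∑-map h []       f = refl
∑-map h (x ∷ xs) f = cong (f (h x) +_) (∑-map h xs f)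

∑-concatMap : ∀ (h : X → List Y) (xs : List X) (f : Y → ℕ) →
              ∑ (concatMap h xs) f ≡ ∑ xs (λ x → ∑ (h x) f)
∑-concatMap h []       f = refl
∑-concatMap h (x ∷ xs) f = trans (∑-++ (h x) (concatMap h xs) f) (cong (∑ (h x) f +_) (∑-concatMap h xs f))

∑-member : ∀ {xs : List X} (f : X → ℕ) {x} → x ∈ xs → f x ≤ ∑ xs f
∑-member {xs = x ∷ xs} f (here refl) = m≤m+n _ _
∑-member {xs = x ∷ xs} f (there m)   = ≤-trans (∑-member f m) (m≤n+m _ _)

-- Averaging in place of expectation: a random choice becomes a sum over all choices, compared
-- without division.
∑≤⇒∃≤ : ∀ (xs : List X) (f g : X → ℕ) → 0 < length xs → ∑ xs f ≤ ∑ xs g →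
        ∃ λ x → x ∈ xs × f x ≤ g x
∑≤⇒∃≤ {X} (x ∷ xs) f g _ h = go x xs h
  where
  go : ∀ x (xs : List X) → ∑ (x ∷ xs) f ≤ ∑ (x ∷ xs) g → ∃ λ y → y ∈ x ∷ xs × f y ≤ g y
  go x []       h = x , here refl , subst₂ _≤_ (+-identityʳ _) (+-identityʳ _) h
  go x (y ∷ ys) h with f x ≤? g x
  ... | yes p = x , here refl , p
  ... | no ¬p with go y ys (≮⇒≥ λ q → <⇒≱ (+-mono-< (≰⇒> ¬p) q) h)
  ...   | z , m , q = z , there m , q

count-≤ : ∀ (p : X → Bool) xs → count p xs ≤ length xs
count-≤ p xs = ≤-trans (∑-≤const xs (λ x → ⟦⟧≤1 (p x))) (≤-reflexive (*-identityʳ _))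

⟦⟧-mono : ∀ {a b} → (a ≡ true → b ≡ true) → ⟦ a ⟧ ≤ ⟦ b ⟧
⟦⟧-mono {false} h = z≤n
⟦⟧-mono {true}  h rewrite h refl = ≤-refl

count-mono : ∀ {p q : X → Bool} xs → (∀ x → p x ≡ true → q x ≡ true) → count p xs ≤ count q xs
count-mono xs h = ∑-mono xs (λ x → ⟦⟧-mono (h x))

count-cong : ∀ {p q : X → Bool} xs → (∀ x → p x ≡ q x) → count p xs ≡ count q xs
count-cong xs h = ∑-cong xs (λ x → cong ⟦_⟧ (h x))

count>0⇒∃ : ∀ (p : X → Bool) xs → 0 < count p xs → ∃ λ x → x ∈ xs × p x ≡ true
count>0⇒∃ p (x ∷ xs) h with p x in eq
... | true  = x , here refl , eq
... | false with count>0⇒∃ p xs h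
...   | y , m , q = y , there m , q

count<⇒∃ : ∀ (p q : X → Bool) xs → count p xs < count q xs → ∃ λ x → x ∈ xs × p x ≡ false × q x ≡ true
count<⇒∃ p q (x ∷ xs) h with p x in ep | q x in eq
... | false | true  = x , here refl , ep , eq
... | true  | true  = let y , m , r = count<⇒∃ p q xs (s≤s⁻¹ h) in y , there m , r
... | true  | false = let y , m , r = count<⇒∃ p q xs (≤-trans (n≤1+n _) h) in y , there m , r
... | false | false = let y , m , r = count<⇒∃ p q xs h in y , there m , r

-- The union bound. With events `q y` that hold at most once it also yields counting by injections.
count-⋃ : ∀ (p : X → Bool) (xs : List X) (ys : List Y) (q : Y → X → Bool) →
          (∀ x → p x ≡ true → ∃ λ y → y ∈ ys × q y x ≡ true) →
          count p xs ≤ ∑ ys (λ y → count (q y) xs)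
count-⋃ p xs ys q h = ≤-trans (∑-mono xs pt) (≤-reflexive (∑-swap xs ys (λ x y → ⟦ q y x ⟧)))
  where
  pt : ∀ x → ⟦ p x ⟧ ≤ ∑ ys (λ y → ⟦ q y x ⟧)
  pt x with p x in eq
  ... | false = z≤n
  ... | true  = let y , m , r = h x eq in
                ≤-trans (≤-reflexive (sym (cong ⟦_⟧ r))) (∑-member (λ y → ⟦ q y x ⟧) m)

count-∨ : ∀ (p q r : X → Bool) xs → (∀ x → p x ≡ true → q x ≡ true ⊎ r x ≡ true) →
          count p xs ≤ count q xs + count r xs
count-∨ p q r xs h = ≤-trans (∑-mono xs pt) (≤-reflexive (∑-+ xs _ _))
  where
  pt : ∀ x → ⟦ p x ⟧ ≤ ⟦ q x ⟧ + ⟦ r x ⟧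
  pt x with p x in eq
  ... | false = z≤n
  ... | true with h x eq
  ...   | inj₁ e rewrite e = s≤s z≤n
  ...   | inj₂ e rewrite e = m≤n+m 1 ⟦ q x ⟧

length-filterᵇ : ∀ (p : X → Bool) xs → length (filterᵇ p xs) ≡ count p xs
length-filterᵇ p []       = refl
length-filterᵇ p (x ∷ xs) with p x
... | true  = cong suc (length-filterᵇ p xs)
... | false = length-filterᵇ p xs

∈-filterᵇ⁺ : ∀ (p : X → Bool) {xs x} → x ∈ xs → p x ≡ true → x ∈ filterᵇ p xs
∈-filterᵇ⁺ p {x ∷ xs} (here refl) e with p x
∈-filterᵇ⁺ p {x ∷ xs} (here refl) refl | true = here refl
∈-filterᵇ⁺ p {y ∷ xs} (there m) e with p y
... | true  = there (∈-filterᵇ⁺ p m e)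
... | false = ∈-filterᵇ⁺ p m e

∈-filterᵇ⁻ : ∀ (p : X → Bool) {xs x} → x ∈ filterᵇ p xs → x ∈ xs × p x ≡ true
∈-filterᵇ⁻ p {y ∷ xs} m with p y in e
∈-filterᵇ⁻ p {y ∷ xs} (here refl) | true = here refl , e
∈-filterᵇ⁻ p {y ∷ xs} (there m)   | true = let a , b = ∈-filterᵇ⁻ p m in there a , b
... | false = let a , b = ∈-filterᵇ⁻ p {xs} m in there a , b

∑-filterᵇ : ∀ (p : X → Bool) xs (f : X → ℕ) → ∑ (filterᵇ p xs) f ≡ ∑ xs (λ x → ⟦ p x ⟧ * f x)
∑-filterᵇ p []       f = refl
∑-filterᵇ p (x ∷ xs) f with p x
... | true  = cong₂ _+_ (sym (+-identityʳ (f x))) (∑-filterᵇ p xs f)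
... | false = ∑-filterᵇ p xs f

does-true : ∀ {P : Set} (d : Dec P) → does d ≡ true → P
does-true (yes p) _ = p

does-false : ∀ {P : Set} (d : Dec P) → does d ≡ false → ¬ P
does-false (no p) _ = p

∧-true : ∀ {a b} → a ∧ b ≡ true → a ≡ true × b ≡ true
∧-true {true} {true} _ = refl , refl

∧-intro : ∀ {a b} → a ≡ true → b ≡ true → a ∧ b ≡ true
∧-intro refl refl = refl

not-true : ∀ {a} → not a ≡ true → a ≡ false
not-true {false} _ = refl

not-intro : ∀ {a} → a ≡ false → not a ≡ true
not-intro refl = refl

allFin-suc : ∀ n → allFin (suc n) ≡ zero ∷ map suc (allFin n)
allFin-suc n = cong (zero ∷_) (sym (LP.map-tabulate id suc))

length-allFin : ∀ n → length (allFin n) ≡ n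
length-allFin n = LP.length-tabulate id

count-single : ∀ {n} (i : Fin n) → count (λ j → does (j F.≟ i)) (allFin n) ≡ 1
count-single {suc n} zero    = trans (cong (count (λ j → does (j F.≟ zero))) (allFin-suc n))
  (cong suc (trans (∑-map F.suc (allFin n) (λ j → ⟦ does (j F.≟ zero) ⟧)) (∑-0 (allFin n))))
count-single {suc n} (suc i) = trans (cong (count (λ j → does (j F.≟ suc i))) (allFin-suc n))
  (trans (∑-map F.suc (allFin n) (λ j → ⟦ does (j F.≟ suc i) ⟧))
    (trans (count-cong (allFin n) h) (count-single i)))
  where
  h : ∀ j → does (suc j F.≟ suc i) ≡ does (j F.≟ i)
  h j with j F.≟ i
  ... | yes _ = refl
  ... | no  _ = refl

count-⊆ : ∀ {n} (p : Fin n → Bool) (ys : List (Fin n)) → (∀ i → p i ≡ true → i ∈ ys) →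
          count p (allFin n) ≤ length ys
count-⊆ {n} p ys h = begin
  count p (allFin n)
    ≤⟨ count-⋃ p (allFin n) ys (λ y x → does (x F.≟ y)) (λ x e → x , h x e , dec-true (x F.≟ x) refl) ⟩
  ∑ ys (λ y → count (λ x → does (x F.≟ y)) (allFin n))
    ≡⟨ ∑-cong ys count-single ⟩
  ∑ ys (λ _ → 1)
    ≡⟨ trans (∑-const ys 1) (*-identityʳ _) ⟩
  length ys ∎
  where open ≤-Reasoning

count-inj : ∀ {m n} (f : Fin m → Fin n) → (∀ i j → f i ≡ f j → i ≡ j) → (p : Fin m → Bool) (q : Fin n → Bool) →
            (∀ i → p i ≡ true → q (f i) ≡ true) → count p (allFin m) ≤ count q (allFin n)
count-inj {m} {n} f inj p q h = begin
  count p (allFin m)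
    ≤⟨ count-⋃ p (allFin m) (filterᵇ q (allFin n)) (λ y x → does (f x F.≟ y))
        (λ x e → f x , ∈-filterᵇ⁺ q (MP.∈-allFin (f x)) (h x e) , dec-true (f x F.≟ f x) refl) ⟩
  ∑ (filterᵇ q (allFin n)) (λ y → count (λ x → does (f x F.≟ y)) (allFin m))
    ≤⟨ ∑-≤const (filterᵇ q (allFin n)) one ⟩
  length (filterᵇ q (allFin n)) * 1
    ≡⟨ trans (*-identityʳ _) (length-filterᵇ q (allFin n)) ⟩
  count q (allFin n) ∎
  where
  open ≤-Reasoning
  one : ∀ y → count (λ x → does (f x F.≟ y)) (allFin m) ≤ 1
  one y with count (λ x → does (f x F.≟ y)) (allFin m) in eq
  ... | zero  = z≤n
  ... | suc c with count>0⇒∃ (λ x → does (f x F.≟ y)) (allFin m) (subst (0 <_) (sym eq) (s≤s z≤n))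
  ...   | x₀ , _ , e₀ = subst (_≤ 1) eq (count-⊆ _ (x₀ ∷ []) λ i e →
            here (inj i x₀ (trans (does-true (f i F.≟ y) e) (sym (does-true (f x₀ F.≟ y) e₀)))))

-- The uniform measure on coordinate vectors

vecs : (R r : ℕ) → List (Vec (Fin R) r)
vecs R zero    = [] ∷ []
vecs R (suc r) = concatMap (λ g → map (g ∷_) (vecs R r)) (allFin R)

∑-vecs : ∀ R r (f : Vec (Fin R) (suc r) → ℕ) →
         ∑ (vecs R (suc r)) f ≡ ∑ (allFin R) (λ g → ∑ (vecs R r) (λ e → f (g ∷ e)))
∑-vecs R r f = trans (∑-concatMap _ (allFin R) f) (∑-cong (allFin R) (λ g → ∑-map (g ∷_) (vecs R r) f))

length≡∑1 : ∀ (xs : List X) → length xs ≡ ∑ xs (λ _ → 1)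
length≡∑1 xs = sym (trans (∑-const xs 1) (*-identityʳ _))

length-vecs : ∀ R r → length (vecs R r) ≡ R ^ r
length-vecs R zero    = refl
length-vecs R (suc r) = begin
  length (vecs R (suc r))                          ≡⟨ length≡∑1 (vecs R (suc r)) ⟩
  ∑ (vecs R (suc r)) (λ _ → 1)                     ≡⟨ ∑-vecs R r _ ⟩
  ∑ (allFin R) (λ _ → ∑ (vecs R r) (λ _ → 1))      ≡⟨ ∑-const (allFin R) _ ⟩
  length (allFin R) * ∑ (vecs R r) (λ _ → 1)       ≡⟨ cong₂ _*_ (length-allFin R) (trans (sym (length≡∑1 (vecs R r))) (length-vecs R r)) ⟩
  R * R ^ r ∎
  where open ≡-Reasoning

∈-vecs : ∀ R r (e : Vec (Fin R) r) → e ∈ vecs R r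
∈-vecs R zero    []      = here refl
∈-vecs R (suc r) (g ∷ e) =
  MP.∈-concatMap⁺ (λ g → map (g ∷_) (vecs R r)) (AnyP.tabulate⁺ g (MP.∈-map⁺ (g ∷_) (∈-vecs R r e)))

-- Resampling one coordinate preserves the uniform measure.
∑-resample : ∀ R r (i : Fin r) (f : Vec (Fin R) r → ℕ) →
             ∑ (vecs R r) (λ e → ∑ (allFin R) (λ g → f (e V.[ i ]≔ g))) ≡ R * ∑ (vecs R r) f
∑-resample R (suc r) zero f = begin
  ∑ (vecs R (suc r)) (λ e → ∑ (allFin R) (λ g → f (e V.[ zero ]≔ g)))
    ≡⟨ ∑-vecs R r _ ⟩
  ∑ (allFin R) (λ _ → ∑ (vecs R r) (λ e → ∑ (allFin R) (λ g → f (g ∷ e))))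
    ≡⟨ ∑-const (allFin R) _ ⟩
  length (allFin R) * ∑ (vecs R r) (λ e → ∑ (allFin R) (λ g → f (g ∷ e)))
    ≡⟨ cong₂ _*_ (length-allFin R) (trans (∑-swap (vecs R r) (allFin R) _) (sym (∑-vecs R r f))) ⟩
  R * ∑ (vecs R (suc r)) f ∎
  where open ≡-Reasoning
∑-resample R (suc r) (suc i) f = begin
  ∑ (vecs R (suc r)) (λ e → ∑ (allFin R) (λ g → f (e V.[ suc i ]≔ g)))
    ≡⟨ ∑-vecs R r _ ⟩
  ∑ (allFin R) (λ h → ∑ (vecs R r) (λ e → ∑ (allFin R) (λ g → f (h ∷ (e V.[ i ]≔ g)))))
    ≡⟨ ∑-cong (allFin R) (λ h → ∑-resample R r i (λ e → f (h ∷ e))) ⟩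
  ∑ (allFin R) (λ h → R * ∑ (vecs R r) (λ e → f (h ∷ e)))
    ≡⟨ ∑-*ˡ R (allFin R) _ ⟩
  R * ∑ (allFin R) (λ h → ∑ (vecs R r) (λ e → f (h ∷ e)))
    ≡⟨ cong (R *_) (sym (∑-vecs R r f)) ⟩
  R * ∑ (vecs R (suc r)) f ∎
  where open ≡-Reasoning

-- Ramsey's theorem

take-⊆ : ∀ m (xs : List X) → take m xs ⊆ xs
take-⊆ zero    []       = []
take-⊆ zero    (x ∷ xs) = x ∷ʳ take-⊆ zero xs
take-⊆ (suc m) []       = []
take-⊆ (suc m) (x ∷ xs) = refl ∷ take-⊆ m xs

length-take-≤ : ∀ m (xs : List X) → m ≤ length xs → length (take m xs) ≡ m
length-take-≤ m xs h = trans (LP.length-take m xs) (m≤n⇒m⊓n≡m h)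

Homogeneous : ∀ {q} → ℕ → (List X → Fin q) → Fin q → List X → Set
Homogeneous r col c ys = ∀ {t} → t ⊆ ys → length t ≡ r → col t ≡ c

-- The sequences of the Erdős-Rado argument: the colour of a set of size `r + 1` is determined by
-- its first element, and `cs` lists these colours.
EndHomogeneous : ∀ {q} → ℕ → (List X → Fin q) → List X → List (Fin q) → Set
EndHomogeneous r col []       []       = ⊤
EndHomogeneous r col (a ∷ zs) (c ∷ cs) = Homogeneous r (λ t → col (a ∷ t)) c zs × EndHomogeneous r col zs cs
EndHomogeneous r col _        _        = ⊥

module _ {q : ℕ} where

  pick : Fin q → List X → List (Fin q) → List X
  pick c (a ∷ zs) (c′ ∷ cs) with c F.≟ c′
  ... | yes _ = a ∷ pick c zs cs
  ... | no  _ = pick c zs cs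
  pick c _ _ = []

  pick-⊆ : ∀ c (zs : List X) cs → pick c zs cs ⊆ zs
  pick-⊆ c []       cs = []
  pick-⊆ c (a ∷ zs) [] = a ∷ʳ subst (_⊆ zs) (lem zs) (pick-⊆ c zs [])
    where
    lem : ∀ (zs : List _) → pick c zs [] ≡ []
    lem []       = refl
    lem (x ∷ zs) = refl
  pick-⊆ c (a ∷ zs) (c′ ∷ cs) with c F.≟ c′
  ... | yes _ = refl ∷ pick-⊆ c zs cs
  ... | no  _ = a ∷ʳ pick-⊆ c zs cs

  -- The sublists picked for the various colours partition `zs`, so pigeonhole finds a long one.
  ∑-pick : ∀ r (col : List X → Fin q) zs cs → EndHomogeneous r col zs cs →
           ∑ (allFin q) (λ c → length (pick c zs cs)) ≡ length zs
  ∑-pick r col []       []       _ = ∑-0 (allFin q)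
  ∑-pick r col (a ∷ zs) (c′ ∷ cs) (_ , h) = begin
    ∑ (allFin q) (λ c → length (pick c (a ∷ zs) (c′ ∷ cs)))
      ≡⟨ ∑-cong (allFin q) split ⟩
    ∑ (allFin q) (λ c → ⟦ does (c F.≟ c′) ⟧ + length (pick c zs cs))
      ≡⟨ ∑-+ (allFin q) _ _ ⟩
    count (λ c → does (c F.≟ c′)) (allFin q) + ∑ (allFin q) (λ c → length (pick c zs cs))
      ≡⟨ cong₂ _+_ (count-single c′) (∑-pick r col zs cs h) ⟩
    suc (length zs) ∎
    where
    open ≡-Reasoning
    split : ∀ c → length (pick c (a ∷ zs) (c′ ∷ cs)) ≡ ⟦ does (c F.≟ c′) ⟧ + length (pick c zs cs)
    split c with c F.≟ c′
    ... | yes _ = refl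
    ... | no  _ = refl

  pick-homogeneous : ∀ r (col : List X → Fin q) c zs cs → EndHomogeneous r col zs cs →
                     Homogeneous (suc r) col c (pick c zs cs)
  pick-homogeneous r col c (a ∷ zs) (c′ ∷ cs) (h , hs) s e with c F.≟ c′
  pick-homogeneous r col c (a ∷ zs) (c′ ∷ cs) (h , hs) s e | no _ = pick-homogeneous r col c zs cs hs s e
  pick-homogeneous r col c (a ∷ zs) (.c ∷ cs) (h , hs) (_ ∷ʳ s)   e | yes refl = pick-homogeneous r col c zs cs hs s e
  pick-homogeneous r col c (a ∷ zs) (.c ∷ cs) (h , hs) (refl ∷ s) e | yes refl =
    h (⊆-trans s (pick-⊆ c zs cs)) (suc-injective e)
  pick-homogeneous r col c [] cs hs [] ()
  pick-homogeneous r col c (a ∷ zs) [] () s e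

Ramsey : ℕ → ℕ → ℕ → ℕ → Set₁
Ramsey r q m N = ∀ {X : Set} (col : List X → Fin q) xs → N ≤ length xs →
  ∃ λ c → ∃ λ ys → ys ⊆ xs × length ys ≡ m × Homogeneous r col c ys

-- Induction on `r`: each new element of an end-homogeneous sequence passes to a homogeneous set for
-- the colouring of `r`-sets that it induces. Length `q * m` lets the pigeonhole principle leave `m`
-- elements with the same recorded colour.
ramsey : ∀ r q m → ∃ (Ramsey r q m)
ramsey zero q m = m , λ col xs h → col [] , take m xs , take-⊆ m xs , length-take-≤ m xs h ,
  λ { {[]} _ _ → refl }
ramsey (suc r) q m = proj₁ (build (q * m)) , thm
  where
  build : ∀ k → ∃ λ N → ∀ {X : Set} (col : List X → Fin q) xs → N ≤ length xs →
          ∃ λ zs → ∃ λ cs → zs ⊆ xs × length zs ≡ k × EndHomogeneous r col zs cs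
  build zero    = 0 , λ col xs _ → [] , [] , take-⊆ 0 xs , refl , tt
  build (suc k) = suc (proj₁ (ramsey r q (proj₁ (build k)))) , step
    where
    step : ∀ {X : Set} (col : List X → Fin q) xs → suc (proj₁ (ramsey r q (proj₁ (build k)))) ≤ length xs →
           ∃ λ zs → ∃ λ cs → zs ⊆ xs × length zs ≡ suc k × EndHomogeneous r col zs cs
    step col (a ∷ xs) (s≤s h) =
      let c , ys , s , l , hom  = proj₂ (ramsey r q (proj₁ (build k))) (λ t → col (a ∷ t)) xs h
          zs , cs , s′ , l′ , eh = proj₂ (build k) col ys (≤-reflexive (sym l))
      in a ∷ zs , c ∷ cs , refl ∷ ⊆-trans s′ s , cong suc l′ , (λ u → hom (⊆-trans u s′)) , eh
  thm : Ramsey (suc r) q m (proj₁ (build (q * m)))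
  thm col xs h with proj₂ (build (q * m)) col xs h
  ... | zs , cs , s , l , eh with
        ∑≤⇒∃≤ (allFin q) (λ _ → m) (λ c → length (pick c zs cs)) (subst (0 <_) (sym (length-allFin q)) (pos (col [])))
          (≤-reflexive (trans (∑-const (allFin q) m) (trans (cong (_* m) (length-allFin q))
            (trans (sym l) (sym (∑-pick r col zs cs eh))))))
    where
    pos : ∀ {q} → Fin q → 0 < q
    pos zero    = s≤s z≤n
    pos (suc _) = s≤s z≤n
  ...   | c , _ , m≤ = c , take m (pick c zs cs) , ⊆-trans (take-⊆ m _) (⊆-trans (pick-⊆ c zs cs) s) ,
          length-take-≤ m _ m≤ , λ u e → pick-homogeneous r col c zs cs eh (⊆-trans u (take-⊆ m _)) e

choose : ℕ → List X → List (List X)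
choose zero    xs       = [] ∷ []
choose (suc r) []       = []
choose (suc r) (x ∷ xs) = map (x ∷_) (choose r xs) ++ choose (suc r) xs

∈-choose⁺ : ∀ {t xs : List X} → t ⊆ xs → t ∈ choose (length t) xs
∈-choose⁺ {t = []}                  s          = here refl
∈-choose⁺ {t = x ∷ t} {xs = y ∷ xs} (_ ∷ʳ s)   = MP.∈-++⁺ʳ (map (y ∷_) (choose (length t) xs)) (∈-choose⁺ s)
∈-choose⁺ {t = x ∷ t} {xs = y ∷ xs} (refl ∷ s) = MP.∈-++⁺ˡ (MP.∈-map⁺ (x ∷_) (∈-choose⁺ s))

∈-choose⁻ : ∀ r {t} (xs : List X) → t ∈ choose r xs → t ⊆ xs × length t ≡ r
∈-choose⁻ zero    xs (here refl) = take-⊆ 0 xs , refl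
∈-choose⁻ (suc r) (x ∷ xs) m with MP.∈-++⁻ (map (x ∷_) (choose r xs)) m
... | inj₂ m′ = let s , e = ∈-choose⁻ (suc r) xs m′ in x ∷ʳ s , e
... | inj₁ m′ with MP.∈-map⁻ (x ∷_) m′
...   | t , m″ , refl = let s , e = ∈-choose⁻ r xs m″ in refl ∷ s , cong suc e

-- Monochromatic grids

fromLength : ∀ {m} (xs : List X) → length xs ≡ m → ∃ λ (v : Vec X m) → toList v ≡ xs
fromLength []       refl = [] , refl
fromLength (x ∷ xs) refl = let v , e = fromLength xs refl in x ∷ v , cong (x ∷_) e

splitLength : ∀ m {k} (xs : List X) → length xs ≡ m + k →
              ∃ λ (v : Vec X m) → ∃ λ ys → xs ≡ toList v ++ ys × length ys ≡ k
splitLength zero    xs       e = [] , xs , refl , e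
splitLength (suc m) (x ∷ xs) e = let v , ys , e′ , l = splitLength m xs (suc-injective e) in
                                 x ∷ v , ys , cong (x ∷_) e′ , l

single-⊆ : ∀ {m} (v : Vec X m) i → V.lookup v i ∷ [] ⊆ toList v
single-⊆ (x ∷ v) zero    = refl ∷ minimum _
single-⊆ (x ∷ v) (suc i) = x ∷ʳ single-⊆ v i

pair-⊆ : ∀ {m} (v : Vec X m) {i j} → i F.< j → V.lookup v i ∷ V.lookup v j ∷ [] ⊆ toList v
pair-⊆ (x ∷ v) {zero}  {suc j} _       = refl ∷ single-⊆ v j
pair-⊆ (x ∷ v) {suc i} {suc j} (s≤s h) = x ∷ʳ pair-⊆ v h

Unique-pair : ∀ {xs : List X} {a b} → Unique xs → a ∷ b ∷ [] ⊆ xs → a ≢ b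
Unique-pair (_ ∷ u)  (_ ∷ʳ s)   = Unique-pair u s
Unique-pair (px ∷ u) (refl ∷ s) = All.lookup px (S.to∈ s)

all-true : ∀ (p : X → Bool) {xs} → all p xs ≡ true → ∀ {x} → x ∈ xs → p x ≡ true
all-true p {y ∷ ys} e (here refl) = proj₁ (∧-true {p y} e)
all-true p {y ∷ ys} e (there m)   = all-true p (proj₂ (∧-true {p y} e)) m

all-intro : ∀ (p : X → Bool) xs → (∀ {x} → x ∈ xs → p x ≡ true) → all p xs ≡ true
all-intro p []       h = refl
all-intro p (y ∷ ys) h = ∧-intro (h (here refl)) (all-intro p ys (h ∘ there))

updates : ∀ {N r} → Vec X N → Vec (Fin N) r → Vec X r → Vec X N
updates P []       []      = P
updates P (i ∷ is) (g ∷ u) = updates (P V.[ i ]≔ g) is u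

-- Overwriting coordinates of a uniform vector by uniform values leaves it uniform. Consequently
-- some fixed `P` keeps the average density when only the coordinates `is` vary.
∑-updates : ∀ {N r} R (is : Vec (Fin N) r) (f : Vec (Fin R) N → ℕ) →
            ∑ (vecs R N) (λ P → ∑ (vecs R r) (λ u → f (updates P is u))) ≡ R ^ r * ∑ (vecs R N) f
∑-updates {N} R [] f = trans (∑-cong (vecs R N) (λ P → +-identityʳ (f P))) (sym (*-identityˡ _))
∑-updates {N} {suc r} R (i ∷ is) f = begin
  ∑ (vecs R N) (λ P → ∑ (vecs R (suc r)) (λ u → f (updates P (i ∷ is) u)))
    ≡⟨ ∑-cong (vecs R N) (λ P → ∑-vecs R r _) ⟩
  ∑ (vecs R N) (λ P → ∑ (allFin R) (λ g → F (P V.[ i ]≔ g)))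
    ≡⟨ ∑-resample R N i F ⟩
  R * ∑ (vecs R N) F
    ≡⟨ cong (R *_) (∑-updates R is f) ⟩
  R * (R ^ r * ∑ (vecs R N) f)
    ≡⟨ sym (*-assoc R (R ^ r) _) ⟩
  R ^ suc r * ∑ (vecs R N) f ∎
  where
  open ≡-Reasoning
  F : Vec (Fin R) N → ℕ
  F P = ∑ (vecs R r) (λ u → f (updates P is u))

lookup-updates-∉ : ∀ {N r} (P : Vec X N) (is : Vec (Fin N) r) u j → (∀ s → V.lookup is s ≢ j) →
                   V.lookup (updates P is u) j ≡ V.lookup P j
lookup-updates-∉ P []       []      j h = refl
lookup-updates-∉ P (i ∷ is) (g ∷ u) j h = trans (lookup-updates-∉ (P V.[ i ]≔ g) is u j (h ∘ suc))
  (VP.lookup∘update′ (λ e → h zero (sym e)) P g)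

lookup-updates-∈ : ∀ {N r} (P : Vec X N) (is : Vec (Fin N) r) u s →
                   (∀ {i j} → i F.< j → V.lookup is i ≢ V.lookup is j) →
                   V.lookup (updates P is u) (V.lookup is s) ≡ V.lookup u s
lookup-updates-∈ P (i ∷ is) (g ∷ u) zero    d =
  trans (lookup-updates-∉ (P V.[ i ]≔ g) is u i (λ s e → d {zero} {suc s} (s≤s z≤n) (sym e))) (VP.lookup∘update i P g)
lookup-updates-∈ P (i ∷ is) (g ∷ u) (suc s) d = lookup-updates-∈ (P V.[ i ]≔ g) is u s (λ l → d (s≤s l))

encode : Bool → Bool → Bool → Fin 8
encode false false false = F.# 0
encode false false true  = F.# 1
encode false true  false = F.# 2
encode false true  true  = F.# 3
encode true  false false = F.# 4
encode true  false true  = F.# 5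
encode true  true  false = F.# 6
encode true  true  true  = F.# 7

decode : Fin 8 → Bool × Bool × Bool
decode zero = false , false , false
decode (suc zero) = false , false , true
decode (suc (suc zero)) = false , true , false
decode (suc (suc (suc zero))) = false , true , true
decode (suc (suc (suc (suc zero)))) = true , false , false
decode (suc (suc (suc (suc (suc zero))))) = true , false , true
decode (suc (suc (suc (suc (suc (suc zero)))))) = true , true , false
decode (suc (suc (suc (suc (suc (suc (suc zero))))))) = true , true , true

decode-encode : ∀ a b c → decode (encode a b c) ≡ (a , b , c)
decode-encode false false false = refl
decode-encode false false true  = refl
decode-encode false true  false = refl
decode-encode false true  true  = refl
decode-encode true  false false = refl
decode-encode true  false true  = refl
decode-encode true  true  false = refl
decode-encode true  true  true  = refl

two-agree : ∀ (a b c : Bool) → a ≡ b ⊎ a ≡ c ⊎ b ≡ c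
two-agree false false _     = inj₁ refl
two-agree true  true  _     = inj₁ refl
two-agree false true  false = inj₂ (inj₁ refl)
two-agree false true  true  = inj₂ (inj₂ refl)
two-agree true  false false = inj₂ (inj₂ refl)
two-agree true  false true  = inj₂ (inj₁ refl)

-- Constructors are named after the two directions whose colours agree. Freezing one argument of
-- `pt` leaves a two-parameter family with rows and columns in exactly these directions.
data Shape {G Cell : Set} (pt : G → G → G → Cell) : (G → G → Cell) → Set where
  xy : ∀ g → Shape pt (λ p q → pt p g q)
  xz : ∀ g → Shape pt (λ p q → pt g p q)
  yz : ∀ g → Shape pt (λ p q → pt p q g)

-- The indices `s` and `t` are slots, that is, coordinates that may take any value below `R`; `E`
-- marks the assignments of values for which the colours are under control. The index `l` allows
-- several vertices with the same pair of slots.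
record Grid (a b k N D R : ℕ) {Cell : Set} (pt : Fin R → Fin R → Fin R → Cell)
            (col : Cell × Fin N → Cell × Fin N → Bool) : Set where
  field
    cell     : Fin R → Fin R → Cell
    shape    : Shape pt cell
    label    : Fin a → Fin b → Fin k → Fin N
    label-injective : ∀ {s t l s′ t′ l′} → label s t l ≡ label s′ t′ l′ → s ≡ s′ × t ≡ t′ × l ≡ l′
    colour   : Bool
    E        : Vec (Fin R) (a + b) → Bool
    dense    : R ^ (a + b) ≤ D * count E (vecs R (a + b))
    row      : ∀ ps qs → E (ps V.++ qs) ≡ true → ∀ s {t t′} l l′ → t F.< t′ →
               col (cell (V.lookup ps s) (V.lookup qs t) , label s t l)
                   (cell (V.lookup ps s) (V.lookup qs t′) , label s t′ l′) ≡ colour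
    column   : ∀ ps qs → E (ps V.++ qs) ≡ true → ∀ {s s′} t l l′ → s F.< s′ →
               col (cell (V.lookup ps s) (V.lookup qs t) , label s t l)
                   (cell (V.lookup ps s′) (V.lookup qs t) , label s′ t l′) ≡ colour

module _ {R N : ℕ} {Cell : Set} (pt : Fin R → Fin R → Fin R → Cell)
         (col : Cell × Fin N → Cell × Fin N → Bool) where

  -- For pt a b c = (a − b , b − c), the three pairs of points share the first
  -- coordinate, the second coordinate, and the sum of the coordinates.
  colX colY colZ : Vec (Fin R) N → (a b c d e f : Fin N) → Bool
  colX P a b c d e f = col (pt (V.lookup P a) (V.lookup P b) (V.lookup P c) , e) (pt (V.lookup P a) (V.lookup P b) (V.lookup P d) , f)
  colY P a b c d e f = col (pt (V.lookup P a) (V.lookup P c) (V.lookup P d) , e) (pt (V.lookup P b) (V.lookup P c) (V.lookup P d) , f)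
  colZ P a b c d e f = col (pt (V.lookup P a) (V.lookup P b) (V.lookup P d) , e) (pt (V.lookup P a) (V.lookup P c) (V.lookup P d) , f)

  sextuple : Vec (Fin R) N → List (Fin N) → Fin 8
  sextuple P (a ∷ b ∷ c ∷ d ∷ e ∷ f ∷ []) = encode (colX P a b c d e f) (colY P a b c d e f) (colZ P a b c d e f)
  sextuple P _ = zero

  holds : List (Fin N) × Fin 8 → Vec (Fin R) N → Bool
  holds (Q , c) P = all (λ t → does (sextuple P t F.≟ c)) (choose 6 Q)

  holds-elim : ∀ Q c P → holds (Q , c) P ≡ true → ∀ {a b d e f g} → a ∷ b ∷ d ∷ e ∷ f ∷ g ∷ [] ⊆ Q →
               (colX P a b d e f g , colY P a b d e f g , colZ P a b d e f g) ≡ decode c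
  holds-elim Q c P h {a} {b} {d} {e} {f} {g} s =
    trans (sym (decode-encode (colX P a b d e f g) (colY P a b d e f g) (colZ P a b d e f g)))
      (cong decode (does-true (sextuple P _ F.≟ c) (all-true _ {choose 6 Q} h (∈-choose⁺ s))))

-- In order: `g₀`, the `a` row coordinates, `g₁`, the `b` column coordinates, `g₂` and the
-- `b * a * k` labels. A frozen index is thus available before, between and after the varying ones.
size : ℕ → ℕ → ℕ → ℕ
size a b k = suc (a + suc (b + suc (b * a * k)))

module _ (a b k N₀ : ℕ) (ram : Ramsey 6 8 (size a b k) N₀) where

  patterns : List (List (Fin N₀) × Fin 8)
  patterns = cartesianProduct (choose (size a b k) (allFin N₀)) (allFin 8)

  -- The homogeneous set supplied by Ramsey's theorem depends on the values `P`, but the number `D`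
  -- of patterns does not depend on `R`. So one pattern holds for a proportion `1/D` of all `P`, and
  -- a second averaging fixes the coordinates outside `X` and `Y`.
  grid : ∀ R → 0 < R → {Cell : Set} (pt : Fin R → Fin R → Fin R → Cell)
         (col : Cell × Fin N₀ → Cell × Fin N₀ → Bool) → Grid a b k N₀ (length patterns) R pt col
  grid R R>0 {Cell} pt col = result
    where
    exists : ∀ P → ∃ λ π → π ∈ patterns × holds pt col π P ≡ true
    exists P =
      let c , Q , Q⊆ , l , hom = ram (sextuple pt col P) (allFin N₀)
                                   (≤-reflexive (sym (length-allFin N₀)))
      in (Q , c) , MP.∈-cartesianProduct⁺ (subst (λ m → Q ∈ choose m (allFin N₀)) l (∈-choose⁺ Q⊆)) (MP.∈-allFin c) ,
         all-intro _ (choose 6 Q) λ {t} m → let s , l = ∈-choose⁻ 6 Q m in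
           dec-true (sextuple pt col P t F.≟ c) (hom s l)

    D = length patterns

    popular : ∃ λ π → π ∈ patterns × length (vecs R N₀) ≤ D * count (holds pt col π) (vecs R N₀)
    popular = ∑≤⇒∃≤ patterns _ _ (MP.∈-length (proj₁ (proj₂ (exists (V.replicate N₀ (F.fromℕ< R>0)))))) (begin
      ∑ patterns (λ _ → length (vecs R N₀))                           ≡⟨ ∑-const patterns _ ⟩
      D * length (vecs R N₀)                                          ≡⟨ cong (D *_) (length≡∑1 (vecs R N₀)) ⟩
      D * count (λ _ → true) (vecs R N₀)                              ≤⟨ *-monoʳ-≤ D (count-⋃ _ (vecs R N₀) patterns (holds pt col) (λ P _ → exists P)) ⟩
      D * ∑ patterns (λ π → count (holds pt col π) (vecs R N₀))       ≡⟨ sym (∑-*ˡ D patterns _) ⟩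
      ∑ patterns (λ π → D * count (holds pt col π) (vecs R N₀))       ∎)
      where open ≤-Reasoning

    Q = proj₁ (proj₁ popular)
    c = proj₂ (proj₁ popular)

    Q-props : Q ⊆ allFin N₀ × length Q ≡ size a b k
    Q-props = ∈-choose⁻ (size a b k) (allFin N₀) (proj₁ (MP.∈-cartesianProduct⁻ (choose (size a b k) (allFin N₀)) (allFin 8) (proj₁ (proj₂ popular))))

    -- The coordinates g₀, g₁, g₂ are frozen, those in X and Y vary, and those in
    -- Lb only serve as labels.
    decompose : ∀ Q → length Q ≡ size a b k → ∃ λ g₀ → ∃ λ (X : Vec (Fin N₀) a) → ∃ λ g₁ → ∃ λ (Y : Vec (Fin N₀) b) → ∃ λ g₂ →
      ∃ λ (Lb : Vec (Fin N₀) (b * a * k)) → Q ≡ g₀ ∷ toList X ++ g₁ ∷ toList Y ++ g₂ ∷ toList Lb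
    decompose (g₀ ∷ Q₁) l with splitLength a Q₁ (suc-injective l)
    ... | X , g₁ ∷ Q₂ , refl , l₂ with splitLength b Q₂ (suc-injective l₂)
    ...   | Y , g₂ ∷ Q₃ , refl , l₃ with fromLength Q₃ (suc-injective l₃)
    ...     | Lb , refl = g₀ , X , g₁ , Y , g₂ , Lb , refl

    result : Grid a b k N₀ D R pt col
    result with decompose Q (proj₂ Q-props)
    ... | g₀ , X , g₁ , Y , g₂ , Lb , eq = main
      where
      is : Vec (Fin N₀) (a + b)
      is = X V.++ Y

      uniq : ∀ {i j} → i ∷ j ∷ [] ⊆ g₀ ∷ toList X ++ g₁ ∷ toList Y ++ g₂ ∷ toList Lb → i ≢ j
      uniq s = Unique-pair (UP.allFin⁺ N₀) (⊆-trans (subst (_ ⊆_) (sym eq) s) (proj₁ Q-props))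

      is-⊆ : toList is ⊆ g₀ ∷ toList X ++ g₁ ∷ toList Y ++ g₂ ∷ toList Lb
      is-⊆ = subst (_⊆ g₀ ∷ toList X ++ g₁ ∷ toList Y ++ g₂ ∷ toList Lb) (sym (VP.toList-++ X Y))
        (g₀ ∷ʳ ++⁺ {as = toList X} ⊆-refl (g₁ ∷ʳ subst (_⊆ toList Y ++ g₂ ∷ toList Lb) (LP.++-identityʳ (toList Y))
          (++⁺ {as = toList Y} ⊆-refl (minimum (g₂ ∷ toList Lb)))))

      distinct : ∀ {i j} → i F.< j → V.lookup is i ≢ V.lookup is j
      distinct l = uniq (⊆-trans (pair-⊆ is l) is-⊆)

      lookupˡ : ∀ s → V.lookup is (s F.↑ˡ b) ≡ V.lookup X s
      lookupˡ s = VP.lookup-++ˡ X Y s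

      lookupʳ : ∀ t → V.lookup is (a F.↑ʳ t) ≡ V.lookup Y t
      lookupʳ t = VP.lookup-++ʳ X Y t

      outside : ∀ {g} → (∀ s → V.lookup X s ≢ g) → (∀ t → V.lookup Y t ≢ g) → ∀ s → V.lookup is s ≢ g
      outside hX hY s e with F.splitAt a s in sp
      ... | inj₁ s′ = hX s′ (trans (sym (lookupˡ s′)) (trans (cong (V.lookup is) (FP.splitAt⁻¹-↑ˡ sp)) e))
      ... | inj₂ t′ = hY t′ (trans (sym (lookupʳ t′)) (trans (cong (V.lookup is) (FP.splitAt⁻¹-↑ʳ sp)) e))

      out₀ : ∀ s → V.lookup is s ≢ g₀
      out₀ = outside
        (λ s e → uniq (refl ∷ ++⁺ (single-⊆ X s) (minimum _)) (sym e))
        (λ t e → uniq (refl ∷ ++⁺ (minimum (toList X)) (g₁ ∷ʳ ++⁺ (single-⊆ Y t) (minimum _))) (sym e))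
      out₁ : ∀ s → V.lookup is s ≢ g₁
      out₁ = outside
        (λ s e → uniq (g₀ ∷ʳ ++⁺ (single-⊆ X s) (refl ∷ minimum _)) e)
        (λ t e → uniq (g₀ ∷ʳ ++⁺ (minimum (toList X)) (refl ∷ ++⁺ (single-⊆ Y t) (minimum _))) (sym e))
      out₂ : ∀ s → V.lookup is s ≢ g₂
      out₂ = outside
        (λ s e → uniq (g₀ ∷ʳ ++⁺ (single-⊆ X s) (g₁ ∷ʳ ++⁺ (minimum (toList Y)) (refl ∷ minimum _))) e)
        (λ t e → uniq (g₀ ∷ʳ ++⁺ (minimum (toList X)) (g₁ ∷ʳ ++⁺ (single-⊆ Y t) (refl ∷ minimum _))) e)

      base : ∃ λ P → P ∈ vecs R N₀ × R ^ (a + b) ≤ D * count (λ u → holds pt col (Q , c) (updates P is u)) (vecs R (a + b))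
      base = ∑≤⇒∃≤ (vecs R N₀) _ _ (MP.∈-length (∈-vecs R N₀ (V.replicate N₀ (F.fromℕ< R>0)))) (begin
        ∑ (vecs R N₀) (λ _ → R ^ (a + b))
          ≡⟨ trans (∑-const (vecs R N₀) _) (*-comm (length (vecs R N₀)) _) ⟩
        R ^ (a + b) * length (vecs R N₀)
          ≤⟨ *-monoʳ-≤ (R ^ (a + b)) (proj₂ (proj₂ popular)) ⟩
        R ^ (a + b) * (D * count (holds pt col (Q , c)) (vecs R N₀))
          ≡⟨ x∙yz≈y∙xz (R ^ (a + b)) D _ ⟩
        D * (R ^ (a + b) * count (holds pt col (Q , c)) (vecs R N₀))
          ≡⟨ cong (D *_) (sym (∑-updates R is _)) ⟩
        D * ∑ (vecs R N₀) (λ P → count (λ u → holds pt col (Q , c) (updates P is u)) (vecs R (a + b)))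
          ≡⟨ sym (∑-*ˡ D (vecs R N₀) _) ⟩
        ∑ (vecs R N₀) (λ P → D * count (λ u → holds pt col (Q , c) (updates P is u)) (vecs R (a + b))) ∎)
        where
        open ≤-Reasoning
        open import Algebra.Properties.CommutativeSemigroup *-commutativeSemigroup using (x∙yz≈y∙xz)

      P₀ = proj₁ base

      module _ (ps : Vec (Fin R) a) (qs : Vec (Fin R) b) where

        P : Vec (Fin R) N₀
        P = updates P₀ is (ps V.++ qs)

        at-X : ∀ s → V.lookup P (V.lookup X s) ≡ V.lookup ps s
        at-X s = trans (cong (V.lookup P) (sym (lookupˡ s)))
          (trans (lookup-updates-∈ P₀ is (ps V.++ qs) (s F.↑ˡ b) distinct) (VP.lookup-++ˡ ps qs s))

        at-Y : ∀ t → V.lookup P (V.lookup Y t) ≡ V.lookup qs t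
        at-Y t = trans (cong (V.lookup P) (sym (lookupʳ t)))
          (trans (lookup-updates-∈ P₀ is (ps V.++ qs) (a F.↑ʳ t) distinct) (VP.lookup-++ʳ ps qs t))

        at-out : ∀ {g} → (∀ s → V.lookup is s ≢ g) → V.lookup P g ≡ V.lookup P₀ g
        at-out h = lookup-updates-∉ P₀ is (ps V.++ qs) _ h

      -- Lexicographic in `t`, `s`, `l`: the labels of two points increase along a row and along a
      -- column whatever the values of `l` are, as the last two entries of a 6-sublist must.
      index : Fin a → Fin b → Fin k → Fin (b * a * k)
      index s t l = combine (combine t s) l

      label : Fin a → Fin b → Fin k → Fin N₀
      label s t l = V.lookup Lb (index s t l)

      index-mono-t : ∀ {s s′ t t′} l l′ → t F.< t′ → index s t l F.< index s′ t′ l′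
      index-mono-t l l′ h = FP.combine-monoˡ-< l l′ (FP.combine-monoˡ-< _ _ h)

      index-mono-s : ∀ {s s′} t l l′ → s F.< s′ → index s t l F.< index s′ t l′
      index-mono-s {s} {s′} t l l′ h = FP.combine-monoˡ-< l l′
        (subst₂ _<_ (sym (FP.toℕ-combine t s)) (sym (FP.toℕ-combine t s′)) (+-monoʳ-< (a * toℕ t) h))

      labels : ∀ {i j} → i F.< j → V.lookup Lb i ∷ V.lookup Lb j ∷ [] ⊆ toList Lb
      labels = pair-⊆ Lb

      Lb-injective : ∀ {i j} → V.lookup Lb i ≡ V.lookup Lb j → i ≡ j
      Lb-injective {i} {j} e with FP.<-cmp i j
      ... | tri≈ _ r _ = r
      ... | tri< l _ _ = ⊥-elim (uniq (g₀ ∷ʳ ++⁺ (minimum (toList X)) (g₁ ∷ʳ ++⁺ (minimum (toList Y)) (g₂ ∷ʳ labels l))) e)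
      ... | tri> _ _ l = ⊥-elim (uniq (g₀ ∷ʳ ++⁺ (minimum (toList X)) (g₁ ∷ʳ ++⁺ (minimum (toList Y)) (g₂ ∷ʳ labels l))) (sym e))

      label-injective : ∀ {s t l s′ t′ l′} → label s t l ≡ label s′ t′ l′ → s ≡ s′ × t ≡ t′ × l ≡ l′
      label-injective {s} {t} {l} {s′} {t′} {l′} e =
        let e₁ , el = FP.combine-injective (combine t s) l (combine t′ s′) l′ (Lb-injective e)
            et , es = FP.combine-injective t s t′ s′ e₁
        in es , et , el

      E : Vec (Fin R) (a + b) → Bool
      E u = holds pt col (Q , c) (updates P₀ is u)

      cX = proj₁ (decode c)
      cY = proj₁ (proj₂ (decode c))
      cZ = proj₂ (proj₂ (decode c))

      elim : ∀ ps qs → E (ps V.++ qs) ≡ true → ∀ {x₁ x₂ x₃ x₄ l₁ l₂} →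
             x₁ ∷ x₂ ∷ x₃ ∷ x₄ ∷ l₁ ∷ l₂ ∷ [] ⊆ g₀ ∷ toList X ++ g₁ ∷ toList Y ++ g₂ ∷ toList Lb →
             (colX pt col (P ps qs) x₁ x₂ x₃ x₄ l₁ l₂ , colY pt col (P ps qs) x₁ x₂ x₃ x₄ l₁ l₂ , colZ pt col (P ps qs) x₁ x₂ x₃ x₄ l₁ l₂)
               ≡ (cX , cY , cZ)
      elim ps qs e s = holds-elim pt col Q c (P ps qs) e (subst (_ ⊆_) (sym eq) s)

      transport : ∀ {p₁ p₂ p₃ q₁ q₂ q₃ p₁′ p₂′ p₃′ q₁′ q₂′ q₃′ : Fin R} {l l′ κ} →
        p₁ ≡ p₁′ → p₂ ≡ p₂′ → p₃ ≡ p₃′ → q₁ ≡ q₁′ → q₂ ≡ q₂′ → q₃ ≡ q₃′ →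
        col (pt p₁ p₂ p₃ , l) (pt q₁ q₂ q₃ , l′) ≡ κ → col (pt p₁′ p₂′ p₃′ , l) (pt q₁′ q₂′ q₃′ , l′) ≡ κ
      transport refl refl refl refl refl refl h = h

      main : Grid a b k N₀ D R pt col
      main with two-agree cX cY cZ
      ... | inj₁ agree = record
        { cell = λ p q → pt p (V.lookup P₀ g₁) q ; shape = xy _ ; label = label ; label-injective = label-injective
        ; colour = cX ; E = E ; dense = proj₂ (proj₂ base)
        ; row = λ ps qs e s {t} {t′} l l′ h → transport
            (at-X ps qs s) (at-out ps qs out₁) (at-Y ps qs t) (at-X ps qs s) (at-out ps qs out₁) (at-Y ps qs t′)
            (cong proj₁ (elim ps qs e (g₀ ∷ʳ ++⁺ (single-⊆ X s) (refl ∷ ++⁺ (pair-⊆ Y h) (g₂ ∷ʳ labels (index-mono-t l l′ h))))))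
        ; column = λ ps qs e {s} {s′} t l l′ h → trans (transport
            (at-X ps qs s) (at-out ps qs out₁) (at-Y ps qs t) (at-X ps qs s′) (at-out ps qs out₁) (at-Y ps qs t)
            (cong (proj₁ ∘ proj₂) (elim ps qs e (g₀ ∷ʳ ++⁺ (pair-⊆ X h) (refl ∷ ++⁺ (single-⊆ Y t) (g₂ ∷ʳ labels (index-mono-s t l l′ h))))))) (sym agree) }
      ... | inj₂ (inj₁ agree) = record
        { cell = λ p q → pt (V.lookup P₀ g₀) p q ; shape = xz _ ; label = label ; label-injective = label-injective
        ; colour = cX ; E = E ; dense = proj₂ (proj₂ base)
        ; row = λ ps qs e s {t} {t′} l l′ h → transport
            (at-out ps qs out₀) (at-X ps qs s) (at-Y ps qs t) (at-out ps qs out₀) (at-X ps qs s) (at-Y ps qs t′)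
            (cong proj₁ (elim ps qs e (refl ∷ ++⁺ (single-⊆ X s) (g₁ ∷ʳ ++⁺ (pair-⊆ Y h) (g₂ ∷ʳ labels (index-mono-t l l′ h))))))
        ; column = λ ps qs e {s} {s′} t l l′ h → trans (transport
            (at-out ps qs out₀) (at-X ps qs s) (at-Y ps qs t) (at-out ps qs out₀) (at-X ps qs s′) (at-Y ps qs t)
            (cong (proj₂ ∘ proj₂) (elim ps qs e (refl ∷ ++⁺ (pair-⊆ X h) (g₁ ∷ʳ ++⁺ (single-⊆ Y t) (g₂ ∷ʳ labels (index-mono-s t l l′ h))))))) (sym agree) }
      ... | inj₂ (inj₂ agree) = record
        { cell = λ p q → pt p q (V.lookup P₀ g₂) ; shape = yz _ ; label = label ; label-injective = label-injective
        ; colour = cY ; E = E ; dense = proj₂ (proj₂ base)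
        ; row = λ ps qs e s {t} {t′} l l′ h → trans (transport
            (at-X ps qs s) (at-Y ps qs t) (at-out ps qs out₂) (at-X ps qs s) (at-Y ps qs t′) (at-out ps qs out₂)
            (cong (proj₂ ∘ proj₂) (elim ps qs e (g₀ ∷ʳ ++⁺ (single-⊆ X s) (g₁ ∷ʳ ++⁺ (pair-⊆ Y h) (refl ∷ labels (index-mono-t l l′ h))))))) (sym agree)
        ; column = λ ps qs e {s} {s′} t l l′ h → transport
            (at-X ps qs s) (at-Y ps qs t) (at-out ps qs out₂) (at-X ps qs s′) (at-Y ps qs t) (at-out ps qs out₂)
            (cong (proj₁ ∘ proj₂) (elim ps qs e (g₀ ∷ʳ ++⁺ (pair-⊆ X h) (g₁ ∷ʳ ++⁺ (single-⊆ Y t) (refl ∷ labels (index-mono-s t l l′ h)))))) }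

-- Dependent random choice

-- All lists of length at most `d`, with repetitions allowed: different constraints may carry the
-- same vector.
tuples : ℕ → List X → List (List X)
tuples zero    xs = [] ∷ []
tuples (suc d) xs = [] ∷ concatMap (λ x → map (x ∷_) (tuples d xs)) xs

∈-tuples : ∀ d {xs : List X} es → length es ≤ d → (∀ {e} → e ∈ es → e ∈ xs) → es ∈ tuples d xs
∈-tuples zero    []       _ _ = here refl
∈-tuples (suc d) []       _ _ = here refl
∈-tuples (suc d) {xs} (e ∷ es) (s≤s l) h =
  there (MP.∈-concatMap⁺ (λ x → map (x ∷_) (tuples d xs))
    (lem (h (here refl)) (MP.∈-map⁺ (e ∷_) (∈-tuples d es l (h ∘ there)))))
  where
  lem : ∀ {xs : List _} {e} {P : _ → Set} → e ∈ xs → P e → Any P xs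
  lem m p = Any.map (λ { refl → p }) m

length-tuples : ∀ d (xs : List X) → length (tuples d xs) ≤ (1 + length xs) ^ d
length-tuples zero    xs = ≤-refl
length-tuples (suc d) xs = begin
  suc (length (concatMap (λ x → map (x ∷_) (tuples d xs)) xs))
    ≡⟨ cong suc (trans (length≡∑1 (concatMap (λ x → map (x ∷_) (tuples d xs)) xs)) (∑-concatMap _ xs _)) ⟩
  suc (∑ xs (λ x → ∑ (map (x ∷_) (tuples d xs)) (λ _ → 1)))
    ≤⟨ s≤s (∑-≤const xs (λ x → ≤-trans (≤-reflexive (trans (∑-map (x ∷_) (tuples d xs) _) (sym (length≡∑1 (tuples d xs))))) (length-tuples d xs))) ⟩
  suc (length xs * (1 + length xs) ^ d)
    ≤⟨ +-monoˡ-≤ _ (m^n>0 (1 + length xs) d) ⟩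
  (1 + length xs) ^ suc d ∎
  where open ≤-Reasoning

-- A suitable vertex g keeps a positive proportion of
-- A but only a proportion O(1/B) of the bad tuples, so after t rounds no bad
-- tuple survives.
module DRC (R β B Δ : ℕ) (R≡Bβ : R ≡ B * β) (B>0 : 0 < B) (R>0 : 0 < R)
           {X : Set} (E : X → Fin R → Bool) where

  deg : X → ℕ
  deg e = count (E e) (allFin R)

  commonly : List X → Fin R → Bool
  commonly es g = all (λ e → E e g) es

  common : List X → ℕ
  common es = count (commonly es) (allFin R)

  ∑-length-filter : ∀ {Z : Set} (p : Z → Fin R → Bool) ys →
    ∑ (allFin R) (λ g → length (filterᵇ (λ y → p y g) ys)) ≡ ∑ ys (λ y → count (p y) (allFin R))
  ∑-length-filter p ys = trans (∑-cong (allFin R) (λ g → length-filterᵇ (λ y → p y g) ys))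
                               (∑-swap (allFin R) ys (λ g y → ⟦ p y g ⟧))

  module _ (C : ℕ) (C>0 : 0 < C) where

    -- One average yields both claims. With `a` and `b` the numbers of elements and of bad tuples,
    -- the sum over `g` of `a * b + B * a * b′ g` is at most `2 * a * R * b`, and this is at most
    -- the sum of `4 * C * b * A′ g`. For a `g` that respects the inequality each summand on the
    -- left gives one claim.
    choose-vertex : ∀ (A : List X) (bad : List (List X)) →
      (∀ {e} → e ∈ A → R ≤ 2 * C * deg e) → (∀ {es} → es ∈ bad → common es ≤ β) →
      0 < length A → 0 < length bad →
      ∃ λ g → length A ≤ 4 * C * length (filterᵇ (λ e → E e g) A)
            × B * length (filterᵇ (λ es → commonly es g) bad) ≤ 4 * C * length bad
    choose-vertex A bad rich poor A>0 bad>0 = g , claim₁ , claim₂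
      where
      a = length A
      b = length bad
      A′ : Fin R → ℕ
      A′ g = length (filterᵇ (λ e → E e g) A)
      b′ : Fin R → ℕ
      b′ g = length (filterᵇ (λ es → commonly es g) bad)
      lhs : ∑ (allFin R) (λ g → a * b + (B * a) * b′ g) ≤ 2 * (a * R * b)
      lhs = begin
        ∑ (allFin R) (λ g → a * b + (B * a) * b′ g)
          ≡⟨ ∑-+ (allFin R) _ _ ⟩
        ∑ (allFin R) (λ _ → a * b) + ∑ (allFin R) (λ g → (B * a) * b′ g)
          ≡⟨ cong₂ _+_ (trans (∑-const (allFin R) _) (cong (_* (a * b)) (length-allFin R))) (∑-*ˡ (B * a) (allFin R) b′) ⟩
        R * (a * b) + (B * a) * ∑ (allFin R) b′
          ≤⟨ +-monoʳ-≤ (R * (a * b)) (*-monoʳ-≤ (B * a) (≤-trans (≤-reflexive (∑-length-filter commonly bad)) (∑-≤const-∈ bad poor))) ⟩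
        R * (a * b) + (B * a) * (b * β)
          ≡⟨ cong (R * (a * b) +_) (lem B a b β) ⟩
        R * (a * b) + (B * β) * (a * b)
          ≡⟨ cong (λ r → R * (a * b) + r * (a * b)) (sym R≡Bβ) ⟩
        R * (a * b) + R * (a * b)
          ≡⟨ lem′ R a b ⟩
        2 * (a * R * b) ∎
        where
        open ≤-Reasoning
        lem : ∀ B a b β → (B * a) * (b * β) ≡ (B * β) * (a * b)
        lem = solve-∀
        lem′ : ∀ R a b → R * (a * b) + R * (a * b) ≡ 2 * (a * R * b)
        lem′ = solve-∀
      rhs : 2 * (a * R * b) ≤ ∑ (allFin R) (λ g → (4 * C * b) * A′ g)
      rhs = begin
        2 * (a * R * b)
          ≤⟨ *-monoʳ-≤ 2 (*-monoˡ-≤ b (begin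
               a * R                             ≡⟨ sym (∑-const A R) ⟩
               ∑ A (λ _ → R)                     ≤⟨ ∑-mono-∈ A rich ⟩
               ∑ A (λ e → 2 * C * deg e)      ≡⟨ ∑-*ˡ (2 * C) A deg ⟩
               2 * C * ∑ A deg                ∎)) ⟩
        2 * (2 * C * ∑ A deg * b)
          ≡⟨ lem C (∑ A deg) b ⟩
        (4 * C * b) * ∑ A deg
          ≡⟨ cong ((4 * C * b) *_) (sym (∑-length-filter E A)) ⟩
        (4 * C * b) * ∑ (allFin R) A′
          ≡⟨ sym (∑-*ˡ (4 * C * b) (allFin R) A′) ⟩
        ∑ (allFin R) (λ g → (4 * C * b) * A′ g) ∎
        where
        open ≤-Reasoning
        lem : ∀ C s b → 2 * (2 * C * s * b) ≡ (4 * C * b) * s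
        lem = solve-∀
      found = ∑≤⇒∃≤ (allFin R) _ _ (subst (0 <_) (sym (length-allFin R)) R>0) (≤-trans lhs rhs)
      g = proj₁ found
      ineq : a * b + (B * a) * b′ g ≤ (4 * C * b) * A′ g
      ineq = proj₂ (proj₂ found)
      instance
        nzb : NonZero b
        nzb = >-nonZero bad>0
        nza : NonZero a
        nza = >-nonZero A>0
      claim₁ : a ≤ 4 * C * A′ g
      claim₁ = *-cancelʳ-≤ a (4 * C * A′ g) b (≤-trans (m≤m+n _ _) (≤-trans ineq (≤-reflexive (lem (4 * C) b (A′ g)))))
        where
        lem : ∀ C b s → (C * b) * s ≡ C * s * b
        lem = solve-∀
      claim₂ : B * b′ g ≤ 4 * C * b
      claim₂ = *-cancelʳ-≤ (B * b′ g) (4 * C * b) a (begin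
        B * b′ g * a              ≡⟨ lem B (b′ g) a ⟩
        (B * a) * b′ g            ≤⟨ ≤-trans (m≤n+m _ _) ineq ⟩
        (4 * C * b) * A′ g        ≤⟨ *-monoʳ-≤ (4 * C * b) (≤-trans (≤-reflexive (length-filterᵇ _ A)) (count-≤ _ A)) ⟩
        4 * C * b * a             ∎)
        where
        open ≤-Reasoning
        lem : ∀ B b a → B * b * a ≡ (B * a) * b
        lem = solve-∀

    4C>0 : 0 < 4 * C
    4C>0 = ≤-trans C>0 (m≤m+n C _)

    Survivors : ℕ → List X → List (List X) → Set
    Survivors k A bad =
      ∃ λ (p : X → Bool) → length A ≤ (4 * C) ^ k * count p A × (∀ {es} → es ∈ bad → all p es ≡ true → ⊥)

    -- The degree conditions refer to the unfiltered `E`, so they pass to sublists of `A` and `bad`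
    -- and every round starts under the same hypotheses.
    Rounds : ℕ → Set
    Rounds k = ∀ (A : List X) (bad : List (List X)) →
      (∀ {e} → e ∈ A → R ≤ 2 * C * deg e) → (∀ {es} → es ∈ bad → common es ≤ β) →
      0 < length A → (4 * C) ^ k * length bad < B ^ k → Survivors k A bad

    shrink-A : ∀ (A : List X) g → 0 < length A → length A ≤ 4 * C * length (filterᵇ (λ e → E e g) A) →
      0 < length (filterᵇ (λ e → E e g) A)
    shrink-A A g A>0 A≤ =
      n≢0⇒n>0 λ e → <⇒≱ A>0 (≤-trans A≤ (≤-reflexive (trans (cong (4 * C *_) e) (*-zeroʳ (4 * C)))))

    shrink-bad : ∀ k x y → (4 * C) ^ suc k * x < B ^ suc k → B * y ≤ 4 * C * x → (4 * C) ^ k * y < B ^ k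
    shrink-bad k x y h bad≤ = *-cancelˡ-< B _ _ (begin-strict
      B * ((4 * C) ^ k * y)              ≡⟨ lem B ((4 * C) ^ k) y ⟩
      (4 * C) ^ k * (B * y)              ≤⟨ *-monoʳ-≤ ((4 * C) ^ k) bad≤ ⟩
      (4 * C) ^ k * (4 * C * x)          ≡⟨ lem′ ((4 * C) ^ k) (4 * C) x ⟩
      (4 * C) ^ suc k * x                <⟨ h ⟩
      B ^ suc k ∎)
      where
      open ≤-Reasoning
      lem : ∀ B x y → B * (x * y) ≡ x * (B * y)
      lem = solve-∀
      lem′ : ∀ x y z → x * (y * z) ≡ y * x * z
      lem′ = solve-∀

    survive : ∀ k A bad g → length A ≤ 4 * C * length (filterᵇ (λ e → E e g) A) →
      Survivors k (filterᵇ (λ e → E e g) A) (filterᵇ (λ es → commonly es g) bad) → Survivors (suc k) A bad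
    survive k A bad g A≤ (p′ , bound , none) = p , claim₁ , claim₂
      where
      A₁ : List X
      A₁ = filterᵇ (λ e → E e g) A
      p : X → Bool
      p e = E e g ∧ p′ e
      claim₁ : length A ≤ (4 * C) ^ suc k * count p A
      claim₁ = begin
        length A                                   ≤⟨ A≤ ⟩
        4 * C * length A₁                          ≤⟨ *-monoʳ-≤ (4 * C) bound ⟩
        4 * C * ((4 * C) ^ k * count p′ A₁)        ≡⟨ sym (*-assoc (4 * C) ((4 * C) ^ k) (count p′ A₁)) ⟩
        (4 * C) ^ suc k * count p′ A₁              ≡⟨ cong ((4 * C) ^ suc k *_) (trans (∑-filterᵇ (λ e → E e g) A (λ e → ⟦ p′ e ⟧)) (∑-cong A pt)) ⟩
        (4 * C) ^ suc k * count p A                ∎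
        where
        open ≤-Reasoning
        pt : ∀ e → ⟦ E e g ⟧ * ⟦ p′ e ⟧ ≡ ⟦ p e ⟧
        pt e with E e g
        ... | true  = +-identityʳ _
        ... | false = refl
      claim₂ : ∀ {es} → es ∈ bad → all p es ≡ true → ⊥
      claim₂ {es} m e = none {es}
        (∈-filterᵇ⁺ (λ es → commonly es g) m (all-intro (λ e → E e g) es (λ {x} m′ → proj₁ (∧-true {E x g} (all-true p {es} e m′)))))
        (all-intro p′ es (λ {x} m′ → proj₂ (∧-true {E x g} (all-true p {es} e m′))))

    rounds : ∀ k → Rounds k
    rounds k A [] rich poor A>0 h = (λ _ → true) , (begin
        length A                        ≡⟨ sym (+-identityʳ _) ⟩
        1 * length A                    ≤⟨ *-mono-≤ (≤-trans (≤-reflexive (sym (^-zeroˡ k))) (^-monoˡ-≤ k 4C>0)) (≤-reflexive (length≡∑1 A)) ⟩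
        (4 * C) ^ k * count (λ _ → true) A ∎) , λ ()
      where open ≤-Reasoning
    -- With no round left the last hypothesis says that there are fewer than one bad tuples.
    rounds zero    A (b ∷ bad) rich poor A>0 h = ⊥-elim (<⇒≱ h (s≤s z≤n))
    rounds (suc k) A (b ∷ bad) rich poor A>0 h = next (b ∷ bad) poor h (choose-vertex A (b ∷ bad) rich poor A>0 (s≤s z≤n))
      where
      next : ∀ bad → (∀ {es} → es ∈ bad → common es ≤ β) → (4 * C) ^ suc k * length bad < B ^ suc k →
        (∃ λ g → length A ≤ 4 * C * length (filterᵇ (λ e → E e g) A)
               × B * length (filterᵇ (λ es → commonly es g) bad) ≤ 4 * C * length bad) → Survivors (suc k) A bad
      next bad poor h (g , A≤ , bad≤) = survive k A bad g A≤
        (rounds k (filterᵇ (λ e → E e g) A) (filterᵇ (λ es → commonly es g) bad)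
          (λ m → rich (proj₁ (∈-filterᵇ⁻ (λ e → E e g) m)))
          (λ m → poor (proj₁ (∈-filterᵇ⁻ (λ es → commonly es g) {bad} m)))
          (shrink-A A g A>0 A≤)
          (shrink-bad k (length bad) (length (filterᵇ (λ es → commonly es g) bad)) h bad≤))

    -- Elements of degree below `R / (2 * C)` contribute at most half of the degree sum, so a
    -- proportion `1 / (2 * C)` of `A₀` has larger degree. This provides the condition under which
    -- the rounds run.
    drc : ∀ t (A₀ : List X) → 0 < length A₀ → R * length A₀ ≤ C * ∑ A₀ deg →
      (4 * C) ^ t * (1 + length A₀) ^ Δ < B ^ t →
      ∃ λ (p : X → Bool) → length A₀ ≤ 2 * C * (4 * C) ^ t * count p A₀
        × (∀ es → length es ≤ Δ → (∀ {e} → e ∈ es → e ∈ A₀ × p e ≡ true) → β ≤ common es)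
    drc t A₀ A₀>0 dense h = p , bound , good
      where
      high : X → Bool
      high e = does (R ≤? 2 * C * deg e)
      A = filterᵇ high A₀
      bad = filterᵇ (λ es → does (common es ≤? β)) (tuples Δ A)
      |A₀|≤ : length A₀ ≤ 2 * C * length A
      |A₀|≤ = *-cancelˡ-≤ R (+-cancelˡ-≤ (R * length A₀) _ _ (begin
        R * length A₀ + R * length A₀               ≡⟨ lem (R * length A₀) ⟩
        2 * (R * length A₀)                         ≤⟨ *-monoʳ-≤ 2 dense ⟩
        2 * (C * ∑ A₀ deg)                       ≡⟨ trans (sym (*-assoc 2 C _)) (sym (∑-*ˡ (2 * C) A₀ deg)) ⟩
        ∑ A₀ (λ e → 2 * C * deg e)               ≤⟨ ∑-mono A₀ pt ⟩
        ∑ A₀ (λ e → R + R * (2 * C) * ⟦ high e ⟧)   ≡⟨ ∑-+ A₀ _ _ ⟩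
        ∑ A₀ (λ _ → R) + ∑ A₀ (λ e → R * (2 * C) * ⟦ high e ⟧)
          ≡⟨ cong₂ _+_ (trans (∑-const A₀ R) (*-comm (length A₀) R)) (∑-*ˡ (R * (2 * C)) A₀ _) ⟩
        R * length A₀ + R * (2 * C) * count high A₀ ≡⟨ cong (λ c → R * length A₀ + R * (2 * C) * c) (sym (length-filterᵇ high A₀)) ⟩
        R * length A₀ + R * (2 * C) * length A      ≡⟨ cong (R * length A₀ +_) (*-assoc R (2 * C) _) ⟩
        R * length A₀ + R * (2 * C * length A)      ∎))
        where
        open ≤-Reasoning
        instance
          nzR : NonZero R
          nzR = >-nonZero R>0
        lem : ∀ x → x + x ≡ 2 * x
        lem = solve-∀
        low : ∀ {x m} (d : Dec (R ≤ x)) → x ≤ m → x ≤ R + m * ⟦ does d ⟧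
        low (no ¬p) _ = ≤-trans (<⇒≤ (≰⇒> ¬p)) (m≤m+n R _)
        low {m = m} (yes _) h = ≤-trans h (≤-trans (≤-reflexive (sym (*-identityʳ m))) (m≤n+m _ R))
        pt : ∀ e → 2 * C * deg e ≤ R + R * (2 * C) * ⟦ high e ⟧
        pt e = low (R ≤? 2 * C * deg e) (≤-trans (*-monoʳ-≤ (2 * C) (≤-trans (count-≤ (E e) (allFin R)) (≤-reflexive (length-allFin R))))
                      (≤-reflexive (*-comm (2 * C) R)))
      A>0 : 0 < length A
      A>0 = n≢0⇒n>0 λ e → <⇒≱ A₀>0 (≤-trans |A₀|≤ (≤-reflexive (trans (cong (2 * C *_) e) (*-zeroʳ (2 * C)))))
      |bad|≤ : length bad ≤ (1 + length A₀) ^ Δ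
      |bad|≤ = begin
        length bad                ≡⟨ length-filterᵇ _ (tuples Δ A) ⟩
        count _ (tuples Δ A)      ≤⟨ count-≤ _ (tuples Δ A) ⟩
        length (tuples Δ A)       ≤⟨ length-tuples Δ A ⟩
        (1 + length A) ^ Δ        ≤⟨ ^-monoˡ-≤ Δ (s≤s (≤-trans (≤-reflexive (length-filterᵇ high A₀)) (count-≤ high A₀))) ⟩
        (1 + length A₀) ^ Δ       ∎
        where open ≤-Reasoning
      result = rounds t A bad
        (λ {e} m → does-true (R ≤? 2 * C * deg e) (proj₂ (∈-filterᵇ⁻ high {A₀} m)))
        (λ {es} m → does-true (common es ≤? β) (proj₂ (∈-filterᵇ⁻ _ {tuples Δ A} m)))
        A>0 (≤-<-trans (*-monoʳ-≤ ((4 * C) ^ t) |bad|≤) h)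
      q′ = proj₁ result
      p : X → Bool
      p e = high e ∧ q′ e
      bound : length A₀ ≤ 2 * C * (4 * C) ^ t * count p A₀
      bound = begin
        length A₀                                ≤⟨ |A₀|≤ ⟩
        2 * C * length A                         ≤⟨ *-monoʳ-≤ (2 * C) (proj₁ (proj₂ result)) ⟩
        2 * C * ((4 * C) ^ t * count q′ A)        ≡⟨ sym (*-assoc (2 * C) ((4 * C) ^ t) _) ⟩
        2 * C * (4 * C) ^ t * count q′ A          ≡⟨ cong (2 * C * (4 * C) ^ t *_) (trans (∑-filterᵇ high A₀ _) (∑-cong A₀ pt)) ⟩
        2 * C * (4 * C) ^ t * count p A₀         ∎
        where
        open ≤-Reasoning
        pt : ∀ e → ⟦ high e ⟧ * ⟦ q′ e ⟧ ≡ ⟦ p e ⟧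
        pt e with high e
        ... | true  = +-identityʳ _
        ... | false = refl
      good : ∀ es → length es ≤ Δ → (∀ {e} → e ∈ es → e ∈ A₀ × p e ≡ true) → β ≤ common es
      good es l m = ≮⇒≥ λ q → proj₂ (proj₂ result) {es}
        (∈-filterᵇ⁺ (λ es → does (common es ≤? β)) {tuples Δ A}
          (∈-tuples Δ es l (λ {e} i → ∈-filterᵇ⁺ high (proj₁ (m i)) (proj₁ (∧-true {high e} (proj₂ (m i))))))
          (dec-true (common es ≤? β) (<⇒≤ q)))
        (all-intro q′ es (λ {e} i → proj₂ (∧-true {high e} (proj₂ (m i)))))

module _ (R β B Δ : ℕ) (R≡Bβ : R ≡ B * β) (B>0 : 0 < B) (R>0 : 0 < R) where

  Extends : ∀ {j} → (Vec (Fin R) j → Bool) → (Vec (Fin R) (suc j) → Bool) → Set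
  Extends {j} E₁ E = ∀ (es : List (Vec (Fin R) j)) → length es ≤ Δ → (∀ {e} → e ∈ es → E₁ e ≡ true) →
    β ≤ count (λ g → all (λ e → E (g ∷ e)) es) (allFin R)

  -- Dependent random choice prepared for all coordinates at once: at each level any `Δ` admissible
  -- partial vectors have `β` common values for the next coordinate. Coordinates are added at the
  -- front, so the last one is assigned before all others.
  data Chain : ∀ j → (Vec (Fin R) j → Bool) → Set where
    empty : ∀ {E} → E [] ≡ true → Chain zero E
    extend : ∀ {j E E₁} → Extends E₁ E → Chain j E₁ → Chain (suc j) E

-- Density lost in one application of `drc`: a factor `2 * C` for the elements of low degree and
-- `4 * C` for each of the `t` rounds.
nextC : ℕ → ℕ → ℕ
nextC t C = 2 * C * (4 * C) ^ t

iterC : ℕ → ℕ → ℕ → ℕ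
iterC t zero    C = C
iterC t (suc j) C = iterC t j (nextC t C)

nextC-≥ : ∀ t C → C ≤ nextC t C
nextC-≥ t zero    = z≤n
nextC-≥ t (suc c) = begin
  suc c                              ≤⟨ m≤m+n (suc c) _ ⟩
  2 * suc c                          ≡⟨ sym (*-identityʳ _) ⟩
  2 * suc c * 1                      ≤⟨ *-monoʳ-≤ (2 * suc c) (m^n>0 (4 * suc c) t) ⟩
  nextC t (suc c)                    ∎
  where open ≤-Reasoning

iterC-≥ : ∀ t j C → C ≤ iterC t j C
iterC-≥ t zero    C = ≤-refl
iterC-≥ t (suc j) C = ≤-trans (nextC-≥ t C) (iterC-≥ t j (nextC t C))

module _ (R β B Δ : ℕ) (R≡Bβ : R ≡ B * β) (B>0 : 0 < B) (R>0 : 0 < R) where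

  -- The last hypothesis is stated with the worst constant and the longest vectors, so that this one
  -- inequality serves all levels.
  chain : ∀ t j C (E : Vec (Fin R) j → Bool) → 0 < C → R ^ j ≤ C * count E (vecs R j) →
          (4 * iterC t j C) ^ t * (1 + R ^ j) ^ Δ < B ^ t → Chain R β B Δ R≡Bβ B>0 R>0 j E
  chain t zero C E C>0 dense h = empty lem
    where
    lem : E [] ≡ true
    lem with E []
    ... | true  = refl
    ... | false = ⊥-elim (<⇒≱ dense (≤-reflexive (*-zeroʳ C)))
  chain t (suc j) C E C>0 dense h =
    extend (λ es l m → proj₂ (proj₂ d) es l (λ {e} i → ∈-vecs R j e , m i))
      (chain t j (nextC t C) (proj₁ d) (≤-trans C>0 (nextC-≥ t C))
        (subst (_≤ nextC t C * count (proj₁ d) (vecs R j)) (length-vecs R j) (proj₁ (proj₂ d)))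
        (≤-<-trans (*-monoʳ-≤ ((4 * iterC t j (nextC t C)) ^ t) (^-monoˡ-≤ Δ (s≤s Rʲ≤))) h))
    where
    Rʲ≤ : R ^ j ≤ R ^ suc j
    Rʲ≤ = ≤-trans (≤-reflexive (sym (*-identityˡ _))) (*-monoˡ-≤ (R ^ j) R>0)
    d = DRC.drc R β B Δ R≡Bβ B>0 R>0 (λ e g → E (g ∷ e)) C C>0 t (vecs R j)
          (subst (0 <_) (sym (length-vecs R j)) (subst (_≤ R ^ j) (^-zeroˡ j) (^-monoˡ-≤ j R>0)))
          (begin
            R * length (vecs R j)   ≡⟨ cong (R *_) (length-vecs R j) ⟩
            R ^ suc j               ≤⟨ dense ⟩
            C * count E (vecs R (suc j))
              ≡⟨ cong (C *_) (trans (∑-vecs R j _) (∑-swap (allFin R) (vecs R j) (λ g e → ⟦ E (g ∷ e) ⟧))) ⟩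
            C * ∑ (vecs R j) (λ e → count (λ g → E (g ∷ e)) (allFin R)) ∎)
          (≤-<-trans (*-mono-≤ (^-monoˡ-≤ t (*-monoʳ-≤ 4 (iterC-≥ t (suc j) C)))
             (^-monoˡ-≤ Δ (s≤s (≤-trans (≤-reflexive (length-vecs R j)) Rʲ≤)))) h)
      where open ≤-Reasoning

-- Greedy embedding

Separated : ∀ {κ R} → (Fin κ → Fin κ → Bool) → (Fin κ → Fin R) → Set
Separated link val = ∀ {k k′} → link k k′ ≡ true → k ≢ k′ → val k ≢ val k′

Symmetricᵇ : ∀ {κ} → (Fin κ → Fin κ → Bool) → Set
Symmetricᵇ link = ∀ {k k′} → link k k′ ≡ true → link k′ k ≡ true

module _ {κ R : ℕ} (good : Fin κ → Fin R → Bool) (link : Fin κ → Fin κ → Bool) (link-sym : Symmetricᵇ link)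
         (room : ∀ k → count (link k) (allFin κ) < count (good k) (allFin R)) where

  open DecMem {A = Fin R} F._≟_ using (_∈?_)

  private
    used : (Fin κ → Fin R) → Fin κ → List (Fin R)
    used val k = map val (filterᵇ (link k) (allFin κ))

    fresh : ∀ val k → ∃ λ g → g ∈ allFin R × does (g ∈? used val k) ≡ false × good k g ≡ true
    fresh val k = count<⇒∃ (λ g → does (g ∈? used val k)) (good k) (allFin R)
      (≤-<-trans (count-⊆ _ (used val k) (λ g e → does-true (g ∈? used val k) e))
        (subst (_< count (good k) (allFin R))
          (sym (trans (LP.length-map val (filterᵇ (link k) (allFin κ))) (length-filterᵇ (link k) (allFin κ)))) (room k)))

    assign : ∀ ks → ∃ λ (val : Fin κ → Fin R) → (∀ {k} → k ∈ ks → good k (val k) ≡ true)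
      × (∀ {k k′} → k ∈ ks → k′ ∈ ks → link k k′ ≡ true → k ≢ k′ → val k ≢ val k′)
    -- A total default assignment. A linked key that is still unassigned blocks its default value
    -- too; `room` counts all linked keys and so pays for this.
    assign []       = (λ k → proj₁ (count>0⇒∃ (good k) (allFin R) (≤-<-trans z≤n (room k)))) , (λ ()) , λ ()
    assign (k ∷ ks) = val′ , good′ , sep′
      where
      rec = assign ks
      val = proj₁ rec
      new = fresh val k
      g   = proj₁ new
      val′ : Fin κ → Fin R
      val′ k′ with k′ F.≟ k
      ... | yes _ = g
      ... | no  _ = val k′
      good′ : ∀ {k′} → k′ ∈ k ∷ ks → good k′ (val′ k′) ≡ true
      good′ {k′} m with k′ F.≟ k
      good′ m          | yes refl = proj₂ (proj₂ (proj₂ new))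
      good′ (here e)   | no ¬e = ⊥-elim (¬e e)
      good′ (there m)  | no ¬e = proj₁ (proj₂ rec) m
      unused : ∀ {k′} → link k k′ ≡ true → g ≢ val k′
      unused {k′} l e = does-false (g ∈? used val k) (proj₁ (proj₂ (proj₂ new)))
        (subst (_∈ used val k) (sym e) (MP.∈-map⁺ val (∈-filterᵇ⁺ (link k) (MP.∈-allFin k′) l)))
      sep′ : ∀ {k₁ k₂} → k₁ ∈ k ∷ ks → k₂ ∈ k ∷ ks → link k₁ k₂ ≡ true → k₁ ≢ k₂ → val′ k₁ ≢ val′ k₂
      sep′ {k₁} {k₂} m₁ m₂ l ne with k₁ F.≟ k | k₂ F.≟ k
      ... | yes refl | yes refl = ⊥-elim (ne refl)
      ... | yes refl | no _     = unused l
      ... | no _     | yes refl = unused (link-sym l) ∘ sym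
      sep′ (here e) _ l ne | no ¬e | no _ = ⊥-elim (¬e e)
      sep′ (there _) (here e) l ne | no _ | no ¬e = ⊥-elim (¬e e)
      sep′ (there m₁) (there m₂) l ne | no _ | no _ = proj₂ (proj₂ rec) m₁ m₂ l ne

  greedy : ∃ λ (val : Fin κ → Fin R) → (∀ k → good k (val k) ≡ true) × Separated link val
  greedy = let val , g , s = assign (allFin κ) in
    val , (λ k → g (MP.∈-allFin k)) , λ {k} {k′} → s (MP.∈-allFin k) (MP.∈-allFin k′)

greedy-colouring : ∀ {κ} d (link : Fin κ → Fin κ → Bool) → Symmetricᵇ link →
  (∀ k → count (link k) (allFin κ) ≤ d) → ∃ λ (c : Fin κ → Fin (suc d)) → Separated link c
greedy-colouring d link s h =
  let val , _ , sep = greedy (λ _ _ → true) link s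
        (λ k → s≤s (≤-trans (h k) (≤-reflexive (sym (suc-injective (trans (sym (length≡∑1 (allFin (suc d)))) (length-allFin (suc d))))))))
  in val , sep

module _ (R β B Δ : ℕ) (R≡Bβ : R ≡ B * β) (B>0 : 0 < B) (R>0 : 0 < R) {I : Set} (cs : List I) where

  private
    Extends′ : ∀ {j} → (Vec (Fin R) j → Bool) → (Vec (Fin R) (suc j) → Bool) → Set
    Extends′ = Extends R β B Δ R≡Bβ B>0 R>0
    Chain′ : ∀ j → (Vec (Fin R) j → Bool) → Set
    Chain′ = Chain R β B Δ R≡Bβ B>0 R>0

  -- All constraints that use the key `k` in this coordinate must accept its value simultaneously.
  -- There are at most `Δ` of them, so `Extends` offers `β` values, and fewer than `β` are blocked
  -- by linked keys.
  stage : ∀ {j κ} {E₁ : Vec (Fin R) j → Bool} {E : Vec (Fin R) (suc j) → Bool} → Extends′ E₁ E →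
    (e : I → Vec (Fin R) j) → (∀ {c} → c ∈ cs → E₁ (e c) ≡ true) →
    (key : I → Fin κ) → (∀ k → count (λ c → does (key c F.≟ k)) cs ≤ Δ) →
    (link : Fin κ → Fin κ → Bool) → Symmetricᵇ link → (∀ k → count (link k) (allFin κ) < β) →
    ∃ λ (val : Fin κ → Fin R) → (∀ {c} → c ∈ cs → E (val (key c) ∷ e c) ≡ true) × Separated link val
  stage {E₁ = E₁} {E = E} ext e e∈ key fibre link sym′ deg =
    let val , good , sep = greedy (λ k g → all (λ v → E (g ∷ v)) (tuple k)) link sym′
          (λ k → <-≤-trans (deg k) (ext (tuple k)
            (≤-trans (≤-reflexive (trans (LP.length-map e (group k)) (length-filterᵇ _ cs))) (fibre k))
            (λ m → let c , c∈ , eq = MP.∈-map⁻ e m in trans (cong E₁ eq) (e∈ (proj₁ (∈-filterᵇ⁻ _ {cs} c∈))))))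
    in val , (λ {c} m → all-true (λ v → E (val (key c) ∷ v)) {tuple (key c)} (good (key c))
                (MP.∈-map⁺ e (∈-filterᵇ⁺ (λ c′ → does (key c′ F.≟ key c)) m (dec-true (key c F.≟ key c) refl)))) , sep
    where
    group : _ → List I
    group k = filterᵇ (λ c → does (key c F.≟ k)) cs
    tuple : _ → List (Vec (Fin R) _)
    tuple k = map e (group k)

  module _ {n : ℕ} where

    EmbeddedY : ∀ b → (Vec (Fin R) b → Bool) → (Fin b → I → Fin n) → (Fin n → Fin n → Bool) → Set
    EmbeddedY b E key link = ∃ λ (η : Fin b → Fin n → Fin R) →
      (∀ {c} → c ∈ cs → E (tabulate (λ t → η t (key t c))) ≡ true) × (∀ t → Separated link (η t))

    embedY : ∀ b (E : Vec (Fin R) b → Bool) → Chain′ b E →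
      (key : Fin b → I → Fin n) → (∀ t k → count (λ c → does (key t c F.≟ k)) cs ≤ Δ) →
      (link : Fin n → Fin n → Bool) → Symmetricᵇ link → (∀ k → count (link k) (allFin n) < β) →
      EmbeddedY b E key link
    embedY zero E (empty e) key fibre link s deg = (λ ()) , (λ _ → e) , λ ()
    embedY (suc b) E (extend {E₁ = E₁} ext ch) key fibre link s deg =
      next (embedY b E₁ ch (key ∘ suc) (fibre ∘ suc) link s deg)
      where
      next : EmbeddedY b E₁ (key ∘ suc) link → EmbeddedY (suc b) E key link
      next (η , η∈ , sep) =
        let val , v∈ , sep′ = stage {E = E} ext (λ c → tabulate (λ t → η t (key (suc t) c))) η∈ (key zero) (fibre zero) link s deg
        in (λ { zero → val ; (suc t) → η t }) , v∈ , λ { zero → sep′ ; (suc t) → sep t }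

    EmbeddedXY : ∀ a b → (Vec (Fin R) (a + b) → Bool) → (Fin b → I → Fin n) → (Fin n → Fin n → Bool) →
      (Fin a → I → Fin n) → ((Fin b → Fin n → Fin R) → Fin n → Fin n → Bool) → Set
    EmbeddedXY a b E keyY linkY keyX linkX =
      ∃ λ (ξ : Fin a → Fin n → Fin R) → ∃ λ (η : Fin b → Fin n → Fin R) →
        (∀ {c} → c ∈ cs → E (tabulate (λ s → ξ s (keyX s c)) V.++ tabulate (λ t → η t (keyY t c))) ≡ true)
        × (∀ t → Separated linkY (η t)) × (∀ s → Separated (linkX η) (ξ s))

    -- The column coordinates form the tail of the vector and are assigned before any row
    -- coordinate. Therefore the conflicts `linkX` between row keys may depend on the column values
    -- `η`.
    embedXY : ∀ a b (E : Vec (Fin R) (a + b) → Bool) → Chain′ (a + b) E →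
      (keyY : Fin b → I → Fin n) → (∀ t k → count (λ c → does (keyY t c F.≟ k)) cs ≤ Δ) →
      (linkY : Fin n → Fin n → Bool) → Symmetricᵇ linkY → (∀ k → count (linkY k) (allFin n) < β) →
      (keyX : Fin a → I → Fin n) → (∀ t k → count (λ c → does (keyX t c F.≟ k)) cs ≤ Δ) →
      (linkX : (Fin b → Fin n → Fin R) → Fin n → Fin n → Bool) → (∀ η → Symmetricᵇ (linkX η)) →
      (∀ η → (∀ t → Separated linkY (η t)) → ∀ k → count (linkX η k) (allFin n) < β) →
      EmbeddedXY a b E keyY linkY keyX linkX
    embedXY zero b E ch keyY fY linkY sY dY keyX fX linkX sX dX =
      let η , η∈ , sep = embedY b E ch keyY fY linkY sY dY in (λ ()) , η , η∈ , sep , λ ()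
    embedXY (suc a) b E (extend {E₁ = E₁} ext ch) keyY fY linkY sY dY keyX fX linkX sX dX =
      next (embedXY a b E₁ ch keyY fY linkY sY dY (keyX ∘ suc) (fX ∘ suc) linkX sX dX)
      where
      next : EmbeddedXY a b E₁ keyY linkY (keyX ∘ suc) linkX → EmbeddedXY (suc a) b E keyY linkY keyX linkX
      next (ξ , η , ∈E , sepY , sepX) =
        let val , v∈ , sep′ = stage {E = E} ext (λ c → tabulate (λ s → ξ s (keyX (suc s) c)) V.++ tabulate (λ t → η t (keyY t c))) ∈E
                                (keyX zero) (fX zero) (linkX η) (sX η) (dX η sepY)
        in (λ { zero → val ; (suc s) → ξ s }) , η , v∈ , sepY , λ { zero → sep′ ; (suc s) → sepX s }

-- Components, forests and exclusive edge classes

module _ {n : ℕ} where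

  private
    Vx = Fin n
    Edge = Vx × Vx

  Closed : List Edge → (Vx → Set) → Set
  Closed es P = ∀ {c d} → (c , d) ∈ es → (P c → P d) × (P d → P c)

  -- The representative of the connected component of a vertex.
  rep : List Edge → Vx → Vx
  rep []             v = v
  rep ((a , b) ∷ es) v with rep es v F.≟ rep es a
  ... | yes _ = rep es b
  ... | no  _ = rep es v

  -- Replaces induction along a walk: a property that no edge leaves or enters is constant on
  -- components. Component sizes are later bounded by exhibiting such properties.
  rep-elim : ∀ es {P : Vx → Set} → Closed es P → ∀ {u v} → rep es u ≡ rep es v → P u → P v
  rep-elim []             cl refl p = p
  rep-elim ((a , b) ∷ es) {P} cl {u} {v} e p with rep es u F.≟ rep es a | rep es v F.≟ rep es a
  ... | yes eu | yes ev = rep-elim es {P} (cl ∘ there) (trans eu (sym ev)) p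
  ... | no _   | no _   = rep-elim es {P} (cl ∘ there) e p
  ... | yes eu | no _   = rep-elim es {P} (cl ∘ there) e (proj₁ (cl (here refl)) (rep-elim es {P} (cl ∘ there) eu p))
  ... | no _   | yes ev = rep-elim es {P} (cl ∘ there) (sym ev) (proj₂ (cl (here refl)) (rep-elim es {P} (cl ∘ there) e p))

  rep-edge : ∀ {es a b} → (a , b) ∈ es → rep es a ≡ rep es b
  rep-edge {(a , b) ∷ es} (here refl) with rep es a F.≟ rep es a | rep es b F.≟ rep es a
  ... | yes _ | yes _ = refl
  ... | yes _ | no _  = refl
  ... | no ¬e | _     = ⊥-elim (¬e refl)
  rep-edge {(a′ , b′) ∷ es} {a} {b} (there m) with rep-edge m | rep es a F.≟ rep es a′ | rep es b F.≟ rep es a′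
  ... | _ | yes _  | yes _  = refl
  ... | e | no _   | no _   = e
  ... | e | yes ea | no ¬b  = ⊥-elim (¬b (trans (sym e) ea))
  ... | e | no ¬a  | yes eb = ⊥-elim (¬a (trans e eb))

  rep-mono : ∀ {es es′} → (∀ {e} → e ∈ es → e ∈ es′) → ∀ {u v} → rep es u ≡ rep es v → rep es′ u ≡ rep es′ v
  rep-mono {es} {es′} sub {u} e = rep-elim es {λ w → rep es′ u ≡ rep es′ w}
    (λ m → (λ p → trans p (rep-edge (sub m))) , (λ p → trans p (sym (rep-edge (sub m))))) e refl

  -- Every edge is a bridge, witnessed by a side `P` whose boundary is this edge alone.
  IsForest : List Edge → Set₁
  IsForest es = ∀ {a b} → (a , b) ∈ es → ∃ λ (P : Vx → Set) → P a × ¬ P b ×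
    (∀ {c d} → (c , d) ∈ es → (c , d) ≢ (a , b) → (P c → P d) × (P d → P c))

  forest-rep : ∀ {es es′} → IsForest es → (∀ {e} → e ∈ es′ → e ∈ es) →
               ∀ {a b} → (a , b) ∈ es → ¬ (a , b) ∈ es′ → rep es′ a ≢ rep es′ b
  forest-rep {es} {es′} F sub {a} {b} m ∉ e =
    let P , pa , ¬pb , cl = F m
    in ¬pb (rep-elim es′ {P} (λ {c} {d} m′ → cl (sub m′) (λ { refl → ∉ m′ })) e pa)

  all-false⇒count< : ∀ {A : Set} (p : A → Bool) xs → all p xs ≡ false → count p xs < length xs
  all-false⇒count< p (x ∷ xs) e with p x
  ... | true  = s≤s (all-false⇒count< p xs e)
  ... | false = s≤s (count-≤ p xs)

  -- Both edge classes are forests, so an edge whose ends lie in the same U-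
  -- and the same T-component can be dropped from its own class.  A fixed
  -- point of the resulting monotone operator leaves no such edge.
  module Exclusive (Uall Tall : List Edge) (forestU : IsForest Uall) (forestT : IsForest Tall) where

    apart : (Vx → Vx) → Edge → Bool
    apart f (a , b) = not (does (f a F.≟ f b))

    apart-true : ∀ f {a b} → apart f (a , b) ≡ true → f a ≢ f b
    apart-true f {a} {b} e = does-false (f a F.≟ f b) (not-true e)

    apart-intro : ∀ f {a b} → f a ≢ f b → apart f (a , b) ≡ true
    apart-intro f {a} {b} ne = not-intro (dec-false (f a F.≟ f b) ne)

    remaining : List Edge → List Edge
    remaining U = filterᵇ (apart (rep U)) Tall

    keep : List Edge → Edge → Bool
    keep U = apart (rep (remaining U))

    -- Two antitone steps compose: shrinking `U` leaves more edges of the other class, and these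
    -- make fewer pairs lie apart.
    keep-mono : ∀ {U U′} → (∀ {e} → e ∈ U′ → e ∈ U) → ∀ {a b} → keep U′ (a , b) ≡ true → keep U (a , b) ≡ true
    keep-mono {U} {U′} sub k = apart-intro (rep (remaining U)) (λ e → apart-true (rep (remaining U′)) k (rep-mono {remaining U} {remaining U′} sub′ e))
      where
      sub′ : ∀ {e} → e ∈ remaining U → e ∈ remaining U′
      sub′ {c , d} m = let m′ , e = ∈-filterᵇ⁻ (apart (rep U)) {Tall} m in
        ∈-filterᵇ⁺ (apart (rep U′)) m′ (apart-intro (rep U′) (apart-true (rep U) e ∘ rep-mono sub))

    Invariant : List Edge → Set
    Invariant U = (∀ {e} → e ∈ U → e ∈ Uall) × (∀ {e} → e ∈ Uall → keep U e ≡ true → e ∈ U) × (∀ {e} → e ∈ U → keep U e ≡ true)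

    -- Descent from `Uall` to a fixed point. By monotonicity the current list still contains every
    -- edge of `Uall` that it keeps, and each step that changes it makes it shorter.
    iterate : ∀ k U → length U ≤ k → (∀ {e} → e ∈ U → e ∈ Uall) → (∀ {e} → e ∈ Uall → keep U e ≡ true → e ∈ U) → ∃ Invariant
    iterate k U l sub post with all (keep U) U in eq
    ... | true  = U , sub , post , all-true (keep U) eq
    iterate zero [] l sub post | false = [] , sub , post , λ ()
    iterate (suc k) U l sub post | false =
      iterate k (filterᵇ (keep U) U)
        (s≤s⁻¹ (≤-trans (s≤s (≤-reflexive (length-filterᵇ (keep U) U))) (≤-trans (all-false⇒count< (keep U) U eq) l)))
        (λ m → sub (sub′ m))
        (λ {e} m k′ → let k″ = keep-mono sub′ k′ in ∈-filterᵇ⁺ (keep U) (post m k″) k″)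
      where
      sub′ : ∀ {e} → e ∈ filterᵇ (keep U) U → e ∈ U
      sub′ m = proj₁ (∈-filterᵇ⁻ (keep U) m)

    fixpoint : ∃ Invariant
    fixpoint = iterate (length Uall) Uall ≤-refl id (λ m _ → m)

    -- At the fixed point an edge is dropped from its class exactly when the other class joins its
    -- ends; the forest property then puts the ends of a dropped edge into different components of
    -- its own class. The components only get smaller, so bounds proved for `Uall` and `Tall`
    -- persist.
    exclusive : ∃ λ (x : Vx → Vx) → ∃ λ (y : Vx → Vx) →
      (∀ {P : Vx → Set} → Closed Uall P → ∀ {u v} → x u ≡ x v → P u → P v) ×
      (∀ {P : Vx → Set} → Closed Tall P → ∀ {u v} → y u ≡ y v → P u → P v) ×
      (∀ {a b} → (a , b) ∈ Uall ⊎ (a , b) ∈ Tall → (x a ≡ x b × y a ≢ y b) ⊎ (x a ≢ x b × y a ≡ y b))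
    exclusive with fixpoint
    ... | U , sub , post , kept = rep U , rep (remaining U) ,
        (λ {P} cl → rep-elim U {P} (cl ∘ sub)) ,
        (λ {P} cl → rep-elim (remaining U) {P} (cl ∘ subT)) ,
        λ { (inj₁ m) → caseU m ; (inj₂ m) → caseT m }
      where
      subT : ∀ {e} → e ∈ remaining U → e ∈ Tall
      subT m = proj₁ (∈-filterᵇ⁻ (apart (rep U)) m)
      Goal : Vx → Vx → Set
      Goal a b = (rep U a ≡ rep U b × rep (remaining U) a ≢ rep (remaining U) b)
               ⊎ (rep U a ≢ rep U b × rep (remaining U) a ≡ rep (remaining U) b)
      caseU : ∀ {a b} → (a , b) ∈ Uall → Goal a b
      caseU {a} {b} m with rep (remaining U) a F.≟ rep (remaining U) b
      ... | no ne = inj₁ (rep-edge (post m (apart-intro (rep (remaining U)) ne)) , ne)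
      ... | yes e = inj₂ (forest-rep forestU sub m (λ m′ → apart-true (rep (remaining U)) (kept m′) e) , e)
      caseT : ∀ {a b} → (a , b) ∈ Tall → Goal a b
      caseT {a} {b} m with rep U a F.≟ rep U b
      ... | no ne = inj₂ (ne , rep-edge (∈-filterᵇ⁺ (apart (rep U)) m (apart-intro (rep U) ne)))
      ... | yes e = inj₁ (e , forest-rep forestT subT m
              (λ m′ → apart-true (rep U) (proj₂ (∈-filterᵇ⁻ (apart (rep U)) {Tall} m′)) e))

-- Independent transversals

all-false⇒∃ : ∀ {A : Set} (p : A → Bool) xs → all p xs ≡ false → ∃ λ x → x ∈ xs × p x ≡ false
all-false⇒∃ p (x ∷ xs) e with p x in eq
... | false = x , here refl , eq
... | true  = let y , m , q = all-false⇒∃ p xs e in y , there m , q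

count-strict : ∀ {A : Set} {p q : A → Bool} xs → (∀ x → p x ≡ true → q x ≡ true) →
               ∀ {x} → x ∈ xs → p x ≡ false → q x ≡ true → count p xs < count q xs
count-strict {p = p} {q} (y ∷ xs) h (here refl) ep eq rewrite ep | eq = s≤s (count-mono xs h)
count-strict {p = p} {q} (y ∷ xs) h (there m)   ep eq = +-mono-≤-< (⟦⟧-mono (h y)) (count-strict xs h m ep eq)

pairs : ∀ m n → List (Fin m × Fin n)
pairs m n = concatMap (λ i → map (i ,_) (allFin n)) (allFin m)

∑-pairs : ∀ m n (f : Fin m × Fin n → ℕ) → ∑ (pairs m n) f ≡ ∑ (allFin m) (λ i → ∑ (allFin n) (λ j → f (i , j)))
∑-pairs m n f = trans (∑-concatMap _ (allFin m) f) (∑-cong (allFin m) (λ i → ∑-map (i ,_) (allFin n) f))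

∈-pairs : ∀ {m n} i j → (i , j) ∈ pairs m n
∈-pairs {m} {n} i j = MP.∈-concatMap⁺ (λ i → map (i ,_) (allFin n)) (lem (MP.∈-allFin i))
  where
  lem : ∀ {xs} → i ∈ xs → Any (λ k → (i , j) ∈ map (k ,_) (allFin n)) xs
  lem m = Any.map (λ { refl → MP.∈-map⁺ (i ,_) (MP.∈-allFin j) }) m

-- Since `Q` ignores coordinate `b`, prescribing that coordinate is an independent event of
-- probability `1/L`.
count-coordinate : ∀ {J L} (Q : Vec (Fin L) J → Bool) b i → (∀ τ g → Q (τ V.[ b ]≔ g) ≡ Q τ) →
  L * count (λ τ → Q τ ∧ does (V.lookup τ b F.≟ i)) (vecs L J) ≡ count Q (vecs L J)
count-coordinate {J} {L} Q b i ind = begin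
  L * count (λ τ → Q τ ∧ does (V.lookup τ b F.≟ i)) (vecs L J)
    ≡⟨ sym (∑-resample L J b (λ τ → ⟦ Q τ ∧ does (V.lookup τ b F.≟ i) ⟧)) ⟩
  ∑ (vecs L J) (λ τ → ∑ (allFin L) (λ g → ⟦ Q (τ V.[ b ]≔ g) ∧ does (V.lookup (τ V.[ b ]≔ g) b F.≟ i) ⟧))
    ≡⟨ ∑-cong (vecs L J) (λ τ → trans (∑-cong (allFin L) (pt τ))
         (trans (∑-*ˡ ⟦ Q τ ⟧ (allFin L) _) (trans (cong (⟦ Q τ ⟧ *_) (count-single i)) (*-identityʳ _)))) ⟩
  count Q (vecs L J) ∎
  where
  open ≡-Reasoning
  ⟦∧⟧ : ∀ a c → ⟦ a ∧ c ⟧ ≡ ⟦ a ⟧ * ⟦ c ⟧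
  ⟦∧⟧ true  c = sym (+-identityʳ _)
  ⟦∧⟧ false c = refl
  pt : ∀ τ g → ⟦ Q (τ V.[ b ]≔ g) ∧ does (V.lookup (τ V.[ b ]≔ g) b F.≟ i) ⟧ ≡ ⟦ Q τ ⟧ * ⟦ does (g F.≟ i) ⟧
  pt τ g = trans (⟦∧⟧ (Q (τ V.[ b ]≔ g)) _) (cong₂ (λ p q → ⟦ p ⟧ * ⟦ does (q F.≟ i) ⟧) (ind τ g) (VP.lookup∘update b τ g))

-- Rosenfeld's counting argument: adding a block
-- to S at worst halves the fraction of choice functions independent on S.
module Transversal (J L Δ : ℕ) (conflict : Fin J × Fin L → Fin J × Fin L → Bool)
  (conflict-sym : ∀ {u v} → conflict u v ≡ true → conflict v u ≡ true)
  (degree : ∀ u → count (conflict u) (pairs J L) ≤ Δ) (4Δ≤L : 4 * Δ ≤ L) (L>0 : 0 < L) where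

  Choice : Set
  Choice = Vec (Fin L) J

  at : Choice → Fin J → Fin J × Fin L
  at τ b = b , V.lookup τ b

  clash : (Fin J → Bool) → Choice → Fin J × Fin J → Bool
  clash S τ (b , c) = S b ∧ (S c ∧ (not (does (b F.≟ c)) ∧ conflict (at τ b) (at τ c)))

  clash-intro : ∀ S τ {b c} → S b ≡ true → S c ≡ true → b ≢ c → conflict (at τ b) (at τ c) ≡ true → clash S τ (b , c) ≡ true
  clash-intro S τ {b} {c} eb ec ne e = ∧-intro eb (∧-intro ec (∧-intro (not-intro (dec-false (b F.≟ c) ne)) e))

  clash-elim : ∀ S τ {b c} → clash S τ (b , c) ≡ true → S b ≡ true × S c ≡ true × b ≢ c × conflict (at τ b) (at τ c) ≡ true
  clash-elim S τ {b} {c} e =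
    let e₁ , r₁ = ∧-true {S b} e
        e₂ , r₂ = ∧-true {S c} r₁
        e₃ , e₄ = ∧-true {not (does (b F.≟ c))} r₂
    in e₁ , e₂ , does-false (b F.≟ c) (not-true e₃) , e₄

  independent : (Fin J → Bool) → Choice → Bool
  independent S τ = all (λ bc → not (clash S τ bc)) (pairs J J)

  independent-elim : ∀ S τ → independent S τ ≡ true → ∀ b c → clash S τ (b , c) ≡ true → ⊥
  independent-elim S τ e b c k with trans (sym (all-true _ {pairs J J} e (∈-pairs b c))) (cong not k)
  ... | ()

  independent-intro : ∀ S τ → (∀ b c → clash S τ (b , c) ≡ true → ⊥) → independent S τ ≡ true
  independent-intro S τ h = all-intro _ (pairs J J) λ { {b , c} _ → not-intro (BP.¬-not (h b c)) }

  _⊆ˢ_ : (Fin J → Bool) → (Fin J → Bool) → Set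
  S ⊆ˢ S′ = ∀ b → S b ≡ true → S′ b ≡ true

  antitone : ∀ {S S′} → S ⊆ˢ S′ → ∀ τ → independent S′ τ ≡ true → independent S τ ≡ true
  antitone {S} {S′} sub τ e = independent-intro S τ λ b c k →
    let eb , ec , ne , e′ = clash-elim S τ k in
    independent-elim S′ τ e b c (clash-intro S′ τ (sub b eb) (sub c ec) ne e′)

  _⊕_ _⊖_ : (Fin J → Bool) → Fin J → (Fin J → Bool)
  (S ⊕ b) c = S c ∨ does (c F.≟ b)
  (S ⊖ b) c = S c ∧ not (does (c F.≟ b))

  ⊖⊕ : ∀ S b → S ⊆ˢ ((S ⊖ b) ⊕ b)
  ⊖⊕ S b c e with c F.≟ b
  ... | yes _ = BP.∨-zeroʳ _
  ... | no  _ = trans (BP.∨-identityʳ _) (trans (BP.∧-identityʳ _) e)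

  ⊖-⊆ : ∀ S b → (S ⊖ b) ⊆ˢ S
  ⊖-⊆ S b c e = proj₁ (∧-true {S c} e)

  ⊖-self : ∀ S b → (S ⊖ b) b ≡ false
  ⊖-self S b rewrite dec-true (b F.≟ b) refl = BP.∧-zeroʳ (S b)

  ⊖-count : ∀ S b → S b ≡ true → count (S ⊖ b) (allFin J) < count S (allFin J)
  ⊖-count S b e = count-strict (allFin J) (⊖-⊆ S b) (MP.∈-allFin b) (⊖-self S b) e

  ⊕-true : ∀ S b c → (S ⊕ b) c ≡ true → S c ≡ true ⊎ c ≡ b
  ⊕-true S b c e with S c | c F.≟ b
  ... | true  | _     = inj₁ refl
  ... | false | yes p = inj₂ p
  ⊕-true S b c () | false | no _

  N : (Fin J → Bool) → ℕ
  N S = count (independent S) (vecs L J)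

  outside-update : ∀ S b → S b ≡ false → ∀ τ g → independent S (τ V.[ b ]≔ g) ≡ true → independent S τ ≡ true
  outside-update S b eb τ g e = independent-intro S τ λ c d k →
    let ec , ed , ne , e′ = clash-elim S τ k in
    independent-elim S (τ V.[ b ]≔ g) e c d (clash-intro S (τ V.[ b ]≔ g) ec ed ne
      (subst₂ (λ p q → conflict (c , p) (d , q) ≡ true) (sym (lk c ec)) (sym (lk d ed)) e′))
    where
    lk : ∀ c → S c ≡ true → V.lookup (τ V.[ b ]≔ g) c ≡ V.lookup τ c
    lk c ec = VP.lookup∘update′ (λ { refl → case (trans (sym ec) eb) }) τ g
      where
      case : true ≡ false → ⊥
      case ()

  bool-ext : ∀ {p q : Bool} → (p ≡ true → q ≡ true) → (q ≡ true → p ≡ true) → p ≡ q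
  bool-ext {true}  {true}  _ _ = refl
  bool-ext {true}  {false} f _ = sym (f refl)
  bool-ext {false} {true}  _ g = g refl
  bool-ext {false} {false} _ _ = refl

  update-invariant : ∀ S b → S b ≡ false → ∀ τ g → independent S (τ V.[ b ]≔ g) ≡ independent S τ
  update-invariant S b eb τ g = bool-ext (outside-update S b eb τ g)
    (λ e → outside-update S b eb (τ V.[ b ]≔ g) (V.lookup τ b)
      (subst (λ σ → independent S σ ≡ true) (sym (trans (VP.[]≔-idempotent τ b) (VP.[]≔-lookup τ b))) e))

  -- Contains the failures caused by one conflicting pair `(b , i)`, `(c , j)`, after relaxing
  -- independence on `S` to `S ⊖ c`. The two pinned coordinates are then irrelevant to independence,
  -- and for `b` outside `S` the event has exactly `N (S ⊖ c) / L²` members.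
  pinned : (Fin J → Bool) → Fin J → Fin L × (Fin J × Fin L) → Choice → Bool
  pinned S b (i , (c , j)) τ = (independent (S ⊖ c) τ ∧ does (V.lookup τ c F.≟ j)) ∧ does (V.lookup τ b F.≟ i)

  N-pinned : ∀ S b i c j → S b ≡ false → b ≢ c → L * (L * count (pinned S b (i , (c , j))) (vecs L J)) ≡ N (S ⊖ c)
  N-pinned S b i c j eb ne = trans (cong (L *_) (count-coordinate _ b i inv)) (count-coordinate (independent (S ⊖ c)) c j
    (update-invariant (S ⊖ c) c (⊖-self S c)))
    where
    inv : ∀ τ g → (independent (S ⊖ c) (τ V.[ b ]≔ g) ∧ does (V.lookup (τ V.[ b ]≔ g) c F.≟ j))
                ≡ (independent (S ⊖ c) τ ∧ does (V.lookup τ c F.≟ j))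
    inv τ g = cong₂ (λ p q → p ∧ does (q F.≟ j)) (update-invariant (S ⊖ c) b (cong (_∧ _) eb) τ g)
                (VP.lookup∘update′ (ne ∘ sym) τ g)

  threats : (Fin J → Bool) → Fin J → List (Fin L × (Fin J × Fin L))
  threats S b = concatMap (λ i → map (i ,_) (filterᵇ (λ { (c , j) → S c ∧ conflict (b , i) (c , j) }) (pairs J L))) (allFin L)

  threats-elim : ∀ S b {i c j} → (i , (c , j)) ∈ threats S b → S c ≡ true
  threats-elim S b m with find′ (allFin L) m
    where
    find′ : ∀ is {z} → z ∈ concatMap (λ i → map (i ,_) (filterᵇ (λ { (c , j) → S c ∧ conflict (b , i) (c , j) }) (pairs J L))) is →
            S (proj₁ (proj₂ z)) ≡ true
    find′ (i ∷ is) m with MP.∈-++⁻ (map (i ,_) (filterᵇ (λ { (c , j) → S c ∧ conflict (b , i) (c , j) }) (pairs J L))) m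
    ... | inj₂ m′ = find′ is m′
    ... | inj₁ m′ with MP.∈-map⁻ (i ,_) m′
    ...   | (c , j) , m″ , refl = proj₁ (∧-true {S c} (proj₂ (∈-filterᵇ⁻ (λ { (c , j) → S c ∧ conflict (b , i) (c , j) }) {pairs J L} m″)))
  ... | e = e

  length-threats : ∀ S b → length (threats S b) ≤ L * Δ
  length-threats S b = begin
    length (threats S b)
      ≡⟨ trans (length≡∑1 (threats S b)) (∑-concatMap _ (allFin L) _) ⟩
    ∑ (allFin L) (λ i → ∑ (map (i ,_) (F′ i)) (λ _ → 1))
      ≤⟨ ∑-≤const (allFin L) one ⟩
    length (allFin L) * Δ
      ≡⟨ cong (_* Δ) (length-allFin L) ⟩
    L * Δ ∎
    where
    open ≤-Reasoning
    F′ : Fin L → List (Fin J × Fin L)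
    F′ i = filterᵇ (λ { (c , j) → S c ∧ conflict (b , i) (c , j) }) (pairs J L)
    one : ∀ i → ∑ (map (i ,_) (F′ i)) (λ _ → 1) ≤ Δ
    one i = begin
      ∑ (map (i ,_) (F′ i)) (λ _ → 1)   ≡⟨ trans (∑-map (i ,_) (F′ i) _) (sym (length≡∑1 (F′ i))) ⟩
      length (F′ i)                     ≡⟨ length-filterᵇ _ (pairs J L) ⟩
      count _ (pairs J L)               ≤⟨ count-mono (pairs J L) (λ { (c , j) e → proj₂ (∧-true {S c} e) }) ⟩
      count (conflict (b , i)) (pairs J L) ≤⟨ degree (b , i) ⟩
      Δ ∎

  threatened : ∀ S b τ → S b ≡ false → independent S τ ≡ true → independent (S ⊕ b) τ ≡ false →
               ∃ λ z → z ∈ threats S b × pinned S b z τ ≡ true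
  threatened S b τ eb ind dep with all-false⇒∃ _ (pairs J J) dep
  ... | (c , d) , _ , k = build (clash-elim (S ⊕ b) τ (trans (sym (BP.not-involutive _)) (cong not k)))
    where
    witness : ∀ c → S c ≡ true → conflict (at τ b) (at τ c) ≡ true → ∃ λ z → z ∈ threats S b × pinned S b z τ ≡ true
    witness c ec e = (V.lookup τ b , (c , V.lookup τ c)) ,
      MP.∈-concatMap⁺ (λ i → map (i ,_) (filterᵇ (λ { (c , j) → S c ∧ conflict (b , i) (c , j) }) (pairs J L)))
        (lem (MP.∈-allFin (V.lookup τ b))) ,
      ∧-intro (∧-intro (antitone (⊖-⊆ S c) τ ind) (dec-true (V.lookup τ c F.≟ V.lookup τ c) refl)) (dec-true (V.lookup τ b F.≟ V.lookup τ b) refl)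
      where
      lem : ∀ {xs} → V.lookup τ b ∈ xs → Any (λ i → (V.lookup τ b , (c , V.lookup τ c)) ∈
              map (i ,_) (filterᵇ (λ { (c , j) → S c ∧ conflict (b , i) (c , j) }) (pairs J L))) xs
      lem m = Any.map (λ { refl → MP.∈-map⁺ (V.lookup τ b ,_) (∈-filterᵇ⁺ _ (∈-pairs c (V.lookup τ c)) (∧-intro ec e)) }) m
    build : (S ⊕ b) c ≡ true × (S ⊕ b) d ≡ true × c ≢ d × conflict (at τ c) (at τ d) ≡ true →
            ∃ λ z → z ∈ threats S b × pinned S b z τ ≡ true
    build (ec , ed , ne , e) with ⊕-true S b c ec | ⊕-true S b d ed
    ... | inj₁ sc   | inj₁ sd   = ⊥-elim (independent-elim S τ ind c d (clash-intro S τ sc sd ne e))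
    ... | inj₂ refl | inj₂ refl = ⊥-elim (ne refl)
    ... | inj₂ refl | inj₁ sd   = witness d sd e
    ... | inj₁ sc   | inj₂ refl = witness c sc (conflict-sym e)

  -- Induction on the size of `S` gives `N (S ⊖ c) ≤ 2 * N S`. Each of the at most `L * Δ` threats
  -- thus spoils at most `2 * N S / L²` choices, and `4 * Δ ≤ L` bounds the total by `N S / 2`.
  N-⊕ : ∀ k S → count S (allFin J) ≤ k → ∀ b → S b ≡ false → N S ≤ 2 * N (S ⊕ b)
  N-⊕ k S ≤k b eb = +-cancelʳ-≤ (N S) _ _ (begin
    N S + N S                       ≡⟨ lem₀ (N S) ⟩
    2 * N S                         ≤⟨ *-monoʳ-≤ 2 split ⟩
    2 * (N (S ⊕ b) + bad)           ≡⟨ *-distribˡ-+ 2 (N (S ⊕ b)) bad ⟩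
    2 * N (S ⊕ b) + 2 * bad         ≤⟨ +-monoʳ-≤ (2 * N (S ⊕ b)) 2bad≤ ⟩
    2 * N (S ⊕ b) + N S             ∎)
    where
    open ≤-Reasoning
    instance
      nzL : NonZero L
      nzL = >-nonZero L>0
    lem₀ : ∀ x → x + x ≡ 2 * x
    lem₀ = solve-∀
    bad : ℕ
    bad = count (λ τ → independent S τ ∧ not (independent (S ⊕ b) τ)) (vecs L J)
    split : N S ≤ N (S ⊕ b) + bad
    split = count-∨ (independent S) (independent (S ⊕ b)) (λ τ → independent S τ ∧ not (independent (S ⊕ b) τ)) (vecs L J) pt
      where
      pt : ∀ τ → independent S τ ≡ true → independent (S ⊕ b) τ ≡ true ⊎ (independent S τ ∧ not (independent (S ⊕ b) τ)) ≡ true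
      pt τ e with independent (S ⊕ b) τ
      ... | true  = inj₁ refl
      ... | false = inj₂ (∧-intro e refl)
    bad≤ : bad ≤ ∑ (threats S b) (λ z → count (pinned S b z) (vecs L J))
    bad≤ = count-⋃ _ (vecs L J) (threats S b) (pinned S b) λ τ e →
      let e₁ , e₂ = ∧-true {independent S τ} e in threatened S b τ eb e₁ (not-true e₂)
    smaller : ∀ c → S c ≡ true → N (S ⊖ c) ≤ 2 * N S
    smaller c ec = shrink k ≤k
      where
      shrink : ∀ k → count S (allFin J) ≤ k → N (S ⊖ c) ≤ 2 * N S
      shrink zero    h = ⊥-elim (<⇒≱ (⊖-count S c ec) (≤-trans h z≤n))
      shrink (suc k) h = ≤-trans (N-⊕ k (S ⊖ c) (s≤s⁻¹ (≤-trans (⊖-count S c ec) h)) c (⊖-self S c))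
        (*-monoʳ-≤ 2 (count-mono (vecs L J) (antitone (⊖⊕ S c))))
    each : ∀ {z} → z ∈ threats S b → L * L * count (pinned S b z) (vecs L J) ≤ 2 * N S
    each {i , (c , j)} m = let ec = threats-elim S b m in
      ≤-trans (≤-reflexive (trans (*-assoc L L _) (N-pinned S b i c j eb (λ { refl → case (trans (sym ec) eb) })))) (smaller c ec)
      where
      case : true ≡ false → ⊥
      case ()
    2bad≤ : 2 * bad ≤ N S
    2bad≤ = *-cancelˡ-≤ (L * L) {{m*n≢0 L L}} (begin
      L * L * (2 * bad)
        ≡⟨ lem₁ (L * L) bad ⟩
      2 * (L * L * bad)
        ≤⟨ *-monoʳ-≤ 2 (*-monoʳ-≤ (L * L) bad≤) ⟩
      2 * (L * L * ∑ (threats S b) (λ z → count (pinned S b z) (vecs L J)))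
        ≡⟨ cong (2 *_) (sym (∑-*ˡ (L * L) (threats S b) _)) ⟩
      2 * ∑ (threats S b) (λ z → L * L * count (pinned S b z) (vecs L J))
        ≤⟨ *-monoʳ-≤ 2 (∑-≤const-∈ (threats S b) each) ⟩
      2 * (length (threats S b) * (2 * N S))
        ≤⟨ *-monoʳ-≤ 2 (*-monoˡ-≤ (2 * N S) (length-threats S b)) ⟩
      2 * (L * Δ * (2 * N S))
        ≡⟨ lem₂ L Δ (N S) ⟩
      L * (4 * Δ) * N S
        ≤⟨ *-monoˡ-≤ (N S) (*-monoʳ-≤ L 4Δ≤L) ⟩
      L * L * N S ∎)
      where
      lem₁ : ∀ x y → x * (2 * y) ≡ 2 * (x * y)
      lem₁ = solve-∀
      lem₂ : ∀ L d x → 2 * (L * d * (2 * x)) ≡ L * (4 * d) * x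
      lem₂ = solve-∀

  N>0 : ∀ k S → count S (allFin J) ≤ k → 0 < N S
  N>0 k S ≤k with count S (allFin J) in eq
  ... | zero = ≤-trans (≤-trans (subst (0 <_) (sym (length-vecs L J)) (m^n>0 L {{>-nonZero L>0}} J)) (≤-reflexive (length≡∑1 (vecs L J))))
                (count-mono (vecs L J) λ τ _ → independent-intro S τ λ b c k →
                  <⇒≱ (≤-trans (s≤s z≤n) (≤-trans (⊖-count S b (proj₁ (clash-elim S τ k))) (≤-reflexive eq))) z≤n)
  N>0 zero S () | suc _
  N>0 (suc k) S (s≤s ≤k) | suc m with count>0⇒∃ S (allFin J) (subst (0 <_) (sym eq) (s≤s z≤n))
  ... | b , _ , eb = n≢0⇒n>0 λ N≡0 → <⇒≱ (N>0 k (S ⊖ b) small)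
        (≤-trans (N-⊕ k (S ⊖ b) small b (⊖-self S b)) (≤-trans (*-monoʳ-≤ 2 (count-mono (vecs L J) (antitone (⊖⊕ S b)))) (≤-reflexive (cong (2 *_) N≡0))))
    where
    small : count (S ⊖ b) (allFin J) ≤ k
    small = s≤s⁻¹ (≤-trans (⊖-count S b eb) (≤-trans (≤-reflexive eq) (s≤s ≤k)))

  transversal : ∃ λ (τ : Fin J → Fin L) → ∀ {b c} → b ≢ c → conflict (b , τ b) (c , τ c) ≡ true → ⊥
  transversal with count>0⇒∃ (independent (λ _ → true)) (vecs L J) (N>0 J (λ _ → true) (≤-trans (count-≤ _ (allFin J)) (≤-reflexive (length-allFin J))))
  ... | τ , _ , e = V.lookup τ , λ {b} {c} ne k → independent-elim (λ _ → true) τ e b c (clash-intro (λ _ → true) τ refl refl ne k)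

-- Path covers

module PathCover {n : ℕ} (adj : Fin n → Fin n → Bool) (adj-sym : ∀ i j → adj i j ≡ adj j i) where

  private
    Vx = Fin n

  data Path : Vx → Vx → List Vx → Set where
    [_]  : ∀ a → Path a a (a ∷ [])
    _∷_ : ∀ {a b c xs} → adj a b ≡ true → Path b c xs → Path a c (a ∷ xs)

  append : ∀ {a b c d xs ys} → Path a b xs → adj b c ≡ true → Path c d ys → Path a d (xs ++ ys)
  append [ a ]   e q = e ∷ q
  append (f ∷ p) e q = f ∷ append p e q

  flip-adj : ∀ {a b} → adj a b ≡ true → adj b a ≡ true
  flip-adj {a} {b} e = trans (adj-sym b a) e

  backward : ∀ {a b xs} → Path a b xs → ∃ λ ys → Path b a ys × ys ↭ xs
  backward [ a ]       = _ , [ a ] , ↭-refl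
  backward {a} (_∷_ {xs = xs} e p) = let ys , q , π = backward p in
    ys ++ a ∷ [] , append q (flip-adj e) [ a ] , ↭-trans (++-comm ys (a ∷ [])) (↭-prep a π)

  record Item : Set where
    constructor item
    field
      {hd ls} : Vx
      {vs}    : List Vx
      path    : Path hd ls vs
  open Item

  vertices : List Item → List Vx
  vertices = concatMap vs

  Apart : Item → Item → Set
  Apart p q = ∀ {u v} → u ≡ hd p ⊎ u ≡ ls p → v ≡ hd q ⊎ v ≡ ls q → adj u v ≡ false

  join : ∀ p q → Apart p q ⊎ ∃ λ r → vs r ↭ vs p ++ vs q
  join p q with adj (hd p) (hd q) in e₁ | adj (hd p) (ls q) in e₂ | adj (ls p) (hd q) in e₃ | adj (ls p) (ls q) in e₄
  ... | true | _ | _ | _ = let ys , p′ , π = backward (path p) in inj₂ (item (append p′ e₁ (path q)) , ++⁺ʳ (vs q) π)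
  ... | false | true | _ | _ = inj₂ (item (append (path q) (flip-adj e₂) (path p)) , ++-comm (vs q) (vs p))
  ... | false | false | true | _ = inj₂ (item (append (path p) e₃ (path q)) , ↭-refl)
  ... | false | false | false | true = let ys , q′ , π = backward (path q) in inj₂ (item (append (path p) e₄ q′) , ++⁺ˡ (vs p) π)
  ... | false | false | false | false = inj₁ λ
    { (inj₁ refl) (inj₁ refl) → e₁ ; (inj₁ refl) (inj₂ refl) → e₂ ; (inj₂ refl) (inj₁ refl) → e₃ ; (inj₂ refl) (inj₂ refl) → e₄ }

  Search : Item → List Item → Set₁
  Search p ps = All (Apart p) ps ⊎ ∃ λ r → ∃ λ rest → suc (length rest) ≡ length ps × AllPairs Apart rest
    × (∀ {P : Item → Set} → All P ps → All P rest) × (vs r ++ vertices rest ↭ vs p ++ vertices ps)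

  search : ∀ p ps → AllPairs Apart ps → Search p ps
  search p []       _ = inj₁ []
  search p (q ∷ ps) (a ∷ as) with join p q
  ... | inj₂ (r , π) = inj₂ (r , ps , refl , as , (λ { (_ ∷ x) → x }) ,
          ↭-trans (++⁺ʳ (vertices ps) π) (↭-reflexive (LP.++-assoc (vs p) (vs q) (vertices ps))))
  ... | inj₁ ap with search p ps as
  ...   | inj₁ aps = inj₁ (ap ∷ aps)
  ...   | inj₂ (r , rest , l , ar , sub , π) = inj₂ (r , q ∷ rest , cong suc l , sub a ∷ ar , (λ { (x ∷ xs) → x ∷ sub xs }) , (begin
            vs r ++ vs q ++ vertices rest      ↭⟨ swap-front (vs r) (vs q) (vertices rest) ⟩
            vs q ++ vs r ++ vertices rest      ↭⟨ ++⁺ˡ (vs q) π ⟩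
            vs q ++ vs p ++ vertices ps        ↭⟨ swap-front (vs q) (vs p) (vertices ps) ⟩
            vs p ++ vs q ++ vertices ps        ∎))
    where
    open PermutationReasoning
    swap-front : ∀ (xs ys zs : List Vx) → xs ++ ys ++ zs ↭ ys ++ xs ++ zs
    swap-front xs ys zs = ↭-trans (↭-reflexive (sym (LP.++-assoc xs ys zs)))
      (↭-trans (++⁺ʳ zs (++-comm xs ys)) (↭-reflexive (LP.++-assoc ys xs zs)))

  -- A merged path has new ends and must be compared with all the others again; every merge lowers
  -- the number of paths, which bounds the repetitions by `k`.
  insert : ∀ k p ps → length ps ≤ k → AllPairs Apart ps → ∃ λ ps′ → AllPairs Apart ps′ × vertices ps′ ↭ vs p ++ vertices ps
  insert k p ps l as with search p ps as
  ... | inj₁ aps = p ∷ ps , aps ∷ as , ↭-refl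
  insert zero    p []  l as | inj₂ (r , rest , () , _)
  insert (suc k) p ps  l as | inj₂ (r , rest , e , ar , sub , π) =
    let ps′ , as′ , π′ = insert k r rest (s≤s⁻¹ (≤-trans (≤-reflexive e) l)) ar in ps′ , as′ , ↭-trans π′ π

  cover : ∀ xs → ∃ λ ps → AllPairs Apart ps × vertices ps ↭ xs
  cover []       = [] , [] , ↭-refl
  cover (x ∷ xs) = let ps , as , π = cover xs
                       ps′ , as′ , π′ = insert (length ps) (item [ x ]) ps ≤-refl as
                   in ps′ , as′ , ↭-trans π′ (↭-prep x π)

  record Entry : Set where
    constructor entry
    field vertex front back : Vx
  open Entry

  Consecutive : Entry → Entry → Set
  Consecutive e f = (front e ≡ front f × back e ≡ back f × adj (vertex e) (vertex f) ≡ true)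
                  ⊎ (vertex e ≡ back e × vertex f ≡ front f)

  Arranged : List Entry → Set
  Arranged []           = ⊤
  Arranged (e ∷ [])     = vertex e ≡ back e
  Arranged (e ∷ f ∷ es) = Consecutive e f × Arranged (f ∷ es)

  StartsPath : List Entry → Set
  StartsPath []      = ⊤
  StartsPath (e ∷ _) = vertex e ≡ front e

  label : Vx → Vx → List Vx → List Entry
  label h l = map (λ v → entry v h l)

  arranged-path : ∀ {h l a xs} → Path a l xs → ∀ es → Arranged es → StartsPath es → Arranged (label h l xs ++ es)
  arranged-path [ a ]            []       _  _ = refl
  arranged-path [ a ]            (e ∷ es) ar s = inj₂ (refl , s) , ar
  arranged-path (f ∷ [ b ])      es ar s = inj₁ (refl , refl , f) , arranged-path [ b ] es ar s
  arranged-path (f ∷ p@(_ ∷ _))  es ar s = inj₁ (refl , refl , f) , arranged-path p es ar s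

  entries : List Item → List Entry
  entries = concatMap (λ p → label (hd p) (ls p) (vs p))

  starts : ∀ ps → StartsPath (entries ps)
  starts []             = tt
  starts (item [ a ] ∷ ps)   = refl
  starts (item (_ ∷ _) ∷ ps) = refl

  arranged : ∀ ps → Arranged (entries ps)
  arranged []       = tt
  arranged (p ∷ ps) = arranged-path (path p) (entries ps) (arranged ps) (starts ps)

  vertex-entries : ∀ ps → map vertex (entries ps) ≡ vertices ps
  vertex-entries []       = refl
  vertex-entries (p ∷ ps) = trans (LP.map-++ vertex (label (hd p) (ls p) (vs p)) (entries ps))
    (cong₂ _++_ (trans (sym (LP.map-∘ (vs p))) (LP.map-id (vs p))) (vertex-entries ps))

  ∈-entries : ∀ ps {e} → e ∈ entries ps → ∃ λ p → p ∈ ps × front e ≡ hd p × back e ≡ ls p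
  ∈-entries (p ∷ ps) m with MP.∈-++⁻ (label (hd p) (ls p) (vs p)) m
  ... | inj₂ m′ = let q , q∈ , r = ∈-entries ps m′ in q , there q∈ , r
  ... | inj₁ m′ with MP.∈-map⁻ _ m′
  ...   | v , _ , refl = p , here refl , refl , refl

  AllPairs-∈ : ∀ {ps} → AllPairs Apart ps → ∀ {p q} → p ∈ ps → q ∈ ps → p ≡ q ⊎ Apart p q ⊎ Apart q p
  AllPairs-∈ (a ∷ as) (here refl) (here refl) = inj₁ refl
  AllPairs-∈ (a ∷ as) (here refl) (there m)   = inj₂ (inj₁ (All.lookup a m))
  AllPairs-∈ (a ∷ as) (there m)   (here refl) = inj₂ (inj₂ (All.lookup a m))
  AllPairs-∈ (a ∷ as) (there m)   (there m′)  = AllPairs-∈ as m m′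

  IsEnd : Entry → Set
  IsEnd e = vertex e ≡ front e ⊎ vertex e ≡ back e

  ends-apart : ∀ {ps} → AllPairs Apart ps → ∀ {e f} → e ∈ entries ps → f ∈ entries ps → IsEnd e → IsEnd f →
               adj (vertex e) (vertex f) ≡ true → front e ≡ front f × back e ≡ back f
  ends-apart {ps} as {e} {f} e∈ f∈ ee ef a with ∈-entries ps e∈ | ∈-entries ps f∈
  ... | p , p∈ , eh , el | q , q∈ , fh , fl with AllPairs-∈ as p∈ q∈
  ...   | inj₁ refl = trans eh (sym fh) , trans el (sym fl)
  ...   | inj₂ (inj₁ ap) = ⊥-elim (absurd (trans (sym a) (ap (shift eh el ee) (shift fh fl ef))))
    where
    absurd : true ≡ false → ⊥
    absurd ()
    shift : ∀ {v a b a′ b′ : Vx} → a ≡ a′ → b ≡ b′ → v ≡ a ⊎ v ≡ b → v ≡ a′ ⊎ v ≡ b′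
    shift refl refl x = x
  ...   | inj₂ (inj₂ ap) = ⊥-elim (absurd (trans (sym (flip-adj a)) (ap (shift fh fl ef) (shift eh el ee))))
    where
    absurd : true ≡ false → ⊥
    absurd ()
    shift : ∀ {v a b a′ b′ : Vx} → a ≡ a′ → b ≡ b′ → v ≡ a ⊎ v ≡ b → v ≡ a′ ⊎ v ≡ b′
    shift refl refl x = x

  arranged-consecutive : ∀ es → Arranged es → ∀ i j → toℕ j ≡ suc (toℕ i) → Consecutive (L.lookup es i) (L.lookup es j)
  arranged-consecutive (e ∷ [])     ar       zero    (suc ())   _
  arranged-consecutive (e ∷ f ∷ es) (c , ar) zero    (suc zero) _ = c
  arranged-consecutive (e ∷ f ∷ es) (c , ar) (suc i) (suc j)    q = arranged-consecutive (f ∷ es) ar i j (suc-injective q)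

  arranged-last : ∀ es → Arranged es → ∀ i → suc (toℕ i) ≡ length es → vertex (L.lookup es i) ≡ back (L.lookup es i)
  arranged-last (e ∷ [])     ar       zero    _ = ar
  arranged-last (e ∷ f ∷ es) (_ , ar) (suc i) q = arranged-last (f ∷ es) ar i (suc-injective q)

  starts-first : ∀ es → StartsPath es → ∀ i → toℕ i ≡ 0 → vertex (L.lookup es i) ≡ front (L.lookup es i)
  starts-first (e ∷ es) s zero _ = s

  Unique-lookup : ∀ {es : List Entry} → Unique (map vertex es) → ∀ i j → vertex (L.lookup es i) ≡ vertex (L.lookup es j) → i ≡ j
  Unique-lookup {e ∷ es} (a ∷ u) zero    zero    _ = refl
  Unique-lookup {e ∷ es} (a ∷ u) zero    (suc j) q = ⊥-elim (All.lookup a (MP.∈-map⁺ vertex (MP.∈-lookup j)) q)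
  Unique-lookup {e ∷ es} (a ∷ u) (suc i) zero    q = ⊥-elim (All.lookup a (MP.∈-map⁺ vertex (MP.∈-lookup i)) (sym q))
  Unique-lookup {e ∷ es} (a ∷ u) (suc i) (suc j) q = cong suc (Unique-lookup u i j q)

-- A list of the vertices that runs through vertex-disjoint paths; front and
-- back record the ends of the path through the i-th vertex.
record PathOrdering {n : ℕ} (adj : Fin n → Fin n → Bool) : Set where
  field
    name front back : Fin n → Fin n
    name-injective  : ∀ i j → name i ≡ name j → i ≡ j
    position        : Fin n → Fin n
    name-position   : ∀ v → name (position v) ≡ v
    consecutive     : ∀ i j → toℕ j ≡ suc (toℕ i) →
      (front i ≡ front j × back i ≡ back j × adj (name i) (name j) ≡ true) ⊎ (name i ≡ back i × name j ≡ front j)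
    first           : ∀ i → toℕ i ≡ 0 → name i ≡ front i
    last            : ∀ i → suc (toℕ i) ≡ n → name i ≡ back i
    ends-apart      : ∀ i j → name i ≡ front i ⊎ name i ≡ back i → name j ≡ front j ⊎ name j ≡ back j →
      adj (name i) (name j) ≡ true → front i ≡ front j × back i ≡ back j

ordering : ∀ {n} (adj : Fin n → Fin n → Bool) → (∀ i j → adj i j ≡ adj j i) → PathOrdering adj
ordering {n} adj adj-sym with PathCover.cover adj adj-sym (allFin n)
... | ps , as , π = record
  { name           = λ i → vertex (at i)
  ; front          = λ i → front (at i)
  ; back           = λ i → back (at i)
  ; name-injective = λ i j e → FP.toℕ-injective (trans (sym (FP.toℕ-cast len i)) (trans (cong toℕ (Unique-lookup uniq (F.cast len i) (F.cast len j) e)) (FP.toℕ-cast len j)))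
  ; position       = λ v → F.cast (sym len) (Any.index (find v))
  ; name-position  = λ v → trans (cong (λ i → vertex (L.lookup es i)) (trans (FP.cast-trans (sym len) len (Any.index (find v))) (FP.cast-is-id refl (Any.index (find v)))))
                       (trans (cong vertex (sym (AnyP.lookup-index (find v)))) (sym (proj₂ (proj₂ (MP.∈-map⁻ vertex (find′ v))))))
  ; consecutive    = λ i j e → arranged-consecutive es (arranged ps) (F.cast len i) (F.cast len j)
                       (trans (FP.toℕ-cast len j) (trans e (cong suc (sym (FP.toℕ-cast len i)))))
  ; first          = λ i e → starts-first es (starts ps) (F.cast len i) (trans (FP.toℕ-cast len i) e)
  ; last           = λ i e → arranged-last es (arranged ps) (F.cast len i) (trans (cong suc (FP.toℕ-cast len i)) (trans e len))
  ; ends-apart     = λ i j → ends-apart as (MP.∈-lookup (F.cast len i)) (MP.∈-lookup (F.cast len j))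
  }
  where
  open PathCover adj adj-sym
  open Entry
  es : List Entry
  es = entries ps
  vs↭ : map vertex es ↭ allFin n
  vs↭ = ↭-trans (↭-reflexive (vertex-entries ps)) π
  len : n ≡ length es
  len = trans (sym (length-allFin n)) (trans (sym (↭-length vs↭)) (LP.length-map vertex es))
  uniq : Unique (map vertex es)
  uniq = SetoidPerm.Unique-resp-↭ (setoid (Fin n)) (↭⇒↭ₛ (↭-sym vs↭)) (UP.allFin⁺ n)
  find′ : ∀ v → v ∈ map vertex es
  find′ v = ∈-resp-↭ (↭-sym vs↭) (MP.∈-allFin v)
  find : ∀ v → proj₁ (MP.∈-map⁻ vertex (find′ v)) ∈ es
  find v = proj₁ (proj₂ (MP.∈-map⁻ vertex (find′ v)))
  at : Fin n → Entry
  at i = L.lookup es (F.cast len i)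

-- Splitting the edges of a subcubic graph

count-remove : ∀ {n} (p : Fin n → Bool) {a} → p a ≡ true →
               suc (count (λ i → p i ∧ not (does (i F.≟ a))) (allFin n)) ≤ count p (allFin n)
count-remove {n} p {a} pa = count-strict (allFin n) (λ i e → proj₁ (∧-true {p i} e)) (MP.∈-allFin a) lem pa
  where
  lem : (p a ∧ not (does (a F.≟ a))) ≡ false
  lem rewrite pa | dec-true (a F.≟ a) refl = refl

four : ∀ {n} (p : Fin n → Bool) {a b c d} → p a ≡ true → p b ≡ true → p c ≡ true → p d ≡ true →
       a ≢ b → a ≢ c → a ≢ d → b ≢ c → b ≢ d → c ≢ d → 4 ≤ count p (allFin n)
four {n} p {a} {b} {c} {d} pa pb pc pd ab ac ad bc bd cd = begin
  4               ≤⟨ s≤s (s≤s (s≤s (≤-trans (s≤s z≤n) (count-remove p₃ (keep p₂ {d} {c} (keep p₁ {d} {b} (keep p {d} {a} pd (ad ∘ sym)) (bd ∘ sym)) (cd ∘ sym)))))) ⟩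
  3 + count p₃ (allFin n)  ≤⟨ s≤s (s≤s (count-remove p₂ (keep p₁ {c} {b} (keep p {c} {a} pc (ac ∘ sym)) (bc ∘ sym)))) ⟩
  2 + count p₂ (allFin n)  ≤⟨ s≤s (count-remove p₁ (keep p {b} {a} pb (ab ∘ sym))) ⟩
  1 + count p₁ (allFin n)  ≤⟨ count-remove p pa ⟩
  count p (allFin n)       ∎
  where
  open ≤-Reasoning
  p₁ p₂ p₃ : Fin n → Bool
  p₁ i = p i ∧ not (does (i F.≟ a))
  p₂ i = p₁ i ∧ not (does (i F.≟ b))
  p₃ i = p₂ i ∧ not (does (i F.≟ c))
  keep : ∀ q {x y} → q x ≡ true → x ≢ y → (q x ∧ not (does (x F.≟ y))) ≡ true
  keep q {x} {y} e ne = ∧-intro e (not-intro (dec-false (x F.≟ y) ne))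

count-≤1 : ∀ {n} (p : Fin n → Bool) → (∀ i j → p i ≡ true → p j ≡ true → i ≡ j) → count p (allFin n) ≤ 1
count-≤1 {n} p h with count p (allFin n) in eq
... | zero  = z≤n
... | suc c with count>0⇒∃ p (allFin n) (subst (0 <_) (sym eq) (s≤s z≤n))
...   | x₀ , _ , e₀ = subst (_≤ 1) eq (count-⊆ p (x₀ ∷ []) λ i e → here (h i x₀ e e₀))

count-interval : ∀ {n} (p : Fin n → Bool) lo m → (∀ i → p i ≡ true → lo ≤ toℕ i × toℕ i < lo + m) → count p (allFin n) ≤ m
count-interval {n} p lo m h = begin
  count p (allFin n)
    ≤⟨ count-⋃ p (allFin n) (allFin m) (λ e i → does (toℕ i ≟ lo + toℕ e)) cover′ ⟩
  ∑ (allFin m) (λ e → count (λ i → does (toℕ i ≟ lo + toℕ e)) (allFin n))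
    ≤⟨ ∑-≤const (allFin m) (λ e → count-≤1 {n} (λ i → does (toℕ i ≟ lo + toℕ e)) λ i j ei ej → FP.toℕ-injective
         (trans (does-true (toℕ i ≟ lo + toℕ e) ei) (sym (does-true (toℕ j ≟ lo + toℕ e) ej)))) ⟩
  length (allFin m) * 1
    ≡⟨ trans (*-identityʳ _) (length-allFin m) ⟩
  m ∎
  where
  open ≤-Reasoning
  cover′ : ∀ i → p i ≡ true → ∃ λ e → e ∈ allFin m × does (toℕ i ≟ lo + toℕ e) ≡ true
  cover′ i e = let l , u = h i e
                   b : toℕ i ∸ lo < m
                   b = +-cancelˡ-< lo _ _ (subst (_< lo + m) (sym (m+[n∸m]≡n l)) u)
               in fromℕ< b , MP.∈-allFin _ , dec-true (toℕ i ≟ lo + toℕ (fromℕ< b))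
                    (sym (trans (cong (lo +_) (FP.toℕ-fromℕ< b)) (m+[n∸m]≡n l)))

count-pairs-⊆ : ∀ {m k n} (f : Fin m × Fin k → Fin n) → (∀ u v → f u ≡ f v → u ≡ v) →
  (p : Fin m × Fin k → Bool) (ys : List (Fin n)) → (∀ u → p u ≡ true → f u ∈ ys) → count p (pairs m k) ≤ length ys
count-pairs-⊆ {m} {k} f inj p ys h = begin
  count p (pairs m k)
    ≤⟨ count-⋃ p (pairs m k) ys (λ y u → does (f u F.≟ y)) (λ u e → f u , h u e , dec-true (f u F.≟ f u) refl) ⟩
  ∑ ys (λ y → count (λ u → does (f u F.≟ y)) (pairs m k))
    ≤⟨ ∑-≤const ys one ⟩
  length ys * 1
    ≡⟨ *-identityʳ _ ⟩
  length ys ∎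
  where
  open ≤-Reasoning
  single : ∀ i₀ j₀ → count (λ { (i , j) → does (i F.≟ i₀) ∧ does (j F.≟ j₀) }) (pairs m k) ≡ 1
  single i₀ j₀ = trans (∑-pairs m k _) (trans (∑-cong (allFin m) (λ i → row (does (i F.≟ i₀)))) (count-single i₀))
    where
    row : ∀ b → ∑ (allFin k) (λ j → ⟦ b ∧ does (j F.≟ j₀) ⟧) ≡ ⟦ b ⟧
    row true  = count-single j₀
    row false = ∑-0 (allFin k)
  one : ∀ y → count (λ u → does (f u F.≟ y)) (pairs m k) ≤ 1
  one y with count (λ u → does (f u F.≟ y)) (pairs m k) in eq
  ... | zero  = z≤n
  ... | suc c with count>0⇒∃ (λ u → does (f u F.≟ y)) (pairs m k) (subst (0 <_) (sym eq) (s≤s z≤n))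
  ...   | (i₀ , j₀) , _ , e₀ = subst (_≤ 1) eq (≤-trans (count-mono (pairs m k)
            (λ { (i , j) e → lem (inj (i , j) (i₀ , j₀) (trans (does-true (f (i , j) F.≟ y) e) (sym (does-true (f (i₀ , j₀) F.≟ y) e₀)))) }))
            (≤-reflexive (single i₀ j₀)))
    where
    lem : ∀ {i j} → (i , j) ≡ (i₀ , j₀) → (does (i F.≟ i₀) ∧ does (j F.≟ j₀)) ≡ true
    lem refl = ∧-intro (dec-true (i₀ F.≟ i₀) refl) (dec-true (j₀ F.≟ j₀) refl)

module Decomposition {n : ℕ} (adj : Fin n → Fin n → Bool) (adj-sym : ∀ i j → adj i j ≡ adj j i)
  (adj-irrefl : ∀ i → adj i i ≡ false) (degree≤3 : ∀ i → count (adj i) (allFin n) ≤ 3) (o : PathOrdering adj) where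

  open PathOrdering o

  E : Fin n → Fin n → Bool
  E i j = adj (name i) (name j)

  E-sym : ∀ {i j} → E i j ≡ true → E j i ≡ true
  E-sym {i} {j} e = trans (adj-sym (name j) (name i)) e

  E-irrefl : ∀ {i} → E i i ≡ true → ⊥
  E-irrefl {i} e with trans (sym e) (adj-irrefl (name i))
  ... | ()

  E-degree : ∀ i → count (E i) (allFin n) ≤ 3
  E-degree i = ≤-trans (count-inj name name-injective (E i) (adj (name i)) (λ _ e → e)) (degree≤3 (name i))

  nbrs : Fin n → List (Fin n)
  nbrs i = filterᵇ (E i) (allFin n)

  length-nbrs : ∀ i → length (nbrs i) ≤ 3
  length-nbrs i = ≤-trans (≤-reflexive (length-filterᵇ (E i) (allFin n))) (E-degree i)

  ∈-nbrs : ∀ {i j} → E i j ≡ true → j ∈ nbrs i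
  ∈-nbrs {i} {j} e = ∈-filterᵇ⁺ (E i) (MP.∈-allFin j) e

  End : Fin n → Set
  End i = name i ≡ front i ⊎ name i ≡ back i

  End? : ∀ i → Dec (End i)
  End? i = (name i F.≟ front i) ⊎-dec (name i F.≟ back i)

  -- Path edges (Step) and the remaining edges (A).
  Step : Fin n → Fin n → Set
  Step i j = toℕ j ≡ suc (toℕ i) × (front i ≡ front j × back i ≡ back j) × E i j ≡ true

  Step? : ∀ i j → Dec (Step i j)
  Step? i j = (toℕ j ≟ suc (toℕ i)) ×-dec (((front i F.≟ front j) ×-dec (back i F.≟ back j)) ×-dec (E i j B.≟ true))

  A : Fin n → Fin n → Set
  A i j = E i j ≡ true × ¬ Step i j × ¬ Step j i

  A? : ∀ i j → Dec (A i j)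
  A? i j = (E i j B.≟ true) ×-dec (¬? (Step? i j) ×-dec ¬? (Step? j i))

  A-sym : ∀ {i j} → A i j → A j i
  A-sym (e , s , t) = E-sym e , t , s

  A-irrefl : ∀ {i} → A i i → ⊥
  A-irrefl (e , _) = E-irrefl e

  Step-unique : ∀ {i j k} → Step i j → Step i k → j ≡ k
  Step-unique (e , _) (e′ , _) = FP.toℕ-injective (trans e (sym e′))

  previous : ∀ {j} → ¬ End j → ∃ λ i → Step i j
  previous {j} ¬e = go (toℕ j) refl
    where
    go : ∀ m → toℕ j ≡ m → ∃ λ i → Step i j
    go zero    e = ⊥-elim (¬e (inj₁ (first j e)))
    go (suc m) e = i , step (consecutive i j e′)
      where
      i : Fin n
      i = fromℕ< {m} (≤-trans (≤-reflexive (sym e)) (<⇒≤ (FP.toℕ<n j)))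
      e′ : toℕ j ≡ suc (toℕ i)
      e′ = trans e (cong suc (sym (FP.toℕ-fromℕ< _)))
      step : _ → Step i j
      step (inj₁ (f , b , a)) = e′ , (f , b) , a
      step (inj₂ (_ , f))     = ⊥-elim (¬e (inj₁ f))

  following : ∀ {i} → ¬ End i → ∃ λ j → Step i j
  following {i} ¬e with suc (toℕ i) <? n
  ... | no ¬p = ⊥-elim (¬e (inj₂ (last i (≤-antisym (FP.toℕ<n i) (≮⇒≥ ¬p)))))
  ... | yes p = j , step (consecutive i j e′)
    where
    j : Fin n
    j = fromℕ< p
    e′ : toℕ j ≡ suc (toℕ i)
    e′ = FP.toℕ-fromℕ< p
    step : _ → Step i j
    step (inj₁ (f , b , a)) = e′ , (f , b) , a
    step (inj₂ (b , _))     = ⊥-elim (¬e (inj₂ b))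

  -- Two of the at most three neighbours of an inner vertex lie on its path.
  A-unique : ∀ {i j k} → ¬ End i → A i j → A i k → j ≡ k
  A-unique {i} {j} {k} ¬e aj@(ej , sj , tj) ak@(ek , sk , tk) with j F.≟ k | previous ¬e | following ¬e
  ... | yes q | _ | _ = q
  ... | no ne | p , sp | q , sq = ⊥-elim (<⇒≱ (s≤s (E-degree i)) (four (E i) (E-sym (proj₂ (proj₂ sp))) (proj₂ (proj₂ sq)) ej ek
          (λ { refl → <⇒≱ (≤-reflexive (sym (proj₁ sp))) (≤-trans (n≤1+n _) (≤-reflexive (sym (proj₁ sq)))) })
          (λ { refl → tj sp }) (λ { refl → tk sp }) (λ { refl → sj sq }) (λ { refl → sk sq }) ne))

  -- With `true` the key consists of the names of the two ends of a path; with `false` it repeats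
  -- the position of an inner vertex, the lower one for an edge between two inner vertices. The flag
  -- keeps names and positions apart.
  Key : Set
  Key = Fin n × Fin n × Bool

  _≟ᵏ_ : (c d : Key) → Dec (c ≡ d)
  _≟ᵏ_ = ProdP.≡-dec F._≟_ (ProdP.≡-dec F._≟_ B._≟_)

  lower : Fin n → Fin n → Fin n
  lower i j with i F.≤? j
  ... | yes _ = i
  ... | no  _ = j

  lower-comm : ∀ i j → lower i j ≡ lower j i
  lower-comm i j with i F.≤? j | j F.≤? i
  ... | yes p | yes q = FP.≤-antisym p q
  ... | yes p | no ¬q = refl
  ... | no ¬p | yes q = refl
  ... | no ¬p | no ¬q = ⊥-elim (¬q (<⇒≤ (≰⇒> ¬p)))

  lower-either : ∀ i j → lower i j ≡ i ⊎ lower i j ≡ j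
  lower-either i j with i F.≤? j
  ... | yes _ = inj₁ refl
  ... | no  _ = inj₂ refl

  endKey : Fin n → Key
  endKey i = front i , back i , true

  innerKey : Fin n → Key
  innerKey i = i , i , false

  keyOf : ∀ i → Dec (End i) → Dec (∃ λ j → A i j) → Key
  keyOf i (yes _) _ = endKey i
  keyOf i (no _)  (no _) = innerKey i
  keyOf i (no _)  (yes (j , _)) with End? j
  ... | yes _ = endKey j
  ... | no  _ = innerKey (lower i j)

  -- The vertices with the same key contain a component of A: a pair of path
  -- ends with their neighbours, or an A-edge between inner vertices.
  α : Fin n → Key
  α i = keyOf i (End? i) (FP.any? (A? i))

  keyOf-end : ∀ {i} d a → End i → keyOf i d a ≡ endKey i
  keyOf-end (yes _) a e = refl
  keyOf-end (no ¬e) a e = ⊥-elim (¬e e)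

  keyOf-inner-end : ∀ {i j} d a → ¬ End i → A i j → End j → keyOf i d a ≡ endKey j
  keyOf-inner-end (yes e) a ¬e _ _ = ⊥-elim (¬e e)
  keyOf-inner-end {j = j} (no _) (no ¬a) ¬e a _ = ⊥-elim (¬a (j , a))
  keyOf-inner-end {i} {j} (no _) (yes (k , ak)) ¬e a ej with A-unique ¬e a ak
  ... | refl with End? j
  ...   | yes _ = refl
  ...   | no ¬ej = ⊥-elim (¬ej ej)

  keyOf-inner-inner : ∀ {i j} d a → ¬ End i → A i j → ¬ End j → keyOf i d a ≡ innerKey (lower i j)
  keyOf-inner-inner (yes e) a ¬e _ _ = ⊥-elim (¬e e)
  keyOf-inner-inner {j = j} (no _) (no ¬a) ¬e a _ = ⊥-elim (¬a (j , a))
  keyOf-inner-inner {i} {j} (no _) (yes (k , ak)) ¬e a ¬ej with A-unique ¬e a ak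
  ... | refl with End? j
  ...   | yes ej = ⊥-elim (¬ej ej)
  ...   | no _   = refl

  α-A : ∀ {i j} → A i j → α i ≡ α j
  α-A {i} {j} a = go (End? i) (End? j)
    where
    di = FP.any? (A? i)
    dj = FP.any? (A? j)
    go : Dec (End i) → Dec (End j) → α i ≡ α j
    go (yes ei) (yes ej) = trans (keyOf-end (End? i) di ei) (trans
      (let f , b = ends-apart i j ei ej (proj₁ a) in cong₂ (λ x y → x , y , true) f b) (sym (keyOf-end (End? j) dj ej)))
    go (yes ei) (no ¬ej) = trans (keyOf-end (End? i) di ei) (sym (keyOf-inner-end (End? j) dj ¬ej (A-sym a) ei))
    go (no ¬ei) (yes ej) = trans (keyOf-inner-end (End? i) di ¬ei a ej) (sym (keyOf-end (End? j) dj ej))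
    go (no ¬ei) (no ¬ej) = trans (keyOf-inner-inner (End? i) di ¬ei a ¬ej)
      (trans (cong innerKey (lower-comm i j)) (sym (keyOf-inner-inner (End? j) dj ¬ej (A-sym a) ¬ei)))

  around : Fin n → List (Fin n)
  around i = i ∷ nbrs i

  aroundName : Fin n → List (Fin n)
  aroundName v = around (position v)

  near : Key → List (Fin n)
  near (f , b , true)  = aroundName f ++ aroundName b
  near (m , _ , false) = around m

  -- Two path ends with at most three neighbours each give `2 * (1 + 3)`.
  length-near : ∀ c → length (near c) ≤ 8
  length-near (f , b , true)  = ≤-trans (≤-reflexive (LP.length-++ (aroundName f)))
    (+-mono-≤ (s≤s (length-nbrs (position f))) (s≤s (length-nbrs (position b))))
  length-near (m , _ , false) = ≤-trans (s≤s (length-nbrs m)) (m≤m+n 4 4)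

  position-name : ∀ i → position (name i) ≡ i
  position-name i = name-injective _ _ (name-position (name i))

  near-end : ∀ {i j} → End j → (i ≡ j ⊎ E j i ≡ true) → i ∈ near (endKey j)
  near-end {i} {j} e h = [ (λ f → MP.∈-++⁺ˡ (at f)) , (λ b → MP.∈-++⁺ʳ (aroundName (front j)) (at b)) ]′ e
    where
    in-around : ∀ {k} → k ≡ j → i ∈ around k
    in-around refl = [ here , (λ e → there (∈-nbrs e)) ]′ h
    at : ∀ {v} → name j ≡ v → i ∈ aroundName v
    at refl = in-around (position-name j)

  near-α : ∀ i → i ∈ near (α i)
  near-α i = go (End? i) (FP.any? (A? i))
    where
    go : ∀ d a → i ∈ near (keyOf i d a)
    go (yes e) a = near-end e (inj₁ refl)
    go (no _)  (no _) = here refl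
    go (no _)  (yes (j , a)) with End? j
    ... | yes e = near-end e (inj₂ (E-sym (proj₁ a)))
    ... | no  _ with lower-either i j
    ...   | inj₁ q = subst (λ m → i ∈ around m) (sym q) (here refl)
    ...   | inj₂ q = subst (λ m → i ∈ around m) (sym q) (there (∈-nbrs (E-sym (proj₁ a))))

  inClass : Key → Fin n → Bool
  inClass c i = does (α i ≟ᵏ c)

  class≤8 : ∀ c → count (inClass c) (allFin n) ≤ 8
  class≤8 c = ≤-trans (count-⊆ (inClass c) (near c) λ i e → subst (λ c → i ∈ near c) (does-true (α i ≟ᵏ c) e) (near-α i)) (length-near c)

  members : Key → List (Fin n)
  members c = filterᵇ (inClass c) (allFin n)

  length-members : ∀ c → length (members c) ≤ 8
  length-members c = ≤-trans (≤-reflexive (length-filterᵇ (inClass c) (allFin n))) (class≤8 c)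

  ∈-members : ∀ {i c} → α i ≡ c → i ∈ members c
  ∈-members {i} {c} e = ∈-filterᵇ⁺ (inClass c) (MP.∈-allFin i) (dec-true (α i ≟ᵏ c) e)

  nxt : Fin n → Fin n
  nxt i with suc (toℕ i) <? n
  ... | yes p = fromℕ< p
  ... | no  _ = i

  toℕ-nxt : ∀ {i} → suc (toℕ i) < n → toℕ (nxt i) ≡ suc (toℕ i)
  toℕ-nxt {i} h with suc (toℕ i) <? n
  ... | yes p = FP.toℕ-fromℕ< p
  ... | no ¬p = ⊥-elim (¬p h)

  nxt-Step : ∀ {i j} → Step i j → nxt i ≡ j
  nxt-Step {i} {j} (e , _) = FP.toℕ-injective (trans (toℕ-nxt (≤-trans (≤-reflexive (cong suc (sym e))) (FP.toℕ<n j))) (sym e))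

  prv : Fin n → Fin n
  prv i = fromℕ< {pred (toℕ i)} (≤-<-trans pred[n]≤n (FP.toℕ<n i))

  prv-nxt : ∀ {i} → suc (toℕ i) < n → prv (nxt i) ≡ i
  prv-nxt {i} h = FP.toℕ-injective (trans (FP.toℕ-fromℕ< _) (cong pred (toℕ-nxt h)))

  -- Such a path edge must not be cut: moved to the second class, it could close a cycle inside a
  -- component of `A`. A position that no path edge leaves is acceptable as a cut, because the path
  -- breaks there anyway.
  Monochromatic : Fin n → Set
  Monochromatic i = ∃ λ j → Step i j × α i ≡ α j

  Monochromatic? : ∀ i → Dec (Monochromatic i)
  Monochromatic? i = FP.any? λ j → Step? i j ×-dec (α i ≟ᵏ α j)

  -- At most 8 vertices share a key, so nine consecutive ones do not.
  module Chunk (p : ℕ) (fits : p + 8 < n) where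

    pos : Fin 9 → Fin n
    pos e = fromℕ< {p + toℕ e} (≤-<-trans (+-monoʳ-≤ p (s≤s⁻¹ (FP.toℕ<n e))) fits)

    toℕ-pos : ∀ e → toℕ (pos e) ≡ p + toℕ e
    toℕ-pos e = FP.toℕ-fromℕ< _

    pos-injective : ∀ e f → pos e ≡ pos f → e ≡ f
    pos-injective e f q = FP.toℕ-injective (+-cancelˡ-≡ p _ _ (trans (sym (toℕ-pos e)) (trans (cong toℕ q) (toℕ-pos f))))

    constant : (∀ (e : Fin 8) → Monochromatic (pos (F.inject₁ e))) → ∀ m (e : Fin 9) → toℕ e ≡ m → α (pos e) ≡ α (pos zero)
    constant h zero    zero    _ = refl
    constant h (suc m) (suc e) q with h e
    ... | j , (s , _) , eq = trans (cong α j≡) (trans (sym eq) (constant h m (F.inject₁ e) (trans (FP.toℕ-inject₁ e) (suc-injective q))))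
      where
      j≡ : pos (suc e) ≡ j
      j≡ = FP.toℕ-injective (trans (toℕ-pos (suc e)) (trans (+-suc p (toℕ e))
             (sym (trans s (cong suc (trans (toℕ-pos (F.inject₁ e)) (cong (p +_) (FP.toℕ-inject₁ e))))))))

    result : ∃ λ i → p ≤ toℕ i × toℕ i < p + 8 × ¬ Monochromatic i
    result with FP.any? (λ (e : Fin 8) → ¬? (Monochromatic? (pos (F.inject₁ e))))
    ... | yes (e , ok) = pos (F.inject₁ e) ,
          subst (p ≤_) (sym (toℕ-pos (F.inject₁ e))) (m≤m+n p _) ,
          subst (_< p + 8) (sym (trans (toℕ-pos (F.inject₁ e)) (cong (p +_) (FP.toℕ-inject₁ e)))) (+-monoʳ-< p (FP.toℕ<n e)) , ok
    ... | no none = ⊥-elim (<⇒≱ {8} ≤-refl (≤-trans (count-inj pos pos-injective (λ _ → true) (inClass (α (pos zero)))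
          (λ e _ → dec-true (α (pos e) ≟ᵏ α (pos zero)) (constant all-mono (toℕ e) e refl))) (class≤8 (α (pos zero)))))
      where
      all-mono : ∀ (e : Fin 8) → Monochromatic (pos (F.inject₁ e))
      all-mono e with Monochromatic? (pos (F.inject₁ e))
      ... | yes m = m
      ... | no ¬m = ⊥-elim (none (e , ¬m))

  Touch : Fin n → Fin n → Set
  Touch i k = (α i ≡ α k ⊎ α i ≡ α (nxt k)) ⊎ (α (nxt i) ≡ α k ⊎ α (nxt i) ≡ α (nxt k))

  Touch? : ∀ i k → Dec (Touch i k)
  Touch? i k = ((α i ≟ᵏ α k) ⊎-dec (α i ≟ᵏ α (nxt k))) ⊎-dec ((α (nxt i) ≟ᵏ α k) ⊎-dec (α (nxt i) ≟ᵏ α (nxt k)))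

  Touch-sym : ∀ {i k} → Touch i k → Touch k i
  Touch-sym (inj₁ (inj₁ e)) = inj₁ (inj₁ (sym e))
  Touch-sym (inj₁ (inj₂ e)) = inj₂ (inj₁ (sym e))
  Touch-sym (inj₂ (inj₁ e)) = inj₁ (inj₂ (sym e))
  Touch-sym (inj₂ (inj₂ e)) = inj₂ (inj₂ (sym e))

  module Conflicts (J W : ℕ) (wide : 4 * 32 ≤ W) (W>0 : 0 < W) (candidate : Fin J × Fin W → Fin n)
    (candidate-injective : ∀ u v → candidate u ≡ candidate v → u ≡ v)
    (candidate-next : ∀ u → suc (toℕ (candidate u)) < n) where

    conflict : Fin J × Fin W → Fin J × Fin W → Bool
    conflict u v = does (Touch? (candidate u) (candidate v))

    -- A candidate edge has two keys with at most 8 vertices each, and each of these can be the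
    -- start or the end of a conflicting candidate: `2 * 8 * 2 = 32`.
    nearby : Fin n → List (Fin n)
    nearby i = (members (α i) ++ map prv (members (α i))) ++ (members (α (nxt i)) ++ map prv (members (α (nxt i))))

    length-nearby : ∀ i → length (nearby i) ≤ 32
    length-nearby i = ≤-trans (≤-reflexive (LP.length-++ (members (α i) ++ map prv (members (α i))))) (+-mono-≤ (half (α i)) (half (α (nxt i))))
      where
      half : ∀ c → length (members c ++ map prv (members c)) ≤ 16
      half c = ≤-trans (≤-reflexive (trans (LP.length-++ (members c)) (cong (length (members c) +_) (LP.length-map prv (members c)))))
                       (+-mono-≤ (length-members c) (length-members c))

    touch-nearby : ∀ u v → Touch (candidate u) (candidate v) → candidate v ∈ nearby (candidate u)
    touch-nearby u v = [ [ here₁ , here₂ ]′ , [ here₃ , here₄ ]′ ]′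
      where
      i = candidate u
      k = candidate v
      direct : ∀ {c} → c ≡ α k → k ∈ members c ++ map prv (members c)
      direct e = MP.∈-++⁺ˡ (∈-members (sym e))
      shifted : ∀ {c} → c ≡ α (nxt k) → k ∈ members c ++ map prv (members c)
      shifted {c} e = MP.∈-++⁺ʳ (members c) (subst (_∈ map prv (members c)) (prv-nxt (candidate-next v)) (MP.∈-map⁺ prv (∈-members (sym e))))
      here₁ : α i ≡ α k → k ∈ nearby i
      here₁ = λ e → MP.∈-++⁺ˡ (direct {α i} e)
      here₂ : α i ≡ α (nxt k) → k ∈ nearby i
      here₂ = λ e → MP.∈-++⁺ˡ (shifted {α i} e)
      here₃ : α (nxt i) ≡ α k → k ∈ nearby i
      here₃ = λ e → MP.∈-++⁺ʳ (members (α i) ++ map prv (members (α i))) (direct {α (nxt i)} e)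
      here₄ : α (nxt i) ≡ α (nxt k) → k ∈ nearby i
      here₄ = λ e → MP.∈-++⁺ʳ (members (α i) ++ map prv (members (α i))) (shifted {α (nxt i)} e)

    conflict-sym : ∀ {u v} → conflict u v ≡ true → conflict v u ≡ true
    conflict-sym {u} {v} e = dec-true (Touch? (candidate v) (candidate u)) (Touch-sym (does-true (Touch? (candidate u) (candidate v)) e))

    conflict-degree : ∀ u → count (conflict u) (pairs J W) ≤ 32
    conflict-degree u = ≤-trans (count-pairs-⊆ candidate candidate-injective (conflict u) (nearby (candidate u))
      (λ v e → touch-nearby u v (does-true (Touch? (candidate u) (candidate v)) e))) (length-nearby (candidate u))

    separate : ∃ λ (τ : Fin J → Fin W) → ∀ {b c} → b ≢ c → ¬ Touch (candidate (b , τ b)) (candidate (c , τ c))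
    separate = go (Transversal.transversal J W 32 conflict (λ {u} {v} → conflict-sym {u} {v}) conflict-degree wide W>0)
      where
      go : (∃ λ (τ : Fin J → Fin W) → ∀ {b c} → b ≢ c → conflict (b , τ b) (c , τ c) ≡ true → ⊥) →
           ∃ λ (τ : Fin J → Fin W) → ∀ {b c} → b ≢ c → ¬ Touch (candidate (b , τ b)) (candidate (c , τ c))
      go (τ , h) = τ , λ {b} {c} ne t → h ne (dec-true (Touch? (candidate (b , τ b)) (candidate (c , τ c))) t)

  -- There is one cut in each block of `D` positions except the last block, which may be incomplete.
  module Cut (J D : ℕ) (cut : Fin J → Fin n)
    (cut-≥ : ∀ b → toℕ b * D ≤ toℕ (cut b)) (cut-< : ∀ b → toℕ (cut b) < suc (toℕ b) * D) (n≤ : n ≤ suc J * D) (16≤D : 16 ≤ D)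
    (cut-ok : ∀ b → ¬ Monochromatic (cut b)) (cut-free : ∀ {b c} → b ≢ c → ¬ Touch (cut b) (cut c)) where

    IsCut : Fin n → Set
    IsCut i = ∃ λ b → cut b ≡ i

    IsCut? : ∀ i → Dec (IsCut i)
    IsCut? i = FP.any? λ b → cut b F.≟ i

    CutEdge : Fin n → Fin n → Set
    CutEdge i j = Step i j × IsCut i

    cut-apart : ∀ {i j} → CutEdge i j → α i ≢ α j
    cut-apart {i} {j} (s , b , refl) e = cut-ok b (j , s , e)

    -- This is what the independent transversal is for: a key occurs at the ends of at most one cut
    -- edge, so cut edges join key classes in pairs only.
    cut-unique : ∀ {i j k l} → CutEdge i j → CutEdge k l → (α i ≡ α k ⊎ α i ≡ α l) ⊎ (α j ≡ α k ⊎ α j ≡ α l) → i ≡ k × j ≡ l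
    cut-unique {i} {j} {k} {l} (s , b , refl) (s′ , c , refl) t with b F.≟ c
    ... | yes refl = refl , Step-unique s s′
    ... | no ne = ⊥-elim (cut-free ne (subst₂ (λ x y → (α i ≡ α k ⊎ α i ≡ α x) ⊎ (α y ≡ α k ⊎ α y ≡ α x)) (sym (nxt-Step s′)) (sym (nxt-Step s)) t))

    inU? : (e : Fin n × Fin n) → Dec (Step (proj₁ e) (proj₂ e) × ¬ IsCut (proj₁ e))
    inU? (i , j) = Step? i j ×-dec ¬? (IsCut? i)

    -- Each `A`-edge is listed in one orientation only; a reversed copy would keep its ends
    -- connected and spoil the bridge condition of `IsForest`.
    inT? : (e : Fin n × Fin n) → Dec ((toℕ (proj₁ e) < toℕ (proj₂ e) × A (proj₁ e) (proj₂ e)) ⊎ CutEdge (proj₁ e) (proj₂ e))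
    inT? (i , j) = ((toℕ i <? toℕ j) ×-dec A? i j) ⊎-dec (Step? i j ×-dec IsCut? i)

    U T : List (Fin n × Fin n)
    U = filterᵇ (λ e → does (inU? e)) (pairs n n)
    T = filterᵇ (λ e → does (inT? e)) (pairs n n)

    U-elim : ∀ {i j} → (i , j) ∈ U → Step i j × ¬ IsCut i
    U-elim {i} {j} m = does-true (inU? (i , j)) (proj₂ (∈-filterᵇ⁻ (λ e → does (inU? e)) {pairs n n} m))

    T-elim : ∀ {i j} → (i , j) ∈ T → (toℕ i < toℕ j × A i j) ⊎ CutEdge i j
    T-elim {i} {j} m = does-true (inT? (i , j)) (proj₂ (∈-filterᵇ⁻ (λ e → does (inT? e)) {pairs n n} m))

    covered : ∀ {i j} → toℕ i < toℕ j → E i j ≡ true → (i , j) ∈ U ⊎ (i , j) ∈ T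
    covered {i} {j} l e = go (Step? i j) (IsCut? i)
      where
      inT : _ → (i , j) ∈ T
      inT x = ∈-filterᵇ⁺ (λ e → does (inT? e)) (∈-pairs i j) (dec-true (inT? (i , j)) x)
      go : Dec (Step i j) → Dec (IsCut i) → (i , j) ∈ U ⊎ (i , j) ∈ T
      go (yes s) (yes c) = inj₂ (inT (inj₂ (s , c)))
      go (yes s) (no ¬c) = inj₁ (∈-filterᵇ⁺ (λ e → does (inU? e)) (∈-pairs i j) (dec-true (inU? (i , j)) (s , ¬c)))
      go (no ¬s) _       = inj₂ (inT (inj₁ (l , e , ¬s , λ s → <⇒≱ l (≤-trans (n≤1+n _) (≤-reflexive (sym (proj₁ s)))))))

    -- Edges lead from a position to the next one, so only the edge at `a` crosses from the
    -- positions up to `a` to the later ones.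
    forestU : IsForest U
    forestU {a} {b} m = (λ w → toℕ w ≤ toℕ a) , ≤-refl ,
      (λ h → <⇒≱ (≤-reflexive (sym (proj₁ (proj₁ (U-elim m))))) h) , closed
      where
      closed : ∀ {c d} → (c , d) ∈ U → (c , d) ≢ (a , b) → (toℕ c ≤ toℕ a → toℕ d ≤ toℕ a) × (toℕ d ≤ toℕ a → toℕ c ≤ toℕ a)
      closed {c} {d} m′ ne = (λ h → ≤-trans (≤-reflexive (proj₁ s)) (≤∧≢⇒< h (λ e → ne (same (FP.toℕ-injective e))))) ,
                             (λ h → ≤-trans (n≤1+n _) (≤-trans (≤-reflexive (sym (proj₁ s))) h))
        where
        s = proj₁ (U-elim m′)
        same : c ≡ a → (c , d) ≡ (a , b)
        same refl = cong (c ,_) (Step-unique s (proj₁ (U-elim m)))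

    -- Removing a cut edge separates the keys at its ends; removing an A-edge
    -- ab separates b, its other A-neighbours, and what is attached to them by
    -- a cut edge.
    module Side (a b : Fin n) (ab : A a b) (leafy : ∀ {w} → A b w → w ≢ a → ¬ End w) where

      S : Fin n → Set
      S w = w ≡ b ⊎ (A b w × w ≢ a)

      P : Fin n → Set
      P w = S w ⊎ ∃ λ c → ∃ λ d → CutEdge c d × ((S c × α w ≡ α d) ⊎ (S d × α w ≡ α c))

      α-S : ∀ {w} → S w → α w ≡ α b
      α-S (inj₁ refl)    = refl
      α-S (inj₂ (x , _)) = sym (α-A x)

      P-b : P b
      P-b = inj₁ (inj₁ refl)

      ¬P-a : ¬ P a
      ¬P-a (inj₁ (inj₁ refl))       = A-irrefl ab
      ¬P-a (inj₁ (inj₂ (_ , ne)))   = ne refl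
      ¬P-a (inj₂ (c , d , x , inj₁ (sc , e))) = cut-apart x (trans (α-S sc) (trans (sym (α-A ab)) e))
      ¬P-a (inj₂ (c , d , x , inj₂ (sd , e))) = cut-apart x (sym (trans (α-S sd) (trans (sym (α-A ab)) e)))

      S-A : ∀ {u v} → A u v → ¬ (u ≡ b × v ≡ a) → S u → S v
      S-A uv ne (inj₁ refl) = inj₂ (uv , λ { refl → ne (refl , refl) })
      S-A uv ne (inj₂ (bu , u≢a)) = inj₁ (A-unique (leafy bu u≢a) uv (A-sym bu))

      P-A : ∀ {u v} → A u v → ¬ (u ≡ b × v ≡ a) → P u → P v
      P-A uv ne (inj₁ s) = inj₁ (S-A uv ne s)
      P-A uv ne (inj₂ (c , d , x , inj₁ (s , e))) = inj₂ (c , d , x , inj₁ (s , trans (sym (α-A uv)) e))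
      P-A uv ne (inj₂ (c , d , x , inj₂ (s , e))) = inj₂ (c , d , x , inj₂ (s , trans (sym (α-A uv)) e))

      P-cut : ∀ {u v} → CutEdge u v → (P u → P v) × (P v → P u)
      P-cut {u} {v} y = forth , back′
        where
        forth : P u → P v
        forth (inj₁ s) = inj₂ (u , v , y , inj₁ (s , refl))
        forth (inj₂ (c , d , x , inj₁ (s , e))) with cut-unique y x (inj₁ (inj₂ e))
        ... | refl , refl = ⊥-elim (cut-apart y e)
        forth (inj₂ (c , d , x , inj₂ (s , e))) with cut-unique y x (inj₁ (inj₁ e))
        ... | refl , refl = inj₁ s
        back′ : P v → P u
        back′ (inj₁ s) = inj₂ (u , v , y , inj₂ (s , refl))
        back′ (inj₂ (c , d , x , inj₁ (s , e))) with cut-unique y x (inj₂ (inj₂ e))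
        ... | refl , refl = inj₁ s
        back′ (inj₂ (c , d , x , inj₂ (s , e))) with cut-unique y x (inj₂ (inj₁ e))
        ... | refl , refl = ⊥-elim (cut-apart y (sym e))

    -- By `ends-apart` adjacent path ends belong to the same path. Thus `a`, `b` and a further end
    -- `w` next to `b` would be three ends of one path.
    ends-leafy : ∀ {a b} → A a b → End a → End b → ∀ {w} → A b w → w ≢ a → ¬ End w
    ends-leafy {a} {b} ab ea eb {w} bw w≢a ew = bad ea eb ew
      where
      same-a : front a ≡ front b × back a ≡ back b
      same-a = ends-apart a b ea eb (proj₁ ab)
      same-w : front w ≡ front b × back w ≡ back b
      same-w = ends-apart w b ew eb (E-sym (proj₁ bw))
      eq : ∀ {i j x y} → name i ≡ x → x ≡ y → name j ≡ y → i ≡ j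
      eq p q r = name-injective _ _ (trans p (trans q (sym r)))
      fa = proj₁ same-a
      ba = proj₂ same-a
      fw = proj₁ same-w
      bw′ = proj₂ same-w
      a≢b : a ≢ b
      a≢b refl = A-irrefl ab
      w≢b : w ≢ b
      w≢b refl = A-irrefl bw
      bad : End a → End b → End w → ⊥
      bad (inj₁ p) (inj₁ q) _        = a≢b (eq p fa q)
      bad (inj₂ p) (inj₂ q) _        = a≢b (eq p ba q)
      bad (inj₁ p) (inj₂ q) (inj₁ r) = w≢a (eq r (trans fw (sym fa)) p)
      bad (inj₁ p) (inj₂ q) (inj₂ r) = w≢b (eq r bw′ q)
      bad (inj₂ p) (inj₁ q) (inj₁ r) = w≢b (eq r fw q)
      bad (inj₂ p) (inj₁ q) (inj₂ r) = w≢a (eq r (trans bw′ (sym ba)) p)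

    forestT : IsForest T
    forestT {a} {b} m = go (T-elim m)
      where
      Separator : Set₁
      Separator = ∃ λ (P : Fin n → Set) → P a × ¬ P b ×
        (∀ {c d} → (c , d) ∈ T → (c , d) ≢ (a , b) → (P c → P d) × (P d → P c))
      from-a : toℕ a < toℕ b → (ab : A a b) → (∀ {w} → A a w → w ≢ b → ¬ End w) → Separator
      from-a l ab leafy = P , P-b , ¬P-a , closed
        where
        open Side b a (A-sym ab) leafy
        closed : ∀ {c d} → (c , d) ∈ T → (c , d) ≢ (a , b) → (P c → P d) × (P d → P c)
        closed {c} {d} m′ ne with T-elim m′
        ... | inj₂ y = P-cut y
        ... | inj₁ (l′ , cd) = P-A cd (λ { (refl , refl) → ne refl }) , P-A (A-sym cd) (λ { (refl , refl) → <⇒≱ l (<⇒≤ l′) })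
      from-b : toℕ a < toℕ b → (ab : A a b) → (∀ {w} → A b w → w ≢ a → ¬ End w) → Separator
      -- The leafy side lies at `b`, whereas a separator has to contain `a`; hence the complement.
      from-b l ab leafy = (λ w → ¬ P w) , ¬P-a , (λ h → h P-b) , closed
        where
        open Side a b ab leafy
        closed : ∀ {c d} → (c , d) ∈ T → (c , d) ≢ (a , b) → (¬ P c → ¬ P d) × (¬ P d → ¬ P c)
        closed {c} {d} m′ ne with T-elim m′
        ... | inj₂ y = (λ h p → h (proj₂ (P-cut y) p)) , (λ h p → h (proj₁ (P-cut y) p))
        ... | inj₁ (l′ , cd) = (λ h p → h (P-A (A-sym cd) (λ { (refl , refl) → ne refl }) p)) ,
                               (λ h p → h (P-A cd (λ { (refl , refl) → <⇒≱ l (<⇒≤ l′) }) p))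
      only : ∀ {x y} → ¬ End x → A x y → ∀ {w} → A x w → w ≢ y → ¬ End w
      only ¬e a₁ a₂ ne _ = ne (A-unique ¬e a₂ a₁)
      go : (toℕ a < toℕ b × A a b) ⊎ CutEdge a b → Separator
      go (inj₂ x) = (λ w → α w ≡ α a) , refl , (λ e → cut-apart x (sym e)) , closed
        where
        closed : ∀ {c d} → (c , d) ∈ T → (c , d) ≢ (a , b) → (α c ≡ α a → α d ≡ α a) × (α d ≡ α a → α c ≡ α a)
        closed {c} {d} m′ ne with T-elim m′
        ... | inj₁ (_ , cd) = (λ e → trans (sym (α-A cd)) e) , (λ e → trans (α-A cd) e)
        ... | inj₂ y = (λ e → ⊥-elim (differ (inj₁ (inj₁ e)))) , (λ e → ⊥-elim (differ (inj₂ (inj₁ e))))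
          where
          differ : _ → ⊥
          differ t = let p , q = cut-unique y x t in ne (cong₂ _,_ p q)
      -- An inner vertex has only one `A`-edge, so the side at an inner end is leafy for lack of
      -- other neighbours. Two path ends require `ends-leafy`.
      go (inj₁ (l , ab)) with End? a | End? b
      ... | no ¬ea | _      = from-a l ab (only ¬ea ab)
      ... | yes _  | no ¬eb = from-b l ab (only ¬eb (A-sym ab))
      ... | yes ea | yes eb = from-b l ab (ends-leafy ab ea eb)

    -- A component of the first class never passes a cut. From block `k` it is confined by the cuts
    -- in blocks `k − 1` and `k + 1`; the cut in block `k` itself is ignored because `u` may lie on
    -- either side of it. Three blocks remain.
    module Window (u k : ℕ) (u≥ : k * D ≤ u) (u< : u < suc k * D) where

      P : Fin n → Set
      P w = ∀ b → (toℕ b < k → toℕ (cut b) < toℕ w) × (k < toℕ b → toℕ w ≤ toℕ (cut b))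

      closed : Closed U P
      closed {c} {d} m = (λ h b → (λ l → ≤-trans (proj₁ (h b) l) (≤-trans (n≤1+n _) (≤-reflexive (sym (proj₁ s))))) ,
                            (λ l → ≤-trans (≤-reflexive (proj₁ s)) (≤∧≢⇒< (proj₂ (h b) l) (λ e → notcut b (sym e))))) ,
                         (λ h b → (λ l → ≤∧≢⇒< (s≤s⁻¹ (≤-trans (proj₁ (h b) l) (≤-reflexive (proj₁ s)))) (notcut b)) ,
                            (λ l → ≤-trans (n≤1+n _) (≤-trans (≤-reflexive (sym (proj₁ s))) (proj₂ (h b) l))))
        where
        s = proj₁ (U-elim m)
        notcut : ∀ b → toℕ (cut b) ≢ toℕ c
        notcut b e = proj₂ (U-elim m) (b , FP.toℕ-injective e)

      P-u : ∀ {w} → toℕ w ≡ u → P w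
      P-u refl b = (λ l → ≤-trans (cut-< b) (≤-trans (*-monoˡ-≤ D l) u≥)) ,
                   (λ l → ≤-trans (<⇒≤ u<) (≤-trans (*-monoˡ-≤ D l) (cut-≥ b)))

      lower-bound : u < n → ∀ {w} → P w → (k ∸ 1) * D ≤ toℕ w
      lower-bound u<n {w} h = go k refl
        where
        go : ∀ m → k ≡ m → (m ∸ 1) * D ≤ toℕ w
        go zero    _ = z≤n
        go (suc m) e = ≤-trans (≤-trans (≤-reflexive (cong (_* D) (sym tb))) (cut-≥ b)) (<⇒≤ (proj₁ (h b) (≤-reflexive (trans (cong suc tb) (sym e)))))
          where
          m<J : m < J
          m<J = s≤s⁻¹ (*-cancelʳ-< D (suc m) (suc J) (≤-<-trans (≤-trans (≤-reflexive (cong (_* D) (sym e))) u≥) (<-≤-trans u<n n≤)))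
          b : Fin J
          b = fromℕ< m<J
          tb : toℕ b ≡ m
          tb = FP.toℕ-fromℕ< m<J

      upper-bound : ∀ {w} → P w → toℕ w < (2 + k) * D
      upper-bound {w} h with suc k <? J
      ... | yes l = ≤-<-trans (proj₂ (h b) (≤-reflexive (sym tb))) (subst (λ m → toℕ (cut b) < suc m * D) tb (cut-< b))
        where
        b : Fin J
        b = fromℕ< l
        tb : toℕ b ≡ suc k
        tb = FP.toℕ-fromℕ< l
      -- No cut follows block `k`, but then at most one block follows it either.
      ... | no ¬l = <-≤-trans (FP.toℕ<n w) (≤-trans n≤ (*-monoˡ-≤ D (s≤s (≮⇒≥ ¬l))))

    block : ∀ m → ∃ λ k → k * D ≤ m × m < suc k * D
    block zero    = 0 , z≤n , ≤-trans (s≤s z≤n) (≤-trans 16≤D (≤-reflexive (sym (+-identityʳ D))))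
    block (suc m) with block m
    ... | k , l , h with suc m <? suc k * D
    ...   | yes h′ = k , ≤-trans l (n≤1+n m) , h′
    ...   | no ¬h  = suc k , ≮⇒≥ ¬h , ≤-<-trans h (+-monoˡ-< (suc k * D) (≤-trans (s≤s z≤n) 16≤D))

    -- The vertices with key `c` together with those whose key lies across the cut edge at `c`. By
    -- `cut-unique` these are at most two key classes, hence at most 16 vertices, and no edge of `T`
    -- leaves them.
    Partner : Key → Fin n → Set
    Partner c w = α w ≡ c ⊎ ∃ λ i → ∃ λ j → CutEdge i j × ((α i ≡ c × α w ≡ α j) ⊎ (α j ≡ c × α w ≡ α i))

    Partner-closed : ∀ c → Closed T (Partner c)
    Partner-closed c {s} {t} m with T-elim m
    ... | inj₁ (_ , st) = shift (α-A st) , shift (sym (α-A st))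
      where
      shift : ∀ {u v} → α u ≡ α v → Partner c u → Partner c v
      shift e (inj₁ q) = inj₁ (trans (sym e) q)
      shift e (inj₂ (i , j , x , inj₁ (q , r))) = inj₂ (i , j , x , inj₁ (q , trans (sym e) r))
      shift e (inj₂ (i , j , x , inj₂ (q , r))) = inj₂ (i , j , x , inj₂ (q , trans (sym e) r))
    ... | inj₂ y = forth , back′
      where
      forth : Partner c s → Partner c t
      forth (inj₁ q) = inj₂ (s , t , y , inj₁ (q , refl))
      forth (inj₂ (i , j , x , inj₁ (q , r))) with cut-unique y x (inj₁ (inj₂ r))
      ... | refl , refl = ⊥-elim (cut-apart y r)
      forth (inj₂ (i , j , x , inj₂ (q , r))) with cut-unique y x (inj₁ (inj₁ r))
      ... | refl , refl = inj₁ q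
      back′ : Partner c t → Partner c s
      back′ (inj₁ q) = inj₂ (s , t , y , inj₂ (q , refl))
      back′ (inj₂ (i , j , x , inj₁ (q , r))) with cut-unique y x (inj₂ (inj₂ r))
      ... | refl , refl = inj₁ q
      back′ (inj₂ (i , j , x , inj₂ (q , r))) with cut-unique y x (inj₂ (inj₁ r))
      ... | refl , refl = ⊥-elim (cut-apart y (sym r))

    Partner-unique : ∀ c {v w} → Partner c v → Partner c w → α v ≢ c → α w ≢ c → α v ≡ α w
    Partner-unique c (inj₁ e) _ nv _ = ⊥-elim (nv e)
    Partner-unique c (inj₂ _) (inj₁ e) _ nw = ⊥-elim (nw e)
    Partner-unique c (inj₂ (i , j , x , inj₁ (q , r))) (inj₂ (k , l , z , inj₁ (q′ , r′))) _ _ with cut-unique x z (inj₁ (inj₁ (trans q (sym q′))))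
    ... | refl , refl = trans r (sym r′)
    Partner-unique c (inj₂ (i , j , x , inj₁ (q , r))) (inj₂ (k , l , z , inj₂ (q′ , r′))) _ _ with cut-unique x z (inj₁ (inj₂ (trans q (sym q′))))
    ... | refl , refl = ⊥-elim (cut-apart x (trans q (sym q′)))
    Partner-unique c (inj₂ (i , j , x , inj₂ (q , r))) (inj₂ (k , l , z , inj₁ (q′ , r′))) _ _ with cut-unique x z (inj₂ (inj₁ (trans q (sym q′))))
    ... | refl , refl = ⊥-elim (cut-apart x (trans q′ (sym q)))
    Partner-unique c (inj₂ (i , j , x , inj₂ (q , r))) (inj₂ (k , l , z , inj₂ (q′ , r′))) _ _ with cut-unique x z (inj₂ (inj₂ (trans q (sym q′))))
    ... | refl , refl = trans r (sym r′)

    module Classes (x y : Fin n → Fin n)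
      (x-closed : ∀ {P : Fin n → Set} → Closed U P → ∀ {u v} → x u ≡ x v → P u → P v)
      (y-closed : ∀ {P : Fin n → Set} → Closed T P → ∀ {u v} → y u ≡ y v → P u → P v)
      (exclusive : ∀ {a b} → (a , b) ∈ U ⊎ (a , b) ∈ T → (x a ≡ x b × y a ≢ y b) ⊎ (x a ≢ x b × y a ≡ y b)) where

      exactly-one : ∀ {u v} → E u v ≡ true → (x u ≡ x v × y u ≢ y v) ⊎ (x u ≢ x v × y u ≡ y v)
      exactly-one {u} {v} e with <-cmp (toℕ u) (toℕ v)
      ... | tri< l _ _ = exclusive (covered l e)
      ... | tri≈ _ q _ = ⊥-elim (E-irrefl (subst (λ w → E u w ≡ true) (sym (FP.toℕ-injective q)) e))
      ... | tri> _ _ l with exclusive (covered l (E-sym e))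
      ...   | inj₁ (p , q) = inj₁ (sym p , q ∘ sym)
      ...   | inj₂ (p , q) = inj₂ (p ∘ sym , sym q)

      x-fibre : ∀ p → count (λ w → does (x w F.≟ p)) (allFin n) ≤ 3 * D
      x-fibre p with count (λ w → does (x w F.≟ p)) (allFin n) in eq
      ... | zero  = z≤n
      ... | suc c with count>0⇒∃ (λ w → does (x w F.≟ p)) (allFin n) (subst (0 <_) (sym eq) (s≤s z≤n))
      ...   | u , _ , eu with block (toℕ u)
      ...     | k , l , h = subst (_≤ 3 * D) eq (count-interval _ ((k ∸ 1) * D) (3 * D) λ w ew →
                let pw = x-closed {P} closed {u} {w} (trans (does-true (x u F.≟ p) eu) (sym (does-true (x w F.≟ p) ew))) (P-u refl)
                in lower-bound (FP.toℕ<n u) pw , <-≤-trans (upper-bound pw) (arith k))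
        where
        open Window (toℕ u) k l h
        arith : ∀ k → (2 + k) * D ≤ (k ∸ 1) * D + 3 * D
        arith zero    = ≤-trans (*-monoˡ-≤ D (n≤1+n 2)) ≤-refl
        arith (suc k) = ≤-reflexive (trans (cong (_* D) (+-comm 3 k)) (*-distribʳ-+ D k 3))

      y-fibre : ∀ p → count (λ w → does (y w F.≟ p)) (allFin n) ≤ 16
      y-fibre p with count (λ w → does (y w F.≟ p)) (allFin n) in eq
      ... | zero  = z≤n
      ... | suc c with count>0⇒∃ (λ w → does (y w F.≟ p)) (allFin n) (subst (0 <_) (sym eq) (s≤s z≤n))
      ...   | u , _ , eu = subst (_≤ 16) eq (≤-trans (count-∨ here′ (inClass (α u)) away (allFin n) split)
                (+-mono-≤ (class≤8 (α u)) (other (count away (allFin n)) refl)))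
        where
        here′ away : Fin n → Bool
        here′ w = does (y w F.≟ p)
        away w = here′ w ∧ not (inClass (α u) w)
        split : ∀ w → here′ w ≡ true → inClass (α u) w ≡ true ⊎ away w ≡ true
        split w e with inClass (α u) w
        ... | true  = inj₁ refl
        ... | false = inj₂ (∧-intro e refl)
        partner : ∀ w → here′ w ≡ true → Partner (α u) w
        partner w e = y-closed {Partner (α u)} (Partner-closed (α u)) (trans (does-true (y u F.≟ p) eu) (sym (does-true (y w F.≟ p) e))) (inj₁ refl)
        away-elim : ∀ w → away w ≡ true → Partner (α u) w × α w ≢ α u
        away-elim w e = let e₁ , e₂ = ∧-true {here′ w} e in partner w e₁ , does-false (α w ≟ᵏ α u) (not-true e₂)
        other : ∀ m → count away (allFin n) ≡ m → count away (allFin n) ≤ 8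
        other zero    e = ≤-trans (≤-reflexive e) z≤n
        other (suc m) e with count>0⇒∃ away (allFin n) (subst (0 <_) (sym e) (s≤s z≤n))
        ... | w₀ , _ , e₀ = ≤-trans (count-mono (allFin n) λ w ew →
                let pw , nw = away-elim w ew
                    p₀ , n₀ = away-elim w₀ e₀
                in dec-true (α w ≟ᵏ α w₀) (Partner-unique (α u) pw p₀ nw n₀)) (class≤8 (α w₀))

-- From transversal cuts to an exclusive partition

sum-indicator : ∀ {A : Set} (p : A → Bool) xs → sum (map (λ x → if p x then 1 else 0) xs) ≡ count p xs
sum-indicator p []       = refl
sum-indicator p (x ∷ xs) with p x
... | true  = cong suc (sum-indicator p xs)
... | false = sum-indicator p xs

Exclusive-partition : ∀ {n} → (Fin n → Fin n → Bool) → ℕ → Set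
Exclusive-partition {n} adj K = ∃ λ (x : Fin n → Fin n) → ∃ λ (y : Fin n → Fin n) →
  (∀ p → count (λ v → does (x v F.≟ p)) (allFin n) ≤ K) ×
  (∀ p → count (λ v → does (y v F.≟ p)) (allFin n) ≤ K) ×
  (∀ {u v} → adj u v ≡ true → (x u ≡ x v × y u ≢ y v) ⊎ (x u ≢ x v × y u ≡ y v))

module _ {n : ℕ} (adj : Fin n → Fin n → Bool) (adj-sym : ∀ i j → adj i j ≡ adj j i)
  (adj-irrefl : ∀ i → adj i i ≡ false) (degree≤3 : ∀ i → count (adj i) (allFin n) ≤ 3) (o : PathOrdering adj) where

  open Decomposition adj adj-sym adj-irrefl degree≤3 o
  open PathOrdering o

  -- A block consists of `W` chunks of 8 path positions, and each chunk offers one candidate for the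
  -- cut. With conflict degree 32 the transversal requires `4 * 32` candidates per block.
  module Blocks (W J : ℕ) (wide : 4 * 32 ≤ W) (W>0 : 0 < W) (J< : J * (W * 8) < n) (n≤ : n ≤ suc J * (W * 8)) where

    origin : Fin J × Fin W → ℕ
    origin (b , ι) = 8 * toℕ (combine b ι)

    fits : ∀ u → origin u + 8 < n
    fits (b , ι) = ≤-<-trans (begin
      8 * c + 8     ≡⟨ lem c ⟩
      8 * suc c     ≤⟨ *-monoʳ-≤ 8 (FP.toℕ<n (combine b ι)) ⟩
      8 * (J * W)   ≡⟨ lem′ J W ⟩
      J * (W * 8)   ∎) J<
      where
      open ≤-Reasoning
      c = toℕ (combine b ι)
      lem : ∀ c → 8 * c + 8 ≡ 8 * suc c
      lem = solve-∀
      lem′ : ∀ J W → 8 * (J * W) ≡ J * (W * 8)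
      lem′ = solve-∀

    Candidates : Set
    Candidates = ∀ u → ∃ λ i → origin u ≤ toℕ i × toℕ i < origin u + 8 × ¬ Monochromatic i

    module _ (cand : Candidates) where

      candidate : Fin J × Fin W → Fin n
      candidate u = proj₁ (cand u)

      ≥origin : ∀ u → origin u ≤ toℕ (candidate u)
      ≥origin u = proj₁ (proj₂ (cand u))

      <origin : ∀ u → toℕ (candidate u) < origin u + 8
      <origin u = proj₁ (proj₂ (proj₂ (cand u)))

      candidate-next : ∀ u → suc (toℕ (candidate u)) < n
      candidate-next u = ≤-<-trans (<origin u) (fits u)

      same-chunk : ∀ {c d m} → 8 * c ≤ m → m < 8 * c + 8 → 8 * d ≤ m → m < 8 * d + 8 → c ≤ d
      same-chunk {c} {d} {m} c≤ _ _ m< = s≤s⁻¹ (*-cancelˡ-< 8 c (suc d) (≤-<-trans c≤ (<-≤-trans m< (≤-reflexive (lem d)))))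
        where
        lem : ∀ c → 8 * c + 8 ≡ 8 * suc c
        lem = solve-∀

      candidate-injective : ∀ u v → candidate u ≡ candidate v → u ≡ v
      candidate-injective u@(b , ι) v@(c , κ) e =
        let l = subst (λ i → origin v ≤ toℕ i) (sym e) (≥origin v)
            h = subst (λ i → toℕ i < origin v + 8) (sym e) (<origin v)
            q = FP.combine-injective b ι c κ (FP.toℕ-injective
                  (≤-antisym (same-chunk (≥origin u) (<origin u) l h) (same-chunk l h (≥origin u) (<origin u))))
        in cong₂ _,_ (proj₁ q) (proj₂ q)

      module _ (τ : Fin J → Fin W) (sep : ∀ {b c} → b ≢ c → ¬ Touch (candidate (b , τ b)) (candidate (c , τ c))) where

        cut : Fin J → Fin n
        cut b = candidate (b , τ b)

        origin≡ : ∀ b ι → origin (b , ι) ≡ toℕ b * (W * 8) + 8 * toℕ ι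
        origin≡ b ι = trans (cong (8 *_) (FP.toℕ-combine b ι)) (lem W (toℕ b) (toℕ ι))
          where
          lem : ∀ W b ι → 8 * (W * b + ι) ≡ b * (W * 8) + 8 * ι
          lem = solve-∀

        cut-≥ : ∀ b → toℕ b * (W * 8) ≤ toℕ (cut b)
        cut-≥ b = ≤-trans (m≤m+n _ _) (≤-trans (≤-reflexive (sym (origin≡ b (τ b)))) (≥origin (b , τ b)))

        cut-< : ∀ b → toℕ (cut b) < suc (toℕ b) * (W * 8)
        cut-< b = <-≤-trans (<origin (b , τ b)) (begin
          origin (b , τ b) + 8                            ≡⟨ cong (_+ 8) (origin≡ b (τ b)) ⟩
          toℕ b * (W * 8) + 8 * toℕ (τ b) + 8            ≡⟨ lem (toℕ b * (W * 8)) (toℕ (τ b)) ⟩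
          toℕ b * (W * 8) + 8 * suc (toℕ (τ b))          ≤⟨ +-monoʳ-≤ (toℕ b * (W * 8)) (*-monoʳ-≤ 8 (FP.toℕ<n (τ b))) ⟩
          toℕ b * (W * 8) + 8 * W                        ≡⟨ lem′ (toℕ b) W ⟩
          suc (toℕ b) * (W * 8)                          ∎)
          where
          open ≤-Reasoning
          lem : ∀ x t → x + 8 * t + 8 ≡ x + 8 * suc t
          lem = solve-∀
          lem′ : ∀ b W → b * (W * 8) + 8 * W ≡ suc b * (W * 8)
          lem′ = solve-∀

        16≤ : 16 ≤ W * 8
        16≤ = ≤-trans (m≤m+n 16 1008) (*-monoˡ-≤ 8 wide)

        open Cut J (W * 8) cut cut-≥ cut-< n≤ 16≤ (λ b → proj₂ (proj₂ (proj₂ (cand (b , τ b))))) sep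

        translate : (∃ λ (x : Fin n → Fin n) → ∃ λ (y : Fin n → Fin n) →
            (∀ {P : Fin n → Set} → Closed U P → ∀ {u v} → x u ≡ x v → P u → P v) ×
            (∀ {P : Fin n → Set} → Closed T P → ∀ {u v} → y u ≡ y v → P u → P v) ×
            (∀ {a b} → (a , b) ∈ U ⊎ (a , b) ∈ T → (x a ≡ x b × y a ≢ y b) ⊎ (x a ≢ x b × y a ≡ y b))) →
          Exclusive-partition adj (3 * (W * 8))
        translate (x , y , x-closed , y-closed , excl) =
          x ∘ position , y ∘ position ,
          (λ p → ≤-trans (pull (λ v → does (x v F.≟ p))) (x-fibre p)) ,
          (λ p → ≤-trans (pull (λ v → does (y v F.≟ p))) (≤-trans (y-fibre p) (≤-trans 16≤ (m≤m+n _ _)))) ,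
          λ {u} {v} e → exactly-one (subst₂ (λ a b → adj a b ≡ true) (sym (name-position u)) (sym (name-position v)) e)
          where
          open Classes x y (λ {P} → x-closed {P}) (λ {P} → y-closed {P}) excl
          pull : (p : Fin n → Bool) → count (p ∘ position) (allFin n) ≤ count p (allFin n)
          pull p = count-inj position (λ u v e → trans (sym (name-position u)) (trans (cong name e) (name-position v))) (p ∘ position) p (λ _ e → e)

        partition′ : Exclusive-partition adj (3 * (W * 8))
        partition′ = translate (Exclusive.exclusive U T forestU forestT)

      from-transversal : (∃ λ (τ : Fin J → Fin W) → ∀ {b c} → b ≢ c → ¬ Touch (candidate (b , τ b)) (candidate (c , τ c))) →
        Exclusive-partition adj (3 * (W * 8))
      from-transversal (τ , sep) = partition′ τ sep

      from-candidates : Exclusive-partition adj (3 * (W * 8))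
      from-candidates = from-transversal (Conflicts.separate J W wide W>0 candidate candidate-injective candidate-next)

    blocks : Exclusive-partition adj (3 * (W * 8))
    blocks = from-candidates (λ u → Chunk.result (origin u) (fits u))

quotient-bounds : ∀ m d → 0 < d → ∃ λ q → q * d < suc m × suc m ≤ suc q * d
quotient-bounds zero    d d>0 = 0 , s≤s z≤n , ≤-trans d>0 (≤-reflexive (sym (+-identityʳ d)))
quotient-bounds (suc m) d d>0 with quotient-bounds m d d>0
... | q , l , h with suc (suc m) ≤? suc q * d
...   | yes h′ = q , ≤-trans l (n≤1+n _) , h′
...   | no ¬h  = suc q , ≰⇒> ¬h , ≤-trans (s≤s h) (+-monoˡ-≤ (suc q * d) d>0)

bounded-partition : ∀ W → 4 * 32 ≤ W → ∀ {n} (H : Graph n) → MaxDegree≤ 3 H → Exclusive-partition (adj H) (3 * (W * 8))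
bounded-partition W wide {zero}  H Δ = (λ ()) , (λ ()) , (λ ()) , (λ ()) , λ { {()} }
bounded-partition W wide {suc m} H Δ =
  let W>0 = ≤-trans (s≤s z≤n) wide
      J , J< , ≤J = quotient-bounds m (W * 8) (≤-trans W>0 (m≤m*n W 8))
  in Blocks.blocks (adj H) (Graph.sym H) (irrefl H) (λ i → subst (_≤ 3) (sum-indicator (adj H i) (allFin (suc m))) (Δ i))
       (ordering (adj H) (Graph.sym H)) W J wide W>0 J< ≤J

-- Embedding into a dense family of grids

-- The quotient of the relation `r` by the classes of `f`; it transfers constraints between vertices
-- to the components that carry the values.
module Linked {n : ℕ} (f : Fin n → Fin n) (r : Fin n → Fin n → Bool) where

  linked? : ∀ p q → Dec (∃ λ u → ∃ λ v → (f u ≡ p × f v ≡ q) × r u v ≡ true)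
  linked? p q = FP.any? λ u → FP.any? λ v → ((f u F.≟ p) ×-dec (f v F.≟ q)) ×-dec (r u v Data.Bool.≟ true)
    where import Data.Bool

  linked : Fin n → Fin n → Bool
  linked p q = does (linked? p q)

  linked-intro : ∀ {u v} → r u v ≡ true → linked (f u) (f v) ≡ true
  linked-intro {u} {v} e = dec-true (linked? (f u) (f v)) (u , v , (refl , refl) , e)

  linked-sym : (∀ {u v} → r u v ≡ true → r v u ≡ true) → Symmetricᵇ linked
  linked-sym s {p} {q} e with does-true (linked? p q) e
  ... | u , v , (refl , refl) , e′ = linked-intro (s e′)

  linked-degree : ∀ K d → (∀ p → count (λ v → does (f v F.≟ p)) (allFin n) ≤ K) →
    (∀ u → count (r u) (allFin n) ≤ d) → ∀ p → count (linked p) (allFin n) ≤ K * d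
  linked-degree K d fibre deg p = begin
    count (linked p) (allFin n)
      ≤⟨ count-⊆ (linked p) ys cover′ ⟩
    length ys
      ≡⟨ trans (length≡∑1 ys) (∑-concatMap (λ u → map f (filterᵇ (r u) (allFin n))) us (λ _ → 1)) ⟩
    ∑ us (λ u → ∑ (map f (filterᵇ (r u) (allFin n))) (λ _ → 1))
      ≤⟨ ∑-≤const us one ⟩
    length us * d
      ≤⟨ *-monoˡ-≤ d (≤-trans (≤-reflexive (length-filterᵇ _ (allFin n))) (fibre p)) ⟩
    K * d ∎
    where
    open ≤-Reasoning
    us : List (Fin n)
    us = filterᵇ (λ v → does (f v F.≟ p)) (allFin n)
    ys : List (Fin n)
    ys = concatMap (λ u → map f (filterᵇ (r u) (allFin n))) us
    one : ∀ u → ∑ (map f (filterᵇ (r u) (allFin n))) (λ _ → 1) ≤ d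
    one u = ≤-trans (≤-reflexive (trans (∑-map f (filterᵇ (r u) (allFin n)) (λ _ → 1))
              (trans (sym (length≡∑1 (filterᵇ (r u) (allFin n)))) (length-filterᵇ (r u) (allFin n))))) (deg u)
    cover′ : ∀ q → linked p q ≡ true → q ∈ ys
    cover′ q e with does-true (linked? p q) e
    ... | u , v , (fu , refl) , e′ = MP.∈-concatMap⁺ (λ u → map f (filterᵇ (r u) (allFin n)))
          (Any.map (λ { refl → MP.∈-map⁺ f (∈-filterᵇ⁺ (r u) (MP.∈-allFin v) e′) })
            (∈-filterᵇ⁺ (λ v → does (f v F.≟ p)) (MP.∈-allFin u) (dec-true (f u F.≟ p) fu)))

same : ∀ {n m} → (Fin n → Fin m) → Fin n → Fin n → Bool
same f u v = does (f u F.≟ f v)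

same-sym : ∀ {n m} (f : Fin n → Fin m) → Symmetricᵇ (same f)
same-sym f {u} {v} e = dec-true (f v F.≟ f u) (sym (does-true (f u F.≟ f v) e))

count-same : ∀ {n m} (f : Fin n → Fin m) K → (∀ p → count (λ v → does (f v F.≟ p)) (allFin n) ≤ K) →
             ∀ u → count (same f u) (allFin n) ≤ K
count-same {n} f K fibre u = ≤-trans (count-mono (allFin n) (λ v e → dec-true (f v F.≟ f u) (sym (does-true (f u F.≟ f v) e)))) (fibre (f u))

count-classes : ∀ {n m} (p : Fin n → Bool) (f : Fin n → Fin m) → (∀ u v → p u ≡ true → p v ≡ true → f u ≡ f v → u ≡ v) →
                count p (allFin n) ≤ m
count-classes {n} {m} p f inj = begin
  count p (allFin n)
    ≤⟨ count-⋃ p (allFin n) (allFin m) (λ c u → p u ∧ does (f u F.≟ c))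
         (λ u e → f u , MP.∈-allFin (f u) , ∧-intro e (dec-true (f u F.≟ f u) refl)) ⟩
  ∑ (allFin m) (λ c → count (λ u → p u ∧ does (f u F.≟ c)) (allFin n))
    ≤⟨ ∑-≤const (allFin m) one ⟩
  length (allFin m) * 1
    ≡⟨ trans (*-identityʳ _) (length-allFin m) ⟩
  m ∎
  where
  open ≤-Reasoning
  one : ∀ c → count (λ u → p u ∧ does (f u F.≟ c)) (allFin n) ≤ 1
  one c = count-≤1 {n} (λ u → p u ∧ does (f u F.≟ c)) λ u v eu ev →
    let pu , fu = ∧-true {p u} eu
        pv , fv = ∧-true {p v} ev
    in inj u v pu pv (trans (does-true (f u F.≟ c) fu) (sym (does-true (f v F.≟ c) fv)))

-- Indices in the same group will receive distinct values; as there are at most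
-- s groups, no value is then taken more than s times.
module Groups {n : ℕ} (s : ℕ) (n≤s² : n ≤ s * s) where

  group offset : Fin n → Fin s
  group q  = proj₁ (F.remQuot {s} s (F.inject≤ q n≤s²))
  offset q = proj₂ (F.remQuot {s} s (F.inject≤ q n≤s²))

  group-offset : ∀ q r → group q ≡ group r → offset q ≡ offset r → q ≡ r
  group-offset q r e e′ = FP.inject≤-injective n≤s² n≤s² q r
    (trans (sym (FP.combine-remQuot {s} s (F.inject≤ q n≤s²)))
      (trans (cong₂ F.combine e e′) (FP.combine-remQuot {s} s (F.inject≤ r n≤s²))))

  group-size : ∀ q → count (same group q) (allFin n) ≤ s
  group-size q = count-classes (same group q) offset λ u v eu ev e →
    group-offset u v (trans (sym (does-true (group q F.≟ group u) eu)) (does-true (group q F.≟ group v) ev)) e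

  load : ∀ {R} (η : Fin n → Fin R) → Separated (same group) η → ∀ g → count (λ q → does (η q F.≟ g)) (allFin n) ≤ s
  load η sep g = count-classes (λ q → does (η q F.≟ g)) group injective
    where
    injective : ∀ u v → does (η u F.≟ g) ≡ true → does (η v F.≟ g) ≡ true → group u ≡ group v → u ≡ v
    injective u v eu ev e with u F.≟ v
    ... | yes q = q
    ... | no ne = ⊥-elim (sep {u} {v} (dec-true (group u F.≟ group v) e) ne (trans (does-true (η u F.≟ g) eu) (sym (does-true (η v F.≟ g) ev))))

module Constraints {n : ℕ} (adj : Fin n → Fin n → Bool) (adj-sym : ∀ i j → adj i j ≡ adj j i)
  (degree≤3 : ∀ i → count (adj i) (allFin n) ≤ 3) where

  -- Each oriented edge of `H` is one constraint of the embedding: filling every slot with the value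
  -- of one class must produce a vector in `E`.
  edges : List (Fin n × Fin n)
  edges = filterᵇ (λ e → adj (proj₁ e) (proj₂ e)) (pairs n n)

  ∈-edges : ∀ {u v} → adj u v ≡ true → (u , v) ∈ edges
  ∈-edges {u} {v} e = ∈-filterᵇ⁺ (λ e → adj (proj₁ e) (proj₂ e)) (∈-pairs u v) e

  count-edges : ∀ p → count p edges ≡ ∑ (allFin n) (λ u → ∑ (allFin n) (λ v → ⟦ adj u v ⟧ * ⟦ p (u , v) ⟧))
  count-edges p = trans (∑-filterᵇ (λ e → adj (proj₁ e) (proj₂ e)) (pairs n n) (λ e → ⟦ p e ⟧)) (∑-pairs n n _)

  weigh : ∀ (p : Fin n → Bool) → ∑ (allFin n) (λ u → ∑ (allFin n) (λ v → ⟦ adj u v ⟧ * ⟦ p u ⟧)) ≤ 3 * count p (allFin n)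
  weigh p = ≤-trans (∑-mono (allFin n) one) (≤-reflexive (∑-*ˡ 3 (allFin n) (λ u → ⟦ p u ⟧)))
    where
    one : ∀ u → ∑ (allFin n) (λ v → ⟦ adj u v ⟧ * ⟦ p u ⟧) ≤ 3 * ⟦ p u ⟧
    one u with p u
    ... | true  = ≤-trans (≤-reflexive (∑-cong (allFin n) (λ v → *-identityʳ _))) (degree≤3 u)
    ... | false = ≤-reflexive (trans (∑-cong (allFin n) (λ v → *-zeroʳ ⟦ adj u v ⟧)) (∑-0 (allFin n)))

  count-fst : ∀ (p : Fin n → Bool) → count (λ e → p (proj₁ e)) edges ≤ 3 * count p (allFin n)
  count-fst p = ≤-trans (≤-reflexive (count-edges (λ e → p (proj₁ e)))) (weigh p)

  count-snd : ∀ (p : Fin n → Bool) → count (λ e → p (proj₂ e)) edges ≤ 3 * count p (allFin n)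
  count-snd p = ≤-trans (≤-reflexive (trans (count-edges (λ e → p (proj₂ e)))
    (trans (∑-swap (allFin n) (allFin n) (λ u v → ⟦ adj u v ⟧ * ⟦ p v ⟧))
      (∑-cong (allFin n) (λ v → ∑-cong (allFin n) (λ u → cong (λ b → ⟦ b ⟧ * ⟦ p v ⟧) (adj-sym u v)))))))
    (weigh p)

  module Keys (f : Fin n → Fin n) {m : ℕ} (part : Fin n → Fin m) where

    -- Slot `σ` belongs to the class of an end with colour `σ`; if neither end has this colour, the
    -- class of `u` fills the slot by default. As `v` takes precedence, `u` finds its class in its
    -- own slot if the two classes coincide or have different colours.
    key : Fin m → Fin n × Fin n → Fin n
    key σ (u , v) = if does (part (f v) F.≟ σ) then f v else f u

    -- A class has at most `K` vertices of degree at most 3 and can enter through either end of an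
    -- oriented edge: `2 * 3 * K`.
    key-fibre : ∀ K → (∀ p → count (λ v → does (f v F.≟ p)) (allFin n) ≤ K) →
      ∀ σ p → count (λ c → does (key σ c F.≟ p)) edges ≤ 6 * K
    key-fibre K fibre σ p = begin
      count (λ c → does (key σ c F.≟ p)) edges
        ≤⟨ count-∨ _ (λ c → does (f (proj₁ c) F.≟ p)) (λ c → does (f (proj₂ c) F.≟ p)) edges split ⟩
      count (λ c → does (f (proj₁ c) F.≟ p)) edges + count (λ c → does (f (proj₂ c) F.≟ p)) edges
        ≤⟨ +-mono-≤ (count-fst (λ v → does (f v F.≟ p))) (count-snd (λ v → does (f v F.≟ p))) ⟩
      3 * count (λ v → does (f v F.≟ p)) (allFin n) + 3 * count (λ v → does (f v F.≟ p)) (allFin n)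
        ≤⟨ +-mono-≤ (*-monoʳ-≤ 3 (fibre p)) (*-monoʳ-≤ 3 (fibre p)) ⟩
      3 * K + 3 * K
        ≡⟨ sym (*-distribʳ-+ K 3 3) ⟩
      6 * K ∎
      where
      open ≤-Reasoning
      split : ∀ c → does (key σ c F.≟ p) ≡ true → does (f (proj₁ c) F.≟ p) ≡ true ⊎ does (f (proj₂ c) F.≟ p) ≡ true
      split (u , v) e with does (part (f v) F.≟ σ)
      ... | true  = inj₂ e
      ... | false = inj₁ e

    key-snd : ∀ {u v} → key (part (f v)) (u , v) ≡ f v
    key-snd {u} {v} rewrite dec-true (part (f v) F.≟ part (f v)) refl = refl

    key-fst : ∀ {u v} → f u ≡ f v ⊎ part (f u) ≢ part (f v) → key (part (f u)) (u , v) ≡ f u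
    key-fst {u} {v} (inj₂ ne) rewrite dec-false (part (f v) F.≟ part (f u)) (ne ∘ sym) = refl
    key-fst {u} {v} (inj₁ e) with does (part (f v) F.≟ part (f u))
    ... | true  = sym e
    ... | false = refl

record GridCopy {n N R : ℕ} {Cell : Set} (adj : Fin n → Fin n → Bool) (cell : Fin R → Fin R → Cell)
  (col : Cell × Fin N → Cell × Fin N → Bool) (colour : Bool) : Set where
  field
    p q       : Fin n → Fin R
    lab       : Fin n → Fin N
    injective : ∀ u v → p u ≡ p v → q u ≡ q v → lab u ≡ lab v → u ≡ v
    coloured  : ∀ u v → adj u v ≡ true → col (cell (p u) (q u) , lab u) (cell (p v) (q v) , lab v) ≡ colour
    aligned   : ∀ u v → adj u v ≡ true → p u ≡ p v ⊎ q u ≡ q v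

module Embed {n : ℕ} (adj : Fin n → Fin n → Bool) (adj-sym : ∀ i j → adj i j ≡ adj j i)
  (degree≤3 : ∀ i → count (adj i) (allFin n) ≤ 3) (K : ℕ) (x y : Fin n → Fin n)
  (x-fibre : ∀ p → count (λ v → does (x v F.≟ p)) (allFin n) ≤ K)
  (y-fibre : ∀ p → count (λ v → does (y v F.≟ p)) (allFin n) ≤ K)
  (exclusive : ∀ {u v} → adj u v ≡ true → (x u ≡ x v × y u ≢ y v) ⊎ (x u ≢ x v × y u ≡ y v))
  (R β B : ℕ) (R≡Bβ : R ≡ B * β) (B>0 : 0 < B) (R>0 : 0 < R)
  (s : ℕ) (n≤s² : n ≤ s * s) (s<β : s < β) (room : K * (s * K) < β) where

  open Constraints adj adj-sym degree≤3
  open Groups {n} s n≤s²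

  -- The number of slots per direction. A class has at most `K` vertices, each sharing its class of
  -- the other kind with at most `K` vertices, so linked classes can be coloured with `K * K + 1`
  -- colours. The ends of an edge then differ in slot where they differ in class, as `row` and
  -- `column` demand.
  a : ℕ
  a = suc (K * K)

  module LX = Linked x (same y)
  module LY = Linked y (same x)

  ClassColouring : (f g : Fin n → Fin n) → Set
  ClassColouring f g = ∃ λ (c : Fin n → Fin a) → Separated (Linked.linked f (same g)) c

  χ-exists : ClassColouring x y
  χ-exists = greedy-colouring (K * K) LX.linked (LX.linked-sym (λ {u} {v} → same-sym y {u} {v}))
    (LX.linked-degree K K x-fibre (count-same y K y-fibre))

  ψ-exists : ClassColouring y x
  ψ-exists = greedy-colouring (K * K) LY.linked (LY.linked-sym (λ {u} {v} → same-sym x {u} {v}))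
    (LY.linked-degree K K y-fibre (count-same x K x-fibre))

  -- Vertices in one `x`-class share their row value and may share their column value as well; the
  -- last component of the label distinguishes them.
  ω-exists : ∃ λ (c : Fin n → Fin (suc K)) → Separated (same x) c
  ω-exists = greedy-colouring K (same x) (λ {u} {v} → same-sym x {u} {v}) (count-same x K x-fibre)

  module _ (χ ψ : Fin n → Fin a) (χ-sep : Separated LX.linked χ) (ψ-sep : Separated LY.linked ψ)
           (ω : Fin n → Fin (suc K)) (ω-sep : Separated (same x) ω) where

    module KX = Keys x χ
    module KY = Keys y ψ

    module _ (η : Fin a → Fin n → Fin R) where

      -- Vertices in the same column slot with the same value. If they lie in different `x`-classes,
      -- these classes must receive different row values to keep the embedding injective.
      collide : Fin n → Fin n → Bool
      collide u v = does (ψ (y u) F.≟ ψ (y v)) ∧ does (η (ψ (y u)) (y u) F.≟ η (ψ (y v)) (y v))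

      collide-elim : ∀ {u v} → collide u v ≡ true → ψ (y u) ≡ ψ (y v) × η (ψ (y u)) (y u) ≡ η (ψ (y v)) (y v)
      collide-elim {u} {v} e = let e₁ , e₂ = ∧-true {does (ψ (y u) F.≟ ψ (y v))} e in
        does-true (ψ (y u) F.≟ ψ (y v)) e₁ , does-true (η (ψ (y u)) (y u) F.≟ η (ψ (y v)) (y v)) e₂

      collide-intro : ∀ {u v} → ψ (y u) ≡ ψ (y v) → η (ψ (y u)) (y u) ≡ η (ψ (y v)) (y v) → collide u v ≡ true
      collide-intro {u} {v} e₁ e₂ = ∧-intro (dec-true (ψ (y u) F.≟ ψ (y v)) e₁) (dec-true (η (ψ (y u)) (y u) F.≟ η (ψ (y v)) (y v)) e₂)

      module LC = Linked x collide

      -- Within a slot at most `s` of the `y`-classes share a value. This is where the square root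
      -- enters: `s` groups of size at most `s` balance the conflicts among column values against
      -- those among row values.
      collide-degree : (∀ t → Separated (same group) (η t)) → ∀ u → count (collide u) (allFin n) ≤ s * K
      collide-degree sep u = begin
        count (collide u) (allFin n)
          ≤⟨ count-⋃ (collide u) (allFin n) qs (λ q v → does (y v F.≟ q))
               (λ v e → y v , ∈-filterᵇ⁺ same-value (MP.∈-allFin (y v)) (value v (collide-elim e)) , dec-true (y v F.≟ y v) refl) ⟩
        ∑ qs (λ q → count (λ v → does (y v F.≟ q)) (allFin n))
          ≤⟨ ∑-≤const qs y-fibre ⟩
        length qs * K
          ≤⟨ *-monoˡ-≤ K (≤-trans (≤-reflexive (length-filterᵇ same-value (allFin n))) (load (η t) (sep t) g)) ⟩
        s * K ∎
        where
        open ≤-Reasoning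
        t = ψ (y u)
        g = η t (y u)
        same-value : Fin n → Bool
        same-value q = does (η t q F.≟ g)
        qs : List (Fin n)
        qs = filterᵇ same-value (allFin n)
        value : ∀ v → ψ (y u) ≡ ψ (y v) × η (ψ (y u)) (y u) ≡ η (ψ (y v)) (y v) → same-value (y v) ≡ true
        value v (e₁ , e₂) = dec-true (η t (y v) F.≟ g) (trans (cong (λ t → η t (y v)) e₁) (sym e₂))

      collide-sym : ∀ {u v} → collide u v ≡ true → collide v u ≡ true
      collide-sym e = let e₁ , e₂ = collide-elim e in collide-intro (sym e₁) (sym e₂)

    EmbeddedGrid : (Vec (Fin R) (a + a) → Bool) → Set
    EmbeddedGrid E = EmbeddedXY R β B (6 * K) R≡Bβ B>0 R>0 edges a a E KY.key (same group) KX.key (λ η → LC.linked η)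

    embedded : ∀ E → Chain R β B (6 * K) R≡Bβ B>0 R>0 (a + a) E → EmbeddedGrid E
    embedded E ch = embedXY R β B (6 * K) R≡Bβ B>0 R>0 edges a a E ch
      KY.key (KY.key-fibre K y-fibre) (same group) (λ {u} {v} → same-sym group {u} {v}) (λ q → ≤-<-trans (group-size q) s<β)
      KX.key (KX.key-fibre K x-fibre) (λ η → LC.linked η) (λ η → LC.linked-sym η (λ {u} {v} → collide-sym η {u} {v}))
      (λ η sep p → ≤-<-trans (LC.linked-degree η K (s * K) x-fibre (collide-degree η sep) p) room)

    module _ {N D : ℕ} {Cell : Set} {pt : Fin R → Fin R → Fin R → Cell} {col : Cell × Fin N → Cell × Fin N → Bool}
             (col-sym : ∀ v w → col v w ≡ col w v) (G : Grid a a (suc K) N D R pt col) where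

      open Grid G

      copy : EmbeddedGrid E → GridCopy adj cell col colour
      copy (ξ , η , ∈E , _ , sepX) = record
        { p = p ; q = q ; lab = lab ; injective = injective ; coloured = coloured ; aligned = aligned }
        where
        p q : Fin n → Fin R
        p v = ξ (χ (x v)) (x v)
        q v = η (ψ (y v)) (y v)
        lab : Fin n → Fin N
        lab v = label (χ (x v)) (ψ (y v)) (ω v)

        injective : ∀ u v → p u ≡ p v → q u ≡ q v → lab u ≡ lab v → u ≡ v
        injective u v ep eq el with label-injective el | x u F.≟ x v | u F.≟ v
        ... | _               | _      | yes e  = e
        ... | _  , _  , eω    | yes ex | no ne  = ⊥-elim (ω-sep {u} {v} (dec-true (x u F.≟ x v) ex) ne eω)
        ... | eχ , eψ , _     | no nx  | no _   = ⊥-elim (sepX (χ (x u)) (LC.linked-intro η (collide-intro η eψ eq)) nx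
                                                    (trans ep (cong (λ σ → ξ σ (x v)) (sym eχ))))

        aligned : ∀ u v → adj u v ≡ true → p u ≡ p v ⊎ q u ≡ q v
        aligned u v e with exclusive e
        ... | inj₁ (ex , _) = inj₁ (cong (λ c → ξ (χ c) c) ex)
        ... | inj₂ (_ , ey) = inj₂ (cong (λ c → η (ψ c) c) ey)

        module _ (u v : Fin n) (e : adj u v ≡ true) where

          ps-at qs-at : Fin a → Fin R
          ps-at σ = ξ σ (KX.key σ (u , v))
          qs-at τ = η τ (KY.key τ (u , v))

          ps qs : Vec (Fin R) a
          ps = tabulate ps-at
          qs = tabulate qs-at

          χ-apart : x u ≢ x v → y u ≡ y v → χ (x u) ≢ χ (x v)
          χ-apart ne ey = χ-sep (LX.linked-intro (dec-true (y u F.≟ y v) ey)) ne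

          ψ-apart : y u ≢ y v → x u ≡ x v → ψ (y u) ≢ ψ (y v)
          ψ-apart ne ex = ψ-sep (LY.linked-intro (dec-true (x u F.≟ x v) ex)) ne

          either-x : x u ≡ x v ⊎ χ (x u) ≢ χ (x v)
          either-x with exclusive e
          ... | inj₁ (ex , _)  = inj₁ ex
          ... | inj₂ (nx , ey) = inj₂ (χ-apart nx ey)

          either-y : y u ≡ y v ⊎ ψ (y u) ≢ ψ (y v)
          either-y with exclusive e
          ... | inj₁ (ex , ny) = inj₂ (ψ-apart ny ex)
          ... | inj₂ (_ , ey)  = inj₁ ey

          p-u : V.lookup ps (χ (x u)) ≡ p u
          p-u = trans (VP.lookup∘tabulate ps-at (χ (x u))) (cong (ξ (χ (x u))) (KX.key-fst {u} {v} either-x))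
          p-v : V.lookup ps (χ (x v)) ≡ p v
          p-v = trans (VP.lookup∘tabulate ps-at (χ (x v))) (cong (ξ (χ (x v))) (KX.key-snd {u} {v}))
          q-u : V.lookup qs (ψ (y u)) ≡ q u
          q-u = trans (VP.lookup∘tabulate qs-at (ψ (y u))) (cong (η (ψ (y u))) (KY.key-fst {u} {v} either-y))
          q-v : V.lookup qs (ψ (y v)) ≡ q v
          q-v = trans (VP.lookup∘tabulate qs-at (ψ (y v))) (cong (η (ψ (y v))) (KY.key-snd {u} {v}))

          point : Fin a → Fin a → Fin (suc K) → Cell × Fin N
          point σ τ l = cell (V.lookup ps σ) (V.lookup qs τ) , label σ τ l

          at-u : point (χ (x u)) (ψ (y u)) (ω u) ≡ (cell (p u) (q u) , lab u)
          at-u = cong₂ (λ a b → cell a b , lab u) p-u q-u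
          at-v : point (χ (x v)) (ψ (y v)) (ω v) ≡ (cell (p v) (q v) , lab v)
          at-v = cong₂ (λ a b → cell a b , lab v) p-v q-v

          settle : col (point (χ (x u)) (ψ (y u)) (ω u)) (point (χ (x v)) (ψ (y v)) (ω v)) ≡ colour →
                   col (cell (p u) (q u) , lab u) (cell (p v) (q v) , lab v) ≡ colour
          settle h = trans (sym (cong₂ col at-u at-v)) h

          in-row : x u ≡ x v → y u ≢ y v → col (point (χ (x u)) (ψ (y u)) (ω u)) (point (χ (x v)) (ψ (y v)) (ω v)) ≡ colour
          in-row ex ny with FP.<-cmp (ψ (y u)) (ψ (y v))
          ... | tri≈ _ z _ = ⊥-elim (ψ-apart ny ex z)
          ... | tri< l _ _ = subst (λ c → col (point (χ (x u)) (ψ (y u)) (ω u)) (point (χ c) (ψ (y v)) (ω v)) ≡ colour) ex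
                (row ps qs (∈E (∈-edges e)) (χ (x u)) (ω u) (ω v) l)
          ... | tri> _ _ l = trans (col-sym _ _) (subst (λ c → col (point (χ c) (ψ (y v)) (ω v)) (point (χ (x u)) (ψ (y u)) (ω u)) ≡ colour) ex
                (row ps qs (∈E (∈-edges e)) (χ (x u)) (ω v) (ω u) l))

          in-column : x u ≢ x v → y u ≡ y v → col (point (χ (x u)) (ψ (y u)) (ω u)) (point (χ (x v)) (ψ (y v)) (ω v)) ≡ colour
          in-column nx ey with FP.<-cmp (χ (x u)) (χ (x v))
          ... | tri≈ _ z _ = ⊥-elim (χ-apart nx ey z)
          ... | tri< l _ _ = subst (λ c → col (point (χ (x u)) (ψ (y u)) (ω u)) (point (χ (x v)) (ψ c) (ω v)) ≡ colour) ey
                (column ps qs (∈E (∈-edges e)) (ψ (y u)) (ω u) (ω v) l)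
          ... | tri> _ _ l = trans (col-sym _ _) (subst (λ c → col (point (χ (x v)) (ψ c) (ω v)) (point (χ (x u)) (ψ (y u)) (ω u)) ≡ colour) ey
                (column ps qs (∈E (∈-edges e)) (ψ (y u)) (ω v) (ω u) l))

        coloured : ∀ u v → adj u v ≡ true → col (cell (p u) (q u) , lab u) (cell (p v) (q v) , lab v) ≡ colour
        coloured u v e = settle u v e ([ (λ h → in-row u v e (proj₁ h) (proj₂ h)) , (λ h → in-column u v e (proj₁ h) (proj₂ h)) ]′ (exclusive e))

  module _ {N D : ℕ} {Cell : Set} {pt : Fin R → Fin R → Fin R → Cell} {col : Cell × Fin N → Cell × Fin N → Bool}
           (col-sym : ∀ v w → col v w ≡ col w v) (G : Grid a a (suc K) N D R pt col)
           (ch : Chain R β B (6 * K) R≡Bβ B>0 R>0 (a + a) (Grid.E G)) where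

    grid-copy : GridCopy adj (Grid.cell G) col (Grid.colour G)
    grid-copy = go χ-exists ψ-exists ω-exists
      where
      go : ClassColouring x y → ClassColouring y x → (∃ λ (c : Fin n → Fin (suc K)) → Separated (same x) c) → GridCopy adj (Grid.cell G) col (Grid.colour G)
      go (χ , χ-sep) (ψ , ψ-sep) (ω , ω-sep) = copy χ ψ χ-sep ψ-sep ω ω-sep col-sym G (embedded χ ψ χ-sep ψ-sep ω ω-sep (Grid.E G) ch)

sum-map : ∀ {A : Set} (f : A → ℕ) xs → sum (map f xs) ≡ ∑ xs f
sum-map f []       = refl
sum-map f (x ∷ xs) = cong (f x +_) (sum-map f xs)

-- The host graph

module Host (R N : ℕ) where

  side : ℕ
  side = R + R

  Cell : Set
  Cell = Fin side × Fin side

  -- a − b, shifted by R to stay in ℕ.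
  diff : Fin R → Fin R → Fin side
  diff a b = fromℕ< {toℕ a + (R ∸ toℕ b)} (+-mono-<-≤ (FP.toℕ<n a) (m∸n≤m R (toℕ b)))

  toℕ-diff : ∀ a b → toℕ (diff a b) ≡ toℕ a + (R ∸ toℕ b)
  toℕ-diff a b = FP.toℕ-fromℕ< _

  diff-injectiveˡ : ∀ {a a′ b} → diff a b ≡ diff a′ b → a ≡ a′
  diff-injectiveˡ {a} {a′} {b} e = FP.toℕ-injective (+-cancelʳ-≡ (R ∸ toℕ b) _ _
    (trans (sym (toℕ-diff a b)) (trans (cong toℕ e) (toℕ-diff a′ b))))

  diff-injectiveʳ : ∀ {a b b′} → diff a b ≡ diff a b′ → b ≡ b′
  diff-injectiveʳ {a} {b} {b′} e = FP.toℕ-injective (∸-cancelˡ-≡ (<⇒≤ (FP.toℕ<n b)) (<⇒≤ (FP.toℕ<n b′))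
    (+-cancelˡ-≡ (toℕ a) _ _ (trans (sym (toℕ-diff a b)) (trans (cong toℕ e) (toℕ-diff a b′)))))

  -- The sum of the coordinates of pt a b c depends on a and c only.
  pt : Fin R → Fin R → Fin R → Cell
  pt a b c = diff a b , diff b c

  Share : Cell → Cell → Set
  Share (i , j) (k , l) = i ≡ k ⊎ j ≡ l ⊎ toℕ i + toℕ j ≡ toℕ k + toℕ l

  Share? : ∀ c d → Dec (Share c d)
  Share? (i , j) (k , l) = (i F.≟ k) ⊎-dec ((j F.≟ l) ⊎-dec (toℕ i + toℕ j ≟ toℕ k + toℕ l))

  Share-sym : ∀ {c d} → Share c d → Share d c
  Share-sym (inj₁ e)        = inj₁ (sym e)
  Share-sym (inj₂ (inj₁ e)) = inj₂ (inj₁ (sym e))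
  Share-sym (inj₂ (inj₂ e)) = inj₂ (inj₂ (sym e))

  pt-sum : ∀ a b c → toℕ (diff a b) + toℕ (diff b c) ≡ toℕ a + R + (R ∸ toℕ c)
  pt-sum a b c = begin
    toℕ (diff a b) + toℕ (diff b c)                 ≡⟨ cong₂ _+_ (toℕ-diff a b) (toℕ-diff b c) ⟩
    toℕ a + (R ∸ toℕ b) + (toℕ b + (R ∸ toℕ c))     ≡⟨ lem (toℕ a) (R ∸ toℕ b) (toℕ b) (R ∸ toℕ c) ⟩
    toℕ a + (R ∸ toℕ b + toℕ b) + (R ∸ toℕ c)       ≡⟨ cong (λ r → toℕ a + r + (R ∸ toℕ c)) (m∸n+n≡m (<⇒≤ (FP.toℕ<n b))) ⟩
    toℕ a + R + (R ∸ toℕ c)                         ∎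
    where
    open ≡-Reasoning
    lem : ∀ w x y z → w + x + (y + z) ≡ w + (x + y) + z
    lem = solve-∀

  share-middle : ∀ a b b′ c → Share (pt a b c) (pt a b′ c)
  share-middle a b b′ c = inj₂ (inj₂ (trans (pt-sum a b c) (sym (pt-sum a b′ c))))

  share-row : ∀ {cell} → Shape pt cell → ∀ p q q′ → Share (cell p q) (cell p q′)
  share-row (xy g) p q q′ = inj₁ refl
  share-row (xz g) p q q′ = inj₁ refl
  share-row (yz g) p q q′ = share-middle p q q′ g

  share-column : ∀ {cell} → Shape pt cell → ∀ p p′ q → Share (cell p q) (cell p′ q)
  share-column (xy g) p p′ q = inj₂ (inj₁ refl)
  share-column (xz g) p p′ q = share-middle g p p′ q
  share-column (yz g) p p′ q = inj₂ (inj₁ refl)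

  cell-injective : ∀ {cell} → Shape pt cell → ∀ {p q p′ q′} → cell p q ≡ cell p′ q′ → p ≡ p′ × q ≡ q′
  cell-injective (xy g) {p} {q} {p′} {q′} e = diff-injectiveˡ {p} {p′} {g} (cong proj₁ e) , diff-injectiveʳ (cong proj₂ e)
  cell-injective (xz g) {p} {q} {p′} {q′} e with diff-injectiveʳ {g} {p} {p′} (cong proj₁ e)
  ... | refl = refl , diff-injectiveʳ (cong proj₂ e)
  cell-injective (yz g) {p} {q} {p′} {q′} e with diff-injectiveˡ {q} {q′} {g} (cong proj₂ e)
  ... | refl = diff-injectiveˡ {p} {p′} {q} (cong proj₁ e) , refl

  order : ℕ
  order = side * (side * N)

  encodeᵛ : Cell × Fin N → Fin order
  encodeᵛ ((i , j) , l) = combine i (combine j l)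

  decodeᵛ : Fin order → Cell × Fin N
  decodeᵛ v = regroup (remQuot {side} (side * N) v)
    where
    regroup : Fin side × Fin (side * N) → Cell × Fin N
    regroup (i , r) = (i , proj₁ (remQuot {side} N r)) , proj₂ (remQuot {side} N r)

  decode-encodeᵛ : ∀ w → decodeᵛ (encodeᵛ w) ≡ w
  decode-encodeᵛ ((i , j) , l) = trans
    (cong (λ r → (proj₁ r , proj₁ (remQuot {side} N (proj₂ r))) , proj₂ (remQuot {side} N (proj₂ r)))
      (FP.remQuot-combine {side} {side * N} i (combine j l)))
    (cong (λ r → (i , proj₁ r) , proj₂ r) (FP.remQuot-combine {side} {N} j l))

  encode-decodeᵛ : ∀ v → encodeᵛ (decodeᵛ v) ≡ v
  encode-decodeᵛ v = trans (cong (combine (proj₁ (remQuot {side} (side * N) v)))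
      (FP.combine-remQuot {side} N (proj₂ (remQuot {side} (side * N) v))))
    (FP.combine-remQuot {side} (side * N) v)

  decodeᵛ-injective : ∀ {v w} → decodeᵛ v ≡ decodeᵛ w → v ≡ w
  decodeᵛ-injective {v} {w} e = trans (sym (encode-decodeᵛ v)) (trans (cong encodeᵛ e) (encode-decodeᵛ w))

  encodeᵛ-injective : ∀ {v w} → encodeᵛ v ≡ encodeᵛ w → v ≡ w
  encodeᵛ-injective {v} {w} e = trans (sym (decode-encodeᵛ v)) (trans (cong decodeᵛ e) (decode-encodeᵛ w))

  cellOf : Fin order → Cell
  cellOf v = proj₁ (decodeᵛ v)

  Adjacent? : ∀ v w → Dec (v ≢ w × Share (cellOf v) (cellOf w))
  Adjacent? v w = ¬? (v F.≟ w) ×-dec Share? (cellOf v) (cellOf w)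

  hostAdj : Fin order → Fin order → Bool
  hostAdj v w = does (Adjacent? v w)

  hostAdj-flip : ∀ v w → hostAdj v w ≡ true → hostAdj w v ≡ true
  hostAdj-flip v w e = let ne , s = does-true (Adjacent? v w) e in dec-true (Adjacent? w v) (ne ∘ sym , Share-sym s)

  hostAdj-sym : ∀ v w → hostAdj v w ≡ hostAdj w v
  hostAdj-sym v w with hostAdj v w in e | hostAdj w v in e′
  ... | true  | true  = refl
  ... | false | false = refl
  ... | true  | false = trans (sym (hostAdj-flip v w e)) e′
  ... | false | true  = sym (trans (sym (hostAdj-flip w v e′)) e)

  host : Graph order
  host = record
    { adj    = hostAdj
    ; sym    = hostAdj-sym
    ; irrefl = λ v → dec-false (Adjacent? v v) (λ h → proj₁ h refl)
    }

  degreeBound : ℕ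
  degreeBound = 3 * (side * N)

  host-degree : ∀ v → count (hostAdj v) (allFin order) ≤ degreeBound
  host-degree v = begin
    count (hostAdj v) (allFin order)
      ≤⟨ count-∨ (hostAdj v) inX (λ w → inY w ∨ inZ w) (allFin order) split ⟩
    count inX (allFin order) + count (λ w → inY w ∨ inZ w) (allFin order)
      ≤⟨ +-mono-≤ boundX (≤-trans (count-∨ (λ w → inY w ∨ inZ w) inY inZ (allFin order) or) (+-mono-≤ boundY boundZ)) ⟩
    side * N + (side * N + side * N)
      ≡⟨ lem (side * N) ⟩
    degreeBound ∎
    where
    open ≤-Reasoning
    lem : ∀ x → x + (x + x) ≡ 3 * x
    lem = solve-∀
    iv = proj₁ (cellOf v)
    jv = proj₂ (cellOf v)
    i j : Fin order → Fin side
    i w = proj₁ (cellOf w)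
    j w = proj₂ (cellOf w)
    l : Fin order → Fin N
    l w = proj₂ (decodeᵛ w)
    inX inY inZ : Fin order → Bool
    inX w = does (iv F.≟ i w)
    inY w = does (jv F.≟ j w)
    inZ w = does (toℕ iv + toℕ jv ≟ toℕ (i w) + toℕ (j w))
    ∨-introˡ : ∀ {a b} → a ≡ true → a ∨ b ≡ true
    ∨-introˡ refl = refl
    ∨-introʳ : ∀ {a b} → b ≡ true → a ∨ b ≡ true
    ∨-introʳ {false} refl = refl
    ∨-introʳ {true}  refl = refl
    or : ∀ w → inY w ∨ inZ w ≡ true → inY w ≡ true ⊎ inZ w ≡ true
    or w e with inY w
    ... | true  = inj₁ refl
    ... | false = inj₂ e
    split : ∀ w → hostAdj v w ≡ true → inX w ≡ true ⊎ inY w ∨ inZ w ≡ true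
    split w e with proj₂ (does-true (Adjacent? v w) e)
    ... | inj₁ h        = inj₁ (dec-true (iv F.≟ i w) h)
    ... | inj₂ (inj₁ h) = inj₂ (∨-introˡ (dec-true (jv F.≟ j w) h))
    ... | inj₂ (inj₂ h) = inj₂ (∨-introʳ {inY w} (dec-true (toℕ iv + toℕ jv ≟ toℕ (i w) + toℕ (j w)) h))
    same-vertex : ∀ {w w′} → i w ≡ i w′ → j w ≡ j w′ → l w ≡ l w′ → w ≡ w′
    same-vertex a b c = decodeᵛ-injective (cong₂ _,_ (cong₂ _,_ a b) c)
    boundX : count inX (allFin order) ≤ side * N
    boundX = count-classes inX (λ w → combine (j w) (l w)) λ w w′ e e′ c →
      let cj , cl = FP.combine-injective (j w) (l w) (j w′) (l w′) c
      in same-vertex (trans (sym (does-true (iv F.≟ i w) e)) (does-true (iv F.≟ i w′) e′)) cj cl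
    boundY : count inY (allFin order) ≤ side * N
    boundY = count-classes inY (λ w → combine (i w) (l w)) λ w w′ e e′ c →
      let ci , cl = FP.combine-injective (i w) (l w) (i w′) (l w′) c
      in same-vertex ci (trans (sym (does-true (jv F.≟ j w) e)) (does-true (jv F.≟ j w′) e′)) cl
    boundZ : count inZ (allFin order) ≤ side * N
    boundZ = count-classes inZ (λ w → combine (i w) (l w)) λ w w′ e e′ c →
      let ci , cl = FP.combine-injective (i w) (l w) (i w′) (l w′) c
      in same-vertex ci (FP.toℕ-injective (+-cancelˡ-≡ (toℕ (i w)) _ _
           (trans (sym (does-true (toℕ iv + toℕ jv ≟ toℕ (i w) + toℕ (j w)) e))
             (trans (does-true (toℕ iv + toℕ jv ≟ toℕ (i w′) + toℕ (j w′)) e′) (cong (λ k → toℕ k + toℕ (j w′)) (sym ci)))))) cl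

  host-edges : edgeCount host ≤ order * degreeBound
  host-edges = begin
    edgeCount host
      ≡⟨ sum-map _ (allFin order) ⟩
    ∑ (allFin order) (λ v → sum (map (λ w → if (toℕ v <ᵇ toℕ w) ∧ hostAdj v w then 1 else 0) (allFin order)))
      ≤⟨ ∑-≤const (allFin order) (λ v → ≤-trans (≤-reflexive (sum-indicator (λ w → (toℕ v <ᵇ toℕ w) ∧ hostAdj v w) (allFin order)))
           (≤-trans (count-mono (allFin order) (λ w e → proj₂ (∧-true {toℕ v <ᵇ toℕ w} e))) (host-degree v))) ⟩
    length (allFin order) * degreeBound
      ≡⟨ cong (_* degreeBound) (length-allFin order) ⟩
    order * degreeBound ∎
    where open ≤-Reasoning

  module _ {n : ℕ} (H : Graph n) (c : Colouring order) where

    col : Cell × Fin N → Cell × Fin N → Bool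
    col v w = c (encodeᵛ v) (encodeᵛ w)

    mono-copy : ∀ {cell colour} → Shape pt cell → GridCopy (adj H) cell col colour → MonoCopy H host c
    mono-copy {cell} {colour} shape copy = colour , φ , φ-injective , edge
      where
      open GridCopy copy
      φ : Fin n → Fin order
      φ u = encodeᵛ (cell (p u) (q u) , lab u)
      φ-injective : ∀ {u v} → φ u ≡ φ v → u ≡ v
      φ-injective {u} {v} e =
        let e′ = encodeᵛ-injective e
            ep , eq = cell-injective shape (cong proj₁ e′)
        in injective u v ep eq (cong proj₂ e′)
      cellOf-φ : ∀ u → cellOf (φ u) ≡ cell (p u) (q u)
      cellOf-φ u = cong proj₁ (decode-encodeᵛ (cell (p u) (q u) , lab u))
      share : ∀ u v → p u ≡ p v ⊎ q u ≡ q v → Share (cell (p u) (q u)) (cell (p v) (q v))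
      share u v (inj₁ e) = subst (λ r → Share (cell (p u) (q u)) (cell r (q v))) e (share-row shape (p u) (q u) (q v))
      share u v (inj₂ e) = subst (λ r → Share (cell (p u) (q u)) (cell (p v) r)) e (share-column shape (p u) (p v) (q u))
      edge : ∀ u v → adj H u v ≡ true → (hostAdj (φ u) (φ v) ≡ true) × (c (φ u) (φ v) ≡ colour)
      edge u v e = dec-true (Adjacent? (φ u) (φ v))
          ((λ h → loop (φ-injective h)) , subst₂ Share (sym (cellOf-φ u)) (sym (cellOf-φ v)) (share u v (aligned u v e))) ,
        coloured u v e
        where
        loop : u ≡ v → ⊥
        loop refl with trans (sym e) (irrefl H u)
        ... | ()

-- Choice of parameters and the final bound

^-distribʳ-* : ∀ o x y → (x * y) ^ o ≡ x ^ o * y ^ o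
^-distribʳ-* zero    x y = refl
^-distribʳ-* (suc o) x y = trans (cong (x * y *_) (^-distribʳ-* o x y)) (lem x y (x ^ o) (y ^ o))
  where
  lem : ∀ x y z w → x * y * (z * w) ≡ x * z * (y * w)
  lem = solve-∀

root : ∀ e → 0 < e → ∀ n → ∃ λ B → B ^ e ≤ n × n < suc B ^ e
root (suc e) _ zero    = 0 , z≤n , m^n>0 1 (suc e)
root (suc e) e>0 (suc n) with root (suc e) e>0 n
... | B , l , h with suc n <? suc B ^ suc e
...   | yes h′ = B , ≤-trans l (n≤1+n n) , h′
...   | no ¬h  = suc B , ≮⇒≥ ¬h , ≤-<-trans h (^-monoˡ-< (suc e) (n<1+n (suc B)))

-- With s about the square root of n and R = B²s, the host has O(B⁶ n^(3/2)) edges;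
-- B ≤ n^(1/e) with e = 7(k+1) leaves one factor B to absorb the constant.
module Parameters (K N : ℕ) (ram : Ramsey 6 8 (size (suc (K * K)) (suc (K * K)) (suc K)) N) (k : ℕ) where

  a r Δ e ρ w t D C B₀ c : ℕ
  a  = suc (K * K)
  r  = a + a
  Δ  = 6 * K
  e  = 7 * suc k
  -- Exponents for which `R ≤ B ^ ρ` and `(1 + R ^ r) ^ Δ ≤ B ^ w`.
  ρ  = 2 + 2 * e
  w  = (1 + ρ * r) * Δ
  -- Because `(4 * C) ^ 2 ≤ B`, the constants `(4 * C) ^ t` consume only `B ^ suc w`; the other half
  -- of `B ^ t` exceeds the number `B ^ w` of tuples.
  t  = 2 * suc w
  D  = suc (length (patterns a a (suc K) N ram))
  C  = iterC t r D
  -- `36864 = 24 ^ 2 * 4 ^ 3`: the edge bound is `24 * N² * R³`, its square is estimated, and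
  -- `s * s ≤ 4 * n` is cubed.
  c  = 36864 * N ^ 4
  -- Each summand secures one demand on `B`: doubling in the estimates, the rounds, the room for row
  -- values, and the constant in the edge bound.
  B₀ = 2 + (4 * C) ^ 2 + K * K + c

  e>0 : 0 < e
  e>0 = s≤s z≤n

  module _ (n : ℕ) (n≥ : B₀ ^ e ≤ n) (B : ℕ) (B≤ : B ^ e ≤ n) (n< : n < suc B ^ e) (s₀ : ℕ) (s₀≤ : s₀ ^ 2 ≤ n) (n<s : n < suc s₀ ^ 2) where

    B≥B₀ : B₀ ≤ B
    B≥B₀ = ≮⇒≥ λ h → <⇒≱ n< (≤-trans (^-monoˡ-≤ e h) n≥)

    B≥2 : 2 ≤ B
    B≥2 = ≤-trans (m≤m+n 2 ((4 * C) ^ 2 + K * K + c)) B≥B₀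

    B>K² : K * K < B
    B>K² = ≤-trans (≤-trans (+-monoˡ-≤ (K * K) {1} {2 + (4 * C) ^ 2} (s≤s z≤n)) (m≤m+n (2 + (4 * C) ^ 2 + K * K) c)) B≥B₀

    B≥4C² : (4 * C) ^ 2 ≤ B
    B≥4C² = ≤-trans (≤-trans (m≤n+m ((4 * C) ^ 2) 2) (≤-trans (m≤m+n (2 + (4 * C) ^ 2) (K * K)) (m≤m+n (2 + (4 * C) ^ 2 + K * K) c))) B≥B₀

    B≥c : c ≤ B
    B≥c = ≤-trans (m≤n+m c (2 + (4 * C) ^ 2 + K * K)) B≥B₀

    B>0 : 0 < B
    B>0 = ≤-trans (s≤s z≤n) B≥2

    instance
      nzB : NonZero B
      nzB = >-nonZero B>0

    s β R : ℕ
    s = suc s₀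
    β = B * s
    R = B * β

    n≤s² : n ≤ s * s
    n≤s² = ≤-trans (<⇒≤ n<s) (≤-reflexive (cong (s *_) (*-identityʳ s)))

    R>0 : 0 < R
    R>0 = *-mono-≤ B>0 (*-mono-≤ B>0 (s≤s (z≤n {s₀})))

    s<β : s < β
    s<β = ≤-trans (≤-trans (m<m+n s (s≤s (z≤n {s₀}))) (≤-reflexive (lem s))) (*-monoˡ-≤ s B≥2)
      where
      lem : ∀ s → s + s ≡ 2 * s
      lem = solve-∀

    room : K * (s * K) < β
    room = subst (_< β) (lem K s) (*-monoˡ-< s B>K²)
      where
      lem : ∀ K s → K * K * s ≡ K * (s * K)
      lem = solve-∀

    1+B≤B² : suc B ≤ B ^ 2
    1+B≤B² = begin
      suc B      ≤⟨ +-monoˡ-≤ B B>0 ⟩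
      B + B      ≡⟨ lem B ⟩
      2 * B      ≤⟨ *-monoˡ-≤ B B≥2 ⟩
      B * B      ≡⟨ cong (B *_) (sym (*-identityʳ B)) ⟩
      B ^ 2      ∎
      where
      open ≤-Reasoning
      lem : ∀ s → s + s ≡ 2 * s
      lem = solve-∀

    s₀≤s₀² : s₀ ≤ s₀ ^ 2
    s₀≤s₀² = go s₀
      where
      go : ∀ m → m ≤ m ^ 2
      go zero    = z≤n
      go (suc m) = ≤-trans (m≤m*n (suc m) (suc m)) (≤-reflexive (cong (suc m *_) (sym (*-identityʳ (suc m)))))

    -- Crude, but `R` merely has to be bounded by a fixed power of `B`, since the number of rounds
    -- may depend on `k`.
    s≤ : s ≤ B ^ (2 * e)
    s≤ = begin
      suc s₀          ≤⟨ s≤s (≤-trans s₀≤s₀² s₀≤) ⟩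
      suc n           ≤⟨ n< ⟩
      suc B ^ e       ≤⟨ ^-monoˡ-≤ e 1+B≤B² ⟩
      (B ^ 2) ^ e     ≡⟨ ^-*-assoc B 2 e ⟩
      B ^ (2 * e)     ∎
      where open ≤-Reasoning

    R≤ : R ≤ B ^ ρ
    R≤ = *-monoʳ-≤ B (*-monoʳ-≤ B s≤)

    1+Rʳ≤ : 1 + R ^ r ≤ B ^ (1 + ρ * r)
    1+Rʳ≤ = begin
      1 + R ^ r                     ≤⟨ +-mono-≤ (m^n>0 B (ρ * r)) (≤-trans (^-monoˡ-≤ r R≤) (≤-reflexive (^-*-assoc B ρ r))) ⟩
      B ^ (ρ * r) + B ^ (ρ * r)     ≡⟨ lem (B ^ (ρ * r)) ⟩
      2 * B ^ (ρ * r)               ≤⟨ *-monoˡ-≤ (B ^ (ρ * r)) B≥2 ⟩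
      B ^ (1 + ρ * r)               ∎
      where
      open ≤-Reasoning
      lem : ∀ s → s + s ≡ 2 * s
      lem = solve-∀

    rare : (4 * C) ^ t * (1 + R ^ r) ^ Δ < B ^ t
    rare = begin-strict
      (4 * C) ^ t * (1 + R ^ r) ^ Δ
        ≤⟨ *-mono-≤ (≤-trans (≤-reflexive (sym (^-*-assoc (4 * C) 2 (suc w)))) (^-monoˡ-≤ (suc w) B≥4C²))
                    (≤-trans (^-monoˡ-≤ Δ 1+Rʳ≤) (≤-reflexive (^-*-assoc B (1 + ρ * r) Δ))) ⟩
      B ^ suc w * B ^ w
        ≡⟨ sym (^-distribˡ-+-* B (suc w) w) ⟩
      B ^ (suc w + w)
        <⟨ ^-monoʳ-< B B≥2 (≤-reflexive (lem w)) ⟩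
      B ^ t ∎
      where
      open ≤-Reasoning
      lem : ∀ w → suc (suc w + w) ≡ 2 * suc w
      lem = solve-∀

    open Host R N using (host; order; degreeBound; host-edges; pt; mono-copy; col)

    s²≤ : s * s ≤ 4 * n
    s²≤ = begin
      s * s                       ≤⟨ *-mono-≤ s≤2s₀ s≤2s₀ ⟩
      (2 * s₀) * (2 * s₀)         ≡⟨ lem s₀ ⟩
      4 * (s₀ * (s₀ * 1))         ≤⟨ *-monoʳ-≤ 4 s₀≤ ⟩
      4 * n                       ∎
      where
      open ≤-Reasoning
      lem : ∀ s → (2 * s) * (2 * s) ≡ 4 * (s * (s * 1))
      lem = solve-∀
      s₀>0 : 0 < s₀
      s₀>0 = n≢0⇒n>0 λ { refl → <⇒≱ n<s (≤-trans (m^n>0 B e) B≤) }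
      s≤2s₀ : s ≤ 2 * s₀
      s≤2s₀ = ≤-trans (+-monoˡ-≤ s₀ s₀>0) (≤-reflexive (cong (s₀ +_) (sym (+-identityʳ s₀))))

    m : ℕ
    m = order * degreeBound

    m²≤ : m ^ 2 ≤ B ^ 14 * n ^ 3
    m²≤ = begin
      m ^ 2
        ≡⟨ lem₁ ⟩
      576 * N ^ 4 * B ^ 12 * ((s * s) ^ 3)
        ≤⟨ *-monoʳ-≤ (576 * N ^ 4 * B ^ 12) (^-monoˡ-≤ 3 s²≤) ⟩
      576 * N ^ 4 * B ^ 12 * ((4 * n) ^ 3)
        ≡⟨ lem₂ N B n ⟩
      36864 * N ^ 4 * (B ^ 12 * n ^ 3)
        -- The constant is rounded up to `B ^ 2` instead of `B`, which makes the total exponent 14,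
        -- twice the 7 in `e`.
        ≤⟨ *-monoˡ-≤ (B ^ 12 * n ^ 3) (≤-trans B≥c (≤-trans (n≤1+n B) 1+B≤B²)) ⟩
      B ^ 2 * (B ^ 12 * n ^ 3)
        ≡⟨ sym (*-assoc (B ^ 2) (B ^ 12) (n ^ 3)) ⟩
      B ^ 2 * B ^ 12 * n ^ 3
        ≡⟨ cong (_* n ^ 3) (sym (^-distribˡ-+-* B 2 12)) ⟩
      B ^ 14 * n ^ 3 ∎
      where
      open ≤-Reasoning
      sixth : ∀ s N B → ((B * (B * s) + B * (B * s)) * ((B * (B * s) + B * (B * s)) * N) * (3 * ((B * (B * s) + B * (B * s)) * N)))
                       ≡ 24 * (N * N) * (B * B * B * (B * B * B)) * (s * s * s)
      sixth = solve-∀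
      square : ∀ N B s → (24 * (N * N) * (B * B * B * (B * B * B)) * (s * s * s)) * (24 * (N * N) * (B * B * B * (B * B * B)) * (s * s * s) * 1)
             ≡ 576 * (N * (N * (N * (N * 1)))) * (B * B * B * (B * B * B) * (B * B * B * (B * B * B))) * (s * s * (s * s * (s * s * 1)))
      square = solve-∀
      B¹² : B * B * B * (B * B * B) * (B * B * B * (B * B * B)) ≡ B ^ 12
      B¹² = lem B
        where
        lem : ∀ B → B * B * B * (B * B * B) * (B * B * B * (B * B * B)) ≡ B * (B * (B * (B * (B * (B * (B * (B * (B * (B * (B * (B * 1)))))))))))
        lem = solve-∀
      lem₁ : m ^ 2 ≡ 576 * N ^ 4 * B ^ 12 * ((s * s) ^ 3)
      lem₁ = trans (cong (_^ 2) (sixth s N B)) (trans (square N B s)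
        (cong (λ b → 576 * N ^ 4 * b * ((s * s) ^ 3)) B¹²))
      lem₂ : ∀ N B n → 576 * N ^ 4 * B ^ 12 * ((4 * n) ^ 3) ≡ 36864 * N ^ 4 * (B ^ 12 * n ^ 3)
      lem₂ N B n = go (N ^ 4) (B ^ 12) n
        where
        go : ∀ x b n → 576 * x * b * (4 * n * (4 * n * (4 * n * 1))) ≡ 36864 * x * (b * (n * (n * (n * 1))))
        go = solve-∀

    -- Since `14 * suc k` is `2 * e`, the powers of `B` combine to the square of `B ^ e ≤ n`, which
    -- is the additional `n ^ 2`.
    m-bound : m ^ (2 * suc k) ≤ n ^ (3 * suc k + 2)
    m-bound = begin
      m ^ (2 * suc k)                            ≡⟨ sym (^-*-assoc m 2 (suc k)) ⟩
      (m ^ 2) ^ suc k                            ≤⟨ ^-monoˡ-≤ (suc k) m²≤ ⟩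
      (B ^ 14 * n ^ 3) ^ suc k                   ≡⟨ ^-distribʳ-* (suc k) (B ^ 14) (n ^ 3) ⟩
      (B ^ 14) ^ suc k * (n ^ 3) ^ suc k         ≡⟨ cong₂ _*_ (trans (^-*-assoc B 14 (suc k)) (trans (cong (B ^_) (exponent k)) (sym (^-*-assoc B e 2)))) (^-*-assoc n 3 (suc k)) ⟩
      (B ^ e) ^ 2 * n ^ (3 * suc k)              ≤⟨ *-monoˡ-≤ (n ^ (3 * suc k)) (^-monoˡ-≤ 2 B≤) ⟩
      n ^ 2 * n ^ (3 * suc k)                    ≡⟨ trans (*-comm (n ^ 2) (n ^ (3 * suc k))) (sym (^-distribˡ-+-* n (3 * suc k) 2)) ⟩
      n ^ (3 * suc k + 2)                        ∎
      where
      open ≤-Reasoning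
      exponent : ∀ k → 14 * suc k ≡ 7 * suc k * 2
      exponent = solve-∀

    arrows : ∀ (H : Graph n) → MaxDegree≤ 3 H → Exclusive-partition (adj H) K → Arrows host H
    arrows H Δ≤3 (x , y , x-fibre , y-fibre , exclusive) colouring colouring-sym =
      finish (grid a a (suc K) N ram R R>0 pt (col H colouring))
      where
      finish : Grid a a (suc K) N (length (patterns a a (suc K) N ram)) R pt (col H colouring) → MonoCopy H host colouring
      finish G = mono-copy H colouring (Grid.shape G)
        (Embed.grid-copy (adj H) (Graph.sym H) (λ i → subst (_≤ 3) (sum-indicator (adj H i) (allFin n)) (Δ≤3 i))
          K x y x-fibre y-fibre exclusive R β B refl B>0 R>0 s n≤s² s<β room (λ v w → colouring-sym _ _) G
          (chain R β B Δ refl B>0 R>0 t r D (Grid.E G) (s≤s z≤n) (≤-trans (Grid.dense G) (m≤n+m _ _)) rare))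

    size-ramsey : ∀ (H : Graph n) → MaxDegree≤ 3 H → Exclusive-partition (adj H) K →
      ∃[ m ] (m ^ (2 * suc k) ≤ n ^ (3 * suc k + 2) × SizeRamsey≤ H m)
    size-ramsey H Δ≤3 part = m , m-bound , order , host , arrows H Δ≤3 part , host-edges

size-ramsey-bound : ∀ K N → Ramsey 6 8 (size (suc (K * K)) (suc (K * K)) (suc K)) N →
  (∀ {n} (H : Graph n) → MaxDegree≤ 3 H → Exclusive-partition (adj H) K) →
  ∀ (k : ℕ) → ∃[ N ] (∀ (n : ℕ) → N ≤ n → ∀ (H : Graph n) → MaxDegree≤ 3 H →
    ∃[ m ] (m ^ (2 * suc k) ≤ n ^ (3 * suc k + 2) × SizeRamsey≤ H m))
size-ramsey-bound K N ram partition k = B₀ ^ e , λ n n≥ H Δ≤3 →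
  finish n n≥ H Δ≤3 (root e e>0 n) (root 2 (s≤s z≤n) n)
  where
  open Parameters K N ram k using (B₀; e; e>0; size-ramsey)
  finish : ∀ n → B₀ ^ e ≤ n → ∀ (H : Graph n) → MaxDegree≤ 3 H → (∃ λ B → B ^ e ≤ n × n < suc B ^ e) →
    (∃ λ s → s ^ 2 ≤ n × n < suc s ^ 2) → ∃[ m ] (m ^ (2 * suc k) ≤ n ^ (3 * suc k + 2) × SizeRamsey≤ H m)
  finish n n≥ H Δ≤3 (B , B≤ , n<) (s₀ , s₀≤ , n<s) = size-ramsey n n≥ B B≤ n< s₀ s₀≤ n<s H Δ≤3 (partition H Δ≤3)

-- The quotient of the two exponents is `3/2 + 1/(k + 1)`. Having a threshold for every `k` is the
-- meaning of `o(1)` without real exponents.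
theorem1p1 : ∀ (k : ℕ) → ∃[ N ] (∀ (n : ℕ) → N ≤ n → ∀ (H : Graph n) → MaxDegree≤ 3 H →
    ∃[ m ] (m ^ (2 * suc k) ≤ n ^ (3 * suc k + 2) × SizeRamsey≤ H m))
-- `128 = 4 * 32` is the smallest admissible block width. A component then has at most three blocks
-- of `128 * 8` positions.
theorem1p1 = size-ramsey-bound (3 * (128 * 8)) (proj₁ R₀) (proj₂ R₀) (bounded-partition 128 ≤-refl)
  where
  R₀ = ramsey 6 8 (size (suc (3 * (128 * 8) * (3 * (128 * 8)))) (suc (3 * (128 * 8) * (3 * (128 * 8)))) (suc (3 * (128 * 8))))
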